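{- For every integer $k\ge1$, $$\frac{(q,q^{2k+2},q^{2k+3};q^{2k+3})_\infty}{(q)_\infty^{2k+1}}=\sum_{n_1,n_2,\dots,n_{2k}\ge0}\frac{q^{\sum_{i=1}^{2k-1}n_in_{i+1}+\sum_{i=1}^{2k}n_i}}{(q)_{n_1}^2(q)_{n_2}^2\cdots(q)_{n_{2k}}^2}.$$
   Context: Here $|q|<1$; $(q)_n:=\prod_{j=1}^n(1-q^j)$ for $n\ge0$ and $(q)_\infty:=\prod_{j\ge1}(1-q^j)$. For a base $p$ with $|p|<1$, $(a;p)_\infty:=\prod_{j\ge0}(1-ap^j)$ and $(a,b,c;p)_\infty:=(a;p)_\infty(b;p)_\infty(c;p)_\infty$. -}

module Defs where

open import Algebra.Apartness.Bundles using (HeytingField)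
open import Algebra.Bundles using (CommutativeRing; CommutativeSemiring; RawRing)
open import Data.Empty using (⊥-elim)
open import Data.List.Base as List using (List)
open import Data.List.Relation.Binary.Subset.Propositional using (_⊆_)
open import Data.List.Relation.Unary.Unique.Propositional using (Unique)
open import Data.Nat.Base as ℕ using (ℕ; zero; suc)
open import Data.Product.Base using (Σ-syntax; ∃-syntax; _×_; _,_; proj₁; proj₂)
open import Data.Sum.Base using (_⊎_; inj₁; inj₂)
open import Data.Vec.Base as Vec using (Vec; []; _∷_)
open import Level using (Level; _⊔_) renaming (suc to lsuc)
open import Relation.Binary.Core using (Rel)
open import Relation.Binary.Structures using (IsStrictPartialOrder)
open import Relation.Nullary.Negation using (¬_)
import Algebra.Definitions.RawMonoid as RawMonoidDefs
import Algebra.Definitions.RawSemiring as RawSemiringDefs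
import Algebra.Properties.Ring as RingProperties
import Algebra.Solver.Ring.NaturalCoefficients.Default as SemiringSolver

-- The real numbers, axiomatised as an Archimedean, Cauchy complete ordered
-- field.  Classically this determines ℝ up to isomorphism.  The axioms are the
-- constructive ones (no decidability of the order, inverses only for elements
-- apart from 0), so they impose nothing beyond what the usual Cauchy reals
-- satisfy.
record RealField c ℓ₁ ℓ₂ : Set (lsuc (c ⊔ ℓ₁ ⊔ ℓ₂)) where
  infix 4 _<_
  field
    heytingField : HeytingField c ℓ₁ ℓ₂

  open HeytingField heytingField public

  commutativeRing : CommutativeRing c ℓ₁
  commutativeRing = record { isCommutativeRing = isCommutativeRing }

  private
    module Multiples = RawMonoidDefs (CommutativeRing.+-rawMonoid commutativeRing)

  fromℕ : ℕ → Carrier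
  fromℕ n = Multiples._×_ n 1#

  field
    _<_                  : Rel Carrier ℓ₂
    isStrictPartialOrder : IsStrictPartialOrder _≈_ _<_
    <⇒#                  : ∀ {x y} → x < y → x # y
    #⇒<⊎>                : ∀ {x y} → x # y → x < y ⊎ y < x
    +-monoˡ-<            : ∀ z {x y} → x < y → x + z < y + z
    *-positive           : ∀ {x y} → 0# < x → 0# < y → 0# < x * y
    archimedean          : ∀ x → ∃[ n ] (x < fromℕ n)

  infix 4 ∣_∣<_
  ∣_∣<_ : Carrier → Carrier → Set ℓ₂
  ∣ x ∣< ε = (- ε < x) × (x < ε)

  field
    complete : (s : ℕ → Carrier) →
      (∀ ε → 0# < ε → ∃[ N ] (∀ m n → N ℕ.≤ m → N ℕ.≤ n → ∣ s m - s n ∣< ε)) →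
      ∃[ L ] (∀ ε → 0# < ε → ∃[ N ] (∀ n → N ℕ.≤ n → ∣ s n - L ∣< ε))

module OrderLemmas {c ℓ₁ ℓ₂} (ℛ : RealField c ℓ₁ ℓ₂) where

  open RealField ℛ
  open RingProperties (CommutativeRing.ring commutativeRing)
  open SemiringSolver (CommutativeRing.commutativeSemiring commutativeRing)
  open IsStrictPartialOrder isStrictPartialOrder
    using (<-respˡ-≈; <-respʳ-≈) renaming (irrefl to <-irrefl; trans to <-trans) public

  infix 4 _≤_
  _≤_ : Rel Carrier ℓ₂
  x ≤ y = ¬ (y < x)

  <-asym : ∀ {x y} → x < y → ¬ (y < x)
  <-asym x<y y<x = <-irrefl refl (<-trans x<y y<x)

  <-cotrans : ∀ {x y} → x < y → ∀ z → x < z ⊎ z < y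
  <-cotrans x<y z with #-cotrans (<⇒# x<y) z
  ... | inj₁ x#z with #⇒<⊎> x#z
  ...   | inj₁ x<z = inj₁ x<z
  ...   | inj₂ z<x = inj₂ (<-trans z<x x<y)
  <-cotrans x<y z | inj₂ z#y with #⇒<⊎> z#y
  ...   | inj₁ z<y = inj₂ z<y
  ...   | inj₂ y<z = inj₁ (<-trans x<y y<z)

  x-0≈x : ∀ x → x - 0# ≈ x
  x-0≈x x = trans (+-congˡ -0#≈0#) (+-identityʳ x)

  x<y⇒0<y-x : ∀ {x y} → x < y → 0# < y - x
  x<y⇒0<y-x {x} x<y = <-respˡ-≈ (-‿inverseʳ x) (+-monoˡ-< (- x) x<y)

  0<y-x⇒x<y : ∀ {x y} → 0# < y - x → x < y
  0<y-x⇒x<y {x} {y} p = <-respˡ-≈ (+-identityˡ x) (<-respʳ-≈ eq (+-monoˡ-< x p))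
    where
    eq : (y - x) + x ≈ y
    eq = trans (+-assoc y (- x) x) (trans (+-congˡ (-‿inverseˡ x)) (+-identityʳ y))

  -x*-x≈x*x : ∀ x → (- x) * (- x) ≈ x * x
  -x*-x≈x*x x = trans (sym (-‿distribˡ-* x (- x)))
    (trans (-‿cong (sym (-‿distribʳ-* x x))) (-‿involutive (x * x)))

  x<0⇒0<-x : ∀ {x} → x < 0# → 0# < - x
  x<0⇒0<-x x<0 = <-respʳ-≈ (+-identityˡ _) (x<y⇒0<y-x x<0)

  x#0⇒0<x² : ∀ {x} → x # 0# → 0# < x * x
  x#0⇒0<x² {x} x#0 with #⇒<⊎> x#0
  ... | inj₁ x<0 = <-respʳ-≈ (-x*-x≈x*x x) (*-positive (x<0⇒0<-x x<0) (x<0⇒0<-x x<0))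
  ... | inj₂ 0<x = *-positive 0<x 0<x

  xy#0⇒x#0 : ∀ {x y} → x * y # 0# → x # 0#
  xy#0⇒x#0 {x} {y} xy#0 = invertible⇒#
    ( y * i
    , trans (*-comm _ _) xyi≈1
    , xyi≈1 )
    where
    inverse = #⇒invertible xy#0
    i       = proj₁ inverse
    xyi≈1 : (x - 0#) * (y * i) ≈ 1#
    xyi≈1 = trans (*-congʳ (x-0≈x x)) (trans (sym (*-assoc x y i))
      (trans (*-congʳ (sym (x-0≈x (x * y)))) (proj₂ (proj₂ inverse))))

  0<1 : 0# < 1#
  0<1 = <-respʳ-≈ (*-identityˡ 1#) (x#0⇒0<x² (invertible⇒#
    (1# , trans (*-identityˡ _) (x-0≈x 1#) , trans (*-identityʳ _) (x-0≈x 1#))))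

  0≤x² : ∀ x → 0# ≤ x * x
  0≤x² x x²<0 = <-asym x²<0 (x#0⇒0<x² (xy#0⇒x#0 (<⇒# x²<0)))

  +-pos-nonneg : ∀ {x y} → 0# < x → 0# ≤ y → 0# < x + y
  +-pos-nonneg {x} {y} 0<x 0≤y
    with <-cotrans (<-respˡ-≈ (+-identityˡ y) (+-monoˡ-< y 0<x)) 0#
  ... | inj₁ y<0   = ⊥-elim (0≤y y<0)
  ... | inj₂ 0<x+y = 0<x+y

  *-nonneg-pos : ∀ {x y} → 0# ≤ x → 0# < y → 0# ≤ x * y
  *-nonneg-pos 0≤x 0<y xy<0 with #⇒<⊎> (xy#0⇒x#0 (<⇒# xy<0))
  ... | inj₁ x<0 = 0≤x x<0
  ... | inj₂ 0<x = <-asym xy<0 (*-positive 0<x 0<y)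

  0≤x²+y² : ∀ x y → 0# ≤ x * x + y * y
  0≤x²+y² x y s<0 with <-cotrans s<0 (y * y)
  ... | inj₂ y²<0 = 0≤x² y y²<0
  ... | inj₁ s<y² = 0≤x² x (<-respˡ-≈ eq (<-respʳ-≈ (-‿inverseʳ (y * y)) (+-monoˡ-< (- (y * y)) s<y²)))
    where
    eq : (x * x + y * y) - y * y ≈ x * x
    eq = trans (+-assoc _ _ _) (trans (+-congˡ (-‿inverseʳ (y * y))) (+-identityʳ _))

  *-<1 : ∀ {x y} → 0# ≤ y → x < 1# → y < 1# → x * y < 1#
  *-<1 {x} {y} 0≤y x<1 y<1 = 0<y-x⇒x<y (<-respʳ-≈ eq
    (+-pos-nonneg (x<y⇒0<y-x y<1) (*-nonneg-pos 0≤y (x<y⇒0<y-x x<1))))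
    where
    eq : (1# - y) + y * (1# - x) ≈ 1# - x * y
    eq = trans (+-congˡ (trans (distribˡ y 1# (- x)) (+-cong (*-identityʳ y)
           (trans (sym (-‿distribʳ-* y x)) (-‿cong (*-comm y x))))))
         (trans (+-assoc 1# (- y) _) (+-congˡ
           (trans (sym (+-assoc (- y) y _)) (trans (+-congʳ (-‿inverseˡ y)) (+-identityˡ _)))))

module Complex {c ℓ₁ ℓ₂} (ℛ : RealField c ℓ₁ ℓ₂) where

  open RealField ℛ renaming
    ( Carrier to ℝ; _+_ to _+ᵣ_; _*_ to _*ᵣ_; -_ to -ᵣ_; _-_ to _-ᵣ_
    ; 0# to 0ᵣ; 1# to 1ᵣ; _≈_ to _≈ᵣ_; ∣_∣<_ to ∣_∣ᵣ<_ )
  open OrderLemmas ℛ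

  infix 4 _+i_
  record ℂ : Set c where
    constructor _+i_
    field
      re im : ℝ
  open ℂ public

  ℂ-rawRing : RawRing c ℓ₁
  ℂ-rawRing = record
    { Carrier = ℂ
    ; _≈_     = λ z w → (re z ≈ᵣ re w) × (im z ≈ᵣ im w)
    ; _+_     = λ z w → re z +ᵣ re w +i im z +ᵣ im w
    ; _*_     = λ z w → re z *ᵣ re w -ᵣ im z *ᵣ im w +i re z *ᵣ im w +ᵣ im z *ᵣ re w
    ; -_      = λ z → -ᵣ re z +i -ᵣ im z
    ; 0#      = 0ᵣ +i 0ᵣ
    ; 1#      = 1ᵣ +i 0ᵣ
    }

  open RawRing ℂ-rawRing public using (_≈_; _+_; _*_; -_; 0#; 1#)
  open RawSemiringDefs (RawRing.rawSemiring ℂ-rawRing) public using (_^_)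

  infixl 6 _-_
  _-_ : ℂ → ℂ → ℂ
  z - w = z + (- w)

  ∣_∣² : ℂ → ℝ
  ∣ z ∣² = re z *ᵣ re z +ᵣ im z *ᵣ im z

  -- |z| < r in square-root-free form; it has this meaning for r ≥ 0, and is
  -- only used for such r.
  infix 4 ∣_∣<_
  ∣_∣<_ : ℂ → ℝ → Set ℓ₂
  ∣ z ∣< r = ∣ z ∣² < r *ᵣ r

  -- z ≠ 0, in the constructively positive form |z| > 0.
  Nonzero : ℂ → Set ℓ₂
  Nonzero z = 0ᵣ < ∣ z ∣²

  infixl 7 _/_
  _/_ : ℂ → (w : ℂ) → {{Nonzero w}} → ℂ
  _/_ z w {{0<∣w∣²}} = z * (r *ᵣ re w +i r *ᵣ (-ᵣ im w))
    where
    -- The inverse of |w|² - 0.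
    r : ℝ
    r = proj₁ (#⇒invertible (#-sym (<⇒# 0<∣w∣²)))

  infix 4 _⟶_
  _⟶_ : (ℕ → ℂ) → ℂ → Set (c ⊔ ℓ₂)
  s ⟶ L = ∀ ε → 0ᵣ < ε → ∃[ N ] (∀ n → N ℕ.≤ n → ∣ s n - L ∣< ε)

  sumOver : ∀ {i} {I : Set i} → (I → ℂ) → List I → ℂ
  sumOver f = List.foldr (λ x s → f x + s) 0#

  -- Unconditional summability: the net of sums over finite subsets of I
  -- (duplicate-free lists, ordered by inclusion) converges to S.
  HasSum : ∀ {i} {I : Set i} → (I → ℂ) → ℂ → Set (c ⊔ ℓ₂ ⊔ i)
  HasSum {I = I} f S = ∀ ε → 0ᵣ < ε →
    Σ[ F₀ ∈ List I ] (∀ F → Unique F → F₀ ⊆ F → ∣ sumOver f F - S ∣< ε)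

  -- (a;p)_n = ∏_{0 ≤ j < n} (1 - a pʲ).  As q ^ suc j is q * q ^ j by
  -- definition, poch q q n is (q)_n = ∏_{1 ≤ j ≤ n} (1 - qʲ).
  poch : ℂ → ℂ → ℕ → ℂ
  poch a p zero    = 1#
  poch a p (suc n) = poch a p n * (1# - a * p ^ n)

  -- (a;p)_∞ converges, with value P.
  poch∞ : ℂ → ℂ → ℂ → Set (c ⊔ ℓ₂)
  poch∞ a p P = poch a p ⟶ P

  module _ where
    open RingProperties (CommutativeRing.ring commutativeRing)
    open SemiringSolver (CommutativeRing.commutativeSemiring commutativeRing)

    private
      -- (x - y)² + (z + w)² when xy = zw.
      cancel-cross : ∀ x y z w → x *ᵣ y ≈ᵣ z *ᵣ w →
        (x -ᵣ y) *ᵣ (x -ᵣ y) +ᵣ (z +ᵣ w) *ᵣ (z +ᵣ w) ≈ᵣ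
        (x *ᵣ x +ᵣ y *ᵣ y) +ᵣ (z *ᵣ z +ᵣ w *ᵣ w)
      cancel-cross x y z w xy≈zw =
        trans (solve 4 (λ x n z w → (x :+ n) :* (x :+ n) :+ (z :+ w) :* (z :+ w) :=
                  (x :* x :+ n :* n) :+ (z :* z :+ w :* w)
                  :+ con 2 :* (x :* n :+ z :* w)) refl x (-ᵣ y) z w)
        (trans (+-cong (+-congʳ (+-congˡ (-x*-x≈x*x y)))
                 (trans (*-congˡ zero-cross) (zeroʳ _)))
               (+-identityʳ _))
        where
        zero-cross : x *ᵣ (-ᵣ y) +ᵣ z *ᵣ w ≈ᵣ 0ᵣ
        zero-cross = trans (+-cong (sym (-‿distribʳ-* x y)) (sym xy≈zw)) (-‿inverseˡ _)

    ∣∣²-* : ∀ z w → ∣ z * w ∣² ≈ᵣ ∣ z ∣² *ᵣ ∣ w ∣²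
    ∣∣²-* (a +i b) (d +i e) = trans
      (cancel-cross (a *ᵣ d) (b *ᵣ e) (a *ᵣ e) (b *ᵣ d)
        (solve 4 (λ a b d e → (a :* d) :* (b :* e) := (a :* e) :* (b :* d)) refl a b d e))
      (solve 4 (λ a b d e →
        ((a :* d) :* (a :* d) :+ (b :* e) :* (b :* e))
          :+ ((a :* e) :* (a :* e) :+ (b :* d) :* (b :* d))
        := (a :* a :+ b :* b) :* (d :* d :+ e :* e)) refl a b d e)

    ∣1∣²≈1 : ∣ 1# ∣² ≈ᵣ 1ᵣ
    ∣1∣²≈1 = trans (+-cong (*-identityˡ 1ᵣ) (zeroˡ 0ᵣ)) (+-identityʳ 1ᵣ)

    1-nonzero : Nonzero 1#
    1-nonzero = <-respʳ-≈ (sym ∣1∣²≈1) 0<1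

    *-nonzero : ∀ z w → Nonzero z → Nonzero w → Nonzero (z * w)
    *-nonzero z w z≠0 w≠0 = <-respʳ-≈ (sym (∣∣²-* z w)) (*-positive z≠0 w≠0)

    ^-nonzero : ∀ z n → Nonzero z → Nonzero (z ^ n)
    ^-nonzero z zero    z≠0 = 1-nonzero
    ^-nonzero z (suc n) z≠0 = *-nonzero z (z ^ n) z≠0 (^-nonzero z n z≠0)

    ∣q^1+n∣²<1 : ∀ q → ∣ q ∣< 1ᵣ → ∀ n → ∣ q ^ suc n ∣² < 1ᵣ
    ∣q^1+n∣²<1 q q<1 zero = <-respˡ-≈ (sym eq) (<-respʳ-≈ (*-identityˡ 1ᵣ) q<1)
      where
      eq : ∣ q * 1# ∣² ≈ᵣ ∣ q ∣²
      eq = trans (∣∣²-* q 1#) (trans (*-congˡ ∣1∣²≈1) (*-identityʳ _))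
    ∣q^1+n∣²<1 q q<1 (suc n) = <-respˡ-≈ (sym (∣∣²-* q (q ^ suc n)))
      (*-<1 (0≤x²+y² _ _) (<-respʳ-≈ (*-identityˡ 1ᵣ) q<1) (∣q^1+n∣²<1 q q<1 n))

    ∣w∣²<1⇒1-w-nonzero : ∀ w → ∣ w ∣² < 1ᵣ → Nonzero (1# - w)
    ∣w∣²<1⇒1-w-nonzero (x +i y) p = +-pos-nonneg (x#0⇒0<x² (xy#0⇒x#0 1-x²#0)) (0≤x² _)
      where
      0<1-x² : 0ᵣ < 1ᵣ -ᵣ x *ᵣ x
      0<1-x² = <-respʳ-≈ eq (+-pos-nonneg (x<y⇒0<y-x p) (0≤x² y))
        where
        eq : (1ᵣ -ᵣ (x *ᵣ x +ᵣ y *ᵣ y)) +ᵣ y *ᵣ y ≈ᵣ 1ᵣ -ᵣ x *ᵣ x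
        eq = trans (+-congʳ (+-congˡ (sym (-‿+-comm (x *ᵣ x) (y *ᵣ y)))))
          (trans (solve 4 (λ o m n t → (o :+ (m :+ n)) :+ t := (o :+ m) :+ (n :+ t))
                   refl 1ᵣ (-ᵣ (x *ᵣ x)) (-ᵣ (y *ᵣ y)) (y *ᵣ y))
            (trans (+-congˡ (-‿inverseˡ _)) (+-identityʳ _)))

      factor : 1ᵣ -ᵣ x *ᵣ x ≈ᵣ (1ᵣ -ᵣ x) *ᵣ (1ᵣ +ᵣ x)
      factor = sym (trans
        (solve 2 (λ x n → (con 1 :+ n) :* (con 1 :+ x) := (con 1 :+ n :* x) :+ (n :+ x)) refl x (-ᵣ x)
          ) (trans (+-cong (+-congˡ (sym (-‿distribˡ-* x x))) (-‿inverseˡ x)) (+-identityʳ _)))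

      1-x²#0 : (1ᵣ -ᵣ x) *ᵣ (1ᵣ +ᵣ x) # 0ᵣ
      1-x²#0 = #-sym (<⇒# (<-respʳ-≈ factor 0<1-x²))

    poch-nonzero : ∀ q → ∣ q ∣< 1ᵣ → ∀ n → Nonzero (poch q q n)
    poch-nonzero q q<1 zero    = 1-nonzero
    poch-nonzero q q<1 (suc n) = *-nonzero (poch q q n) (1# - q ^ suc n) (poch-nonzero q q<1 n)
      (∣w∣²<1⇒1-w-nonzero (q ^ suc n) (∣q^1+n∣²<1 q q<1 n))

  -- ∑_{1 ≤ i < m} nᵢ nᵢ₊₁
  adjacentProducts : ∀ {m} → Vec ℕ m → ℕ
  adjacentProducts []           = 0
  adjacentProducts (a ∷ [])     = 0
  adjacentProducts (a ∷ b ∷ ns) = a ℕ.* b ℕ.+ adjacentProducts (b ∷ ns)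

  -- ∏ᵢ (q)_{nᵢ}²
  denominator : ∀ {m} → ℂ → Vec ℕ m → ℂ
  denominator q []       = 1#
  denominator q (n ∷ ns) = poch q q n ^ 2 * denominator q ns

  denominator-nonzero : ∀ {m} q → ∣ q ∣< 1ᵣ → (ns : Vec ℕ m) → Nonzero (denominator q ns)
  denominator-nonzero q q<1 []       = 1-nonzero
  denominator-nonzero q q<1 (n ∷ ns) = *-nonzero (poch q q n ^ 2) (denominator q ns)
    (^-nonzero (poch q q n) 2 (poch-nonzero q q<1 n)) (denominator-nonzero q q<1 ns)

  summand : ∀ {m} q → ∣ q ∣< 1ᵣ → Vec ℕ m → ℂ
  summand q q<1 ns = _/_ (q ^ (adjacentProducts ns ℕ.+ Vec.sum ns)) (denominator q ns)
    {{denominator-nonzero q q<1 ns}}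

{-# OPTIONS --safe #-}
module Submission where

-- Let T be the operator (T g)(m) = ∑ₙ q^(n(m+1)) g(n) / (q)ₙ².  The multiple series
-- is the value at 0 of T²ᵏ 1, and its sum over the cube of all nᵢ < N is the same
-- expression for the operator T N truncated to n < N (chain-cube).
--
-- The functions φ n : l ↦ (q)ₗ₊ₙ / (q)ₙ² span a space that T² preserves:
-- expanding (q)ₗ₊ₙ by the q-Vandermonde sum (vandermonde-finite) and summing twice
-- with Euler's formula ∑ₘ q^(m(s+1)) / (q)ₘ = (q)ₛ / (q)_∞ gives
--   T² (φ n) = (q)_∞⁻² ∑ⱼ q^(j²+j) / (q)ₙ₋ⱼ · φ j,
-- for T N up to an error O(ρᴺ) (O-T²-φ).  The coefficients are those of the Bailey
-- chain (β-step), and φ n 0 = 1/(q)ₙ is its first member (β-one).  Hence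
--   (T²ᵏ (φ n)) 0 = (q)_∞⁻²ᵏ βₙ  with  βₙ = ∑ᵣ αᵣ / ((q)ₙ₋ᵣ (q)ₙ₊ᵣ₊₁)
-- and αᵣ = (-1)ʳ q^(r(r-1)/2 + (k+1)(r²+r)) (1 - q²ʳ⁺¹) (O-T^-φ).
--
-- Now let n grow.  On the left (q)ₙ² φ n tends to the constant (q)_∞, uniformly in
-- its argument (O-weighted); on the right (q)ₙ² βₙ tends to ∑ᵣ αᵣ (O-β).  By the
-- triple product in base q²ᵏ⁺³ at z = q this theta series is the product in the
-- numerator of the identity (O-theta).  A finite form of the triple product with
-- Gaussian binomials (tripleProduct) serves twice: for this limit, and at z = q,
-- w = 1 for the unit Bailey pair from which the chain starts (β-unit).
--
-- All limits are taken with a rate: ρ < 1 is fixed with |q| ≤ ρ, errors are recorded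
-- as O(ρᴺ), uniformly in all other variables, so that exchanging limits and sums
-- amounts to adding up a geometric series of error terms (O-∑).  The algebra is
-- done in an arbitrary commutative ring, and the estimates in a ring with a
-- complete norm, where |z| ≤ B is a relation between z and a real number B.
-- Finally the summand is at most κᵐ ρ^(n₁ + ⋯ + nₘ), with m = 2k, so convergence of
-- the sums over cubes implies unconditional convergence (sum-close).

open import Defs
open import Algebra.Bundles using (CommutativeRing)
open import Data.Empty using (⊥-elim)
open import Data.Fin.Base using (toℕ)
open import Data.Fin.Properties using (toℕ<n)
open import Data.Integer.Base as ℤ using (ℤ; -[1+_]; _⊖_; _◃_) renaming (+_ to pos)
open import Data.Integer.Properties as ℤ using ([1+m]⊖[1+n]≡m⊖n)
open import Data.List.Base as List using (List; []; _∷_; _++_)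
open import Data.List.Membership.Propositional using (_∈_)
open import Data.List.Membership.Propositional.Properties using (∈-∃++; ∈-cartesianProductWith⁺; ∈-upTo⁺)
open import Data.List.Relation.Binary.Permutation.Propositional as ↭ using (_↭_; ↭-trans; ↭-reflexive)
open import Data.List.Relation.Binary.Permutation.Propositional.Properties using (∈-resp-↭) renaming (shift to ↭-shift)
open import Data.List.Relation.Binary.Subset.Propositional using (_⊆_)
open import Data.List.Relation.Unary.All as All using (All)
open import Data.List.Relation.Unary.AllPairs using ([]; _∷_)
open import Data.List.Relation.Unary.Any using (here; there)
open import Data.List.Relation.Unary.Unique.Propositional using (Unique)
open import Data.Maybe.Base as Maybe using (Maybe)
open import Data.Nat.Base as ℕ using (ℕ; zero; suc; _∸_; z≤n; s≤s) renaming (_+_ to _+ₙ_; _*_ to _*ₙ_)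
open import Data.Nat.Properties as ℕ using ()
open import Data.Nat.Tactic.RingSolver using (solve-∀)
open import Data.Product.Base using (Σ; Σ-syntax; ∃-syntax; _×_; _,_; proj₁; proj₂)
open import Data.Sign.Base as Sign using (Sign)
open import Data.Sum.Base using (inj₁; inj₂)
open import Data.Vec.Base as Vec using (Vec; []; _∷_)
open import Data.Vec.Properties using (∷-injective)
open import Function.Base using (_∘_; id)
open import Level using (Level; _⊔_) renaming (suc to lsuc)
open import Relation.Binary.PropositionalEquality.Core as ≡ using (_≡_)
open import Relation.Nullary.Decidable.Core using (dec⇒maybe)
import Algebra.Properties.Ring as RingProperties
import Algebra.Properties.Semiring.Exp as Exp
import Algebra.Properties.Semiring.Mult.TCOptimised as SemiringMult
import Algebra.Properties.Semiring.Sum as SemiringSum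
import Algebra.Solver.Ring as RingSolver
import Algebra.Solver.Ring.AlmostCommutativeRing as ACR
import Data.List.Relation.Unary.Unique.Propositional.Properties as Unique
import Relation.Binary.Reasoning.Setoid as SetoidReasoning

-- Ring identities and finite sums

-- A solver for equations in a commutative ring, with integer coefficients.
module IntegerRingSolver {c ℓ} (R : CommutativeRing c ℓ) where
  open CommutativeRing R hiding (zero)
  open RingProperties ring
  open SemiringMult semiring using (×-homo-+; ×1-homo-*) renaming (_×_ to _·_)
  open SetoidReasoning setoid

  -- The canonical map from the integers.
  ⟦_⟧ℤ : ℤ → Carrier
  ⟦ pos n ⟧ℤ    = n · 1#
  ⟦ -[1+ n ] ⟧ℤ = - (suc n · 1#)

  private
    suc-×1 : ∀ n → suc n · 1# ≈ 1# + n · 1#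
    suc-×1 n = ×-homo-+ 1# 1 n

    cancel-1 : ∀ x y → x - y ≈ (1# + x) - (1# + y)
    cancel-1 x y = begin
      x - y                    ≈⟨ +-congʳ (trans (sym (+-identityˡ x)) (+-congʳ (sym (-‿inverseʳ 1#)))) ⟩
      ((1# - 1#) + x) - y      ≈⟨ +-congʳ (trans (+-assoc _ _ _) (trans (+-congˡ (+-comm _ _)) (sym (+-assoc _ _ _)))) ⟩
      ((1# + x) - 1#) - y      ≈⟨ +-assoc _ _ _ ⟩
      (1# + x) + (- 1# - y)    ≈⟨ +-congˡ (-‿+-comm 1# y) ⟩
      (1# + x) - (1# + y)      ∎

    ⊖-homo : ∀ m n → ⟦ m ⊖ n ⟧ℤ ≈ m · 1# - n · 1#
    ⊖-homo zero    zero    = sym (-‿inverseʳ 0#)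
    ⊖-homo zero    (suc n) = sym (+-identityˡ _)
    ⊖-homo (suc m) zero    = sym (trans (+-congˡ -0#≈0#) (+-identityʳ _))
    ⊖-homo (suc m) (suc n) = begin
      ⟦ suc m ⊖ suc n ⟧ℤ                   ≈⟨ reflexive (≡.cong ⟦_⟧ℤ ([1+m]⊖[1+n]≡m⊖n m n)) ⟩
      ⟦ m ⊖ n ⟧ℤ                           ≈⟨ ⊖-homo m n ⟩
      m · 1# - n · 1#                      ≈⟨ cancel-1 _ _ ⟩
      (1# + m · 1#) - (1# + n · 1#)        ≈⟨ +-cong (suc-×1 m) (-‿cong (suc-×1 n)) ⟨
      suc m · 1# - suc n · 1#              ∎

    +-homo : ∀ i j → ⟦ i ℤ.+ j ⟧ℤ ≈ ⟦ i ⟧ℤ + ⟦ j ⟧ℤ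
    +-homo (pos m)    (pos n)    = ×-homo-+ 1# m n
    +-homo (pos m)    -[1+ n ]   = ⊖-homo m (suc n)
    +-homo -[1+ m ]   (pos n)    = trans (⊖-homo n (suc m)) (+-comm _ _)
    +-homo -[1+ m ]   -[1+ n ]   = begin
      - (suc (suc (m +ₙ n)) · 1#)       ≈⟨ -‿cong (reflexive (≡.cong (λ k → suc k · 1#) (ℕ.+-suc m n))) ⟨
      - ((suc m +ₙ suc n) · 1#)         ≈⟨ -‿cong (×-homo-+ 1# (suc m) (suc n)) ⟩
      - (suc m · 1# + suc n · 1#)       ≈⟨ -‿+-comm _ _ ⟨
      - (suc m · 1#) - (suc n · 1#)     ∎

    ◃-homo⁺ : ∀ n → ⟦ Sign.+ ◃ n ⟧ℤ ≈ n · 1#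
    ◃-homo⁺ zero    = refl
    ◃-homo⁺ (suc n) = refl

    ◃-homo⁻ : ∀ n → ⟦ Sign.- ◃ n ⟧ℤ ≈ - (n · 1#)
    ◃-homo⁻ zero    = sym -0#≈0#
    ◃-homo⁻ (suc n) = refl

    *-homo : ∀ i j → ⟦ i ℤ.* j ⟧ℤ ≈ ⟦ i ⟧ℤ * ⟦ j ⟧ℤ
    *-homo (pos m)  (pos n)  = trans (◃-homo⁺ (m *ₙ n)) (×1-homo-* m n)
    *-homo (pos m)  -[1+ n ] = trans (◃-homo⁻ (m *ₙ suc n))
      (trans (-‿cong (×1-homo-* m (suc n))) (-‿distribʳ-* _ _))
    *-homo -[1+ m ] (pos n)  = trans (◃-homo⁻ (suc m *ₙ n))
      (trans (-‿cong (×1-homo-* (suc m) n)) (-‿distribˡ-* _ _))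
    *-homo -[1+ m ] -[1+ n ] = trans (◃-homo⁺ (suc m *ₙ suc n)) (trans (×1-homo-* (suc m) (suc n))
      (trans (sym (-‿involutive _)) (trans (-‿cong (-‿distribˡ-* _ _)) (-‿distribʳ-* _ _))))

    -‿homo : ∀ i → ⟦ ℤ.- i ⟧ℤ ≈ - ⟦ i ⟧ℤ
    -‿homo (pos zero)    = sym -0#≈0#
    -‿homo (pos (suc n)) = refl
    -‿homo -[1+ n ]      = sym (-‿involutive _)

    morphism : ℤ.+-*-rawRing ACR.-Raw-AlmostCommutative⟶ ACR.fromCommutativeRing R
    morphism = record
      { ⟦_⟧    = ⟦_⟧ℤ
      ; +-homo = +-homo
      ; *-homo = *-homo
      ; -‿homo = -‿homo
      ; 0-homo = refl
      ; 1-homo = refl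
      }

    _coeff≟_ : ∀ i j → Maybe (⟦ i ⟧ℤ ≈ ⟦ j ⟧ℤ)
    i coeff≟ j = Maybe.map (λ i≡j → reflexive (≡.cong ⟦_⟧ℤ i≡j)) (dec⇒maybe (i ℤ.≟ j))

  open RingSolver ℤ.+-*-rawRing (ACR.fromCommutativeRing R) morphism _coeff≟_ public
    using (solve; _:=_; con; _:+_; _:*_; _:-_; :-_)

-- Finite sums over initial segments of ℕ.
module FiniteSums {c ℓ} (R : CommutativeRing c ℓ) where
  open CommutativeRing R hiding (zero)
  open SetoidReasoning setoid
  private module Sum = SemiringSum semiring

  abstract
    -- ∑ N f = f 0 + ⋯ + f (N - 1).  It is abstract so that f can be inferred
    -- from ∑ N f.
    ∑ : ℕ → (ℕ → Carrier) → Carrier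
    ∑ N f = Sum.sum {N} (f ∘ toℕ)

    ∑-0 : ∀ f → ∑ 0 f ≈ 0#
    ∑-0 f = refl

    ∑-suc : ∀ N f → ∑ (suc N) f ≈ f 0 + ∑ N (f ∘ suc)
    ∑-suc N f = refl

    ∑-cong-< : ∀ N {f g : ℕ → Carrier} → (∀ n → n ℕ.< N → f n ≈ g n) → ∑ N f ≈ ∑ N g
    ∑-cong-< N f≈g = Sum.sum-cong-≋ {N} (λ n → f≈g (toℕ n) (toℕ<n n))

    ∑-cong : ∀ N {f g : ℕ → Carrier} → (∀ n → f n ≈ g n) → ∑ N f ≈ ∑ N g
    ∑-cong N f≈g = ∑-cong-< N (λ n _ → f≈g n)

    ∑-zero : ∀ N {f : ℕ → Carrier} → (∀ n → f n ≈ 0#) → ∑ N f ≈ 0#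
    ∑-zero N f≈0 = trans (∑-cong N f≈0) (Sum.sum-replicate-zero N)

    ∑-+ : ∀ N (f g : ℕ → Carrier) → ∑ N (λ n → f n + g n) ≈ ∑ N f + ∑ N g
    ∑-+ N f g = Sum.∑-distrib-+ {N} (f ∘ toℕ) (g ∘ toℕ)

    ∑-*ˡ : ∀ N x (f : ℕ → Carrier) → x * ∑ N f ≈ ∑ N (λ n → x * f n)
    ∑-*ˡ N x f = Sum.*-distribˡ-sum {N} x (f ∘ toℕ)

    ∑-*ʳ : ∀ N x (f : ℕ → Carrier) → ∑ N f * x ≈ ∑ N (λ n → f n * x)
    ∑-*ʳ N x f = Sum.*-distribʳ-sum {N} x (f ∘ toℕ)

    ∑-- : ∀ N (f g : ℕ → Carrier) → ∑ N (λ n → f n - g n) ≈ ∑ N f - ∑ N g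
    ∑-- N f g = begin
      ∑ N (λ n → f n - g n)            ≈⟨ ∑-+ N f (λ n → - g n) ⟩
      ∑ N f + ∑ N (λ n → - g n)        ≈⟨ +-congˡ (∑-cong N (λ n → -1*x≈-x (g n))) ⟨
      ∑ N f + ∑ N (λ n → - 1# * g n)   ≈⟨ +-congˡ (∑-*ˡ N (- 1#) g) ⟨
      ∑ N f + - 1# * ∑ N g             ≈⟨ +-congˡ (-1*x≈-x _) ⟩
      ∑ N f - ∑ N g                    ∎
      where open RingProperties ring using (-1*x≈-x)

    ∑-swap : ∀ M N (f : ℕ → ℕ → Carrier) →
      ∑ M (λ m → ∑ N (λ n → f m n)) ≈ ∑ N (λ n → ∑ M (λ m → f m n))
    ∑-swap M N f = Sum.∑-comm {M} {N} (λ m n → f (toℕ m) (toℕ n))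

    ∑-last : ∀ N (f : ℕ → Carrier) → ∑ (suc N) f ≈ ∑ N f + f N
    ∑-last zero    f = trans (+-identityʳ _) (sym (+-identityˡ _))
    ∑-last (suc N) f = trans (+-congˡ (∑-last N (f ∘ suc))) (sym (+-assoc _ _ _))

    ∑-++ : ∀ M N (f : ℕ → Carrier) → ∑ (M +ₙ N) f ≈ ∑ M f + ∑ N (λ n → f (M +ₙ n))
    ∑-++ zero    N f = sym (+-identityˡ _)
    ∑-++ (suc M) N f = trans (+-congˡ (∑-++ M N (f ∘ suc))) (sym (+-assoc _ _ _))

    ∑-reverse : ∀ N (f : ℕ → Carrier) → ∑ (suc N) f ≈ ∑ (suc N) (λ n → f (N ∸ n))
    ∑-reverse zero    f = refl
    ∑-reverse (suc N) f = begin
      ∑ (suc (suc N)) f                          ≈⟨ ∑-last (suc N) f ⟩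
      ∑ (suc N) f + f (suc N)                    ≈⟨ +-comm _ _ ⟩
      f (suc N) + ∑ (suc N) f                    ≈⟨ +-congˡ (∑-reverse N f) ⟩
      f (suc N) + ∑ (suc N) (λ n → f (N ∸ n))    ∎

    -- Terms that vanish may be added at the end.
    ∑-extend : ∀ {M N} (f : ℕ → Carrier) → M ℕ.≤ N → (∀ n → M ℕ.≤ n → f n ≈ 0#) → ∑ M f ≈ ∑ N f
    ∑-extend {N = N} f z≤n       f≈0 = sym (∑-zero N (λ n → f≈0 n z≤n))
    ∑-extend         f (s≤s M≤N) f≈0 = +-congˡ (∑-extend (f ∘ suc) M≤N (λ n M≤n → f≈0 (suc n) (s≤s M≤n)))

-- The q-Vandermonde summation

-- The q-factorials (q)ₙ together with their inverses.
record QFactorials {c ℓ} (R : CommutativeRing c ℓ) (q : CommutativeRing.Carrier R) : Set (c ⊔ ℓ) where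
  open CommutativeRing R hiding (zero)
  open Exp semiring using (_^_)
  field
    fact inv  : ℕ → Carrier
    fact-zero : fact 0 ≈ 1#
    fact-suc  : ∀ n → fact (suc n) ≈ fact n * (1# - q ^ suc n)
    fact-inv  : ∀ n → fact n * inv n ≈ 1#

module QSeries {c ℓ} (R : CommutativeRing c ℓ) (q : CommutativeRing.Carrier R) (F : QFactorials R q) where
  open CommutativeRing R hiding (zero)
  open QFactorials F public
  open Exp semiring using (_^_; ^-congʳ; ^-homo-*)
  open IntegerRingSolver R
  open FiniteSums R
  open SetoidReasoning setoid

  inv-suc : ∀ n → inv n ≈ inv (suc n) * (1# - q ^ suc n)
  inv-suc n = begin
    inv n                                                       ≈⟨ *-identityʳ _ ⟨
    inv n * 1#                                                  ≈⟨ *-congˡ (fact-inv (suc n)) ⟨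
    inv n * (fact (suc n) * inv (suc n))                        ≈⟨ *-congˡ (*-congʳ (fact-suc n)) ⟩
    inv n * (fact n * (1# - q ^ suc n) * inv (suc n))           ≈⟨ solve 4 (λ a b x d → a :* (b :* x :* d) := (b :* a) :* (d :* x)) refl _ _ _ _ ⟩
    (fact n * inv n) * (inv (suc n) * (1# - q ^ suc n))         ≈⟨ *-congʳ (fact-inv n) ⟩
    1# * (inv (suc n) * (1# - q ^ suc n))                       ≈⟨ *-identityˡ _ ⟩
    inv (suc n) * (1# - q ^ suc n)                              ∎

  inv-zero : inv 0 ≈ 1#
  inv-zero = trans (sym (*-identityˡ _)) (trans (*-congʳ (sym fact-zero)) (fact-inv 0))

  -- The factor 1 - qⁿ⁺¹ has the inverse (q)ₙ / (q)ₙ₊₁.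
  cancel : ∀ n {x y} → (1# - q ^ suc n) * x ≈ (1# - q ^ suc n) * y → x ≈ y
  cancel n {x} {y} p = trans (sym (undo x)) (trans (*-congˡ p) (undo y))
    where
    undo : ∀ x → (fact n * inv (suc n)) * ((1# - q ^ suc n) * x) ≈ x
    undo x = begin
      (fact n * inv (suc n)) * ((1# - q ^ suc n) * x)   ≈⟨ solve 4 (λ a b d x → (a :* b) :* (d :* x) := a :* (b :* d) :* x) refl _ _ _ _ ⟩
      fact n * (inv (suc n) * (1# - q ^ suc n)) * x     ≈⟨ *-congʳ (*-congˡ (inv-suc n)) ⟨
      fact n * inv n * x                                ≈⟨ *-congʳ (fact-inv n) ⟩
      1# * x                                            ≈⟨ *-identityˡ x ⟩
      x                                                 ∎

  -- rest n j is 1/(q)ₙ₋₁₋ⱼ when j < n, and 0 otherwise; the value 0 is the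
  -- usual convention for the reciprocal q-factorial of a negative number.
  rest : ℕ → ℕ → Carrier
  rest zero    _       = 0#
  rest (suc n) zero    = inv n
  rest (suc n) (suc j) = rest n j

  rest-≥ : ∀ {n j} → n ℕ.≤ j → rest n j ≈ 0#
  rest-≥ {zero}  {j}     _         = refl
  rest-≥ {suc n} {suc j} (s≤s n≤j) = rest-≥ n≤j

  rest-+ : ∀ n r j → rest n (r +ₙ j) ≈ rest (n ∸ r) j
  rest-+ n       zero    j = refl
  rest-+ zero    (suc r) j = refl
  rest-+ (suc n) (suc r) j = rest-+ n r j

  rest-diag : ∀ r n → rest (suc (r +ₙ n)) r ≈ inv n
  rest-diag zero    n = refl
  rest-diag (suc r) n = rest-diag r n

  -- The recurrence qᵐ/(q)ₘ = 1/(q)ₘ - 1/(q)ₘ₋₁ at m = n - j, multiplied by qʲ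
  -- so that it also holds for j > n.
  rest-step : ∀ n j → q ^ n * rest (suc n) j ≈ q ^ j * (rest (suc n) j - rest n j)
  rest-step zero zero = *-congˡ (solve 1 (λ x → x := x :- con (pos 0)) refl _)
  rest-step zero (suc j) = trans (*-identityˡ _)
    (sym (trans (*-congˡ (-‿inverseʳ 0#)) (zeroʳ _)))
  rest-step (suc n) zero = begin
    q ^ suc n * inv (suc n)                                ≈⟨ solve 2 (λ x i → x :* i := con (pos 1) :* (i :- i :* (con (pos 1) :- x))) refl _ _ ⟩
    1# * (inv (suc n) - inv (suc n) * (1# - q ^ suc n))    ≈⟨ *-congˡ (+-congˡ (-‿cong (inv-suc n))) ⟨
    1# * (inv (suc n) - inv n)                             ∎
  rest-step (suc n) (suc j) = trans (*-assoc q _ _) (trans (*-congˡ (rest-step n j)) (sym (*-assoc q _ _)))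

  -- The same recurrence at r ≤ r + n, without the factor qʳ.
  rest-step-diag : ∀ r n → q ^ n * rest (suc (r +ₙ n)) r ≈ rest (suc (r +ₙ n)) r - rest (r +ₙ n) r
  rest-step-diag zero    n = trans (rest-step n zero) (*-identityˡ _)
  rest-step-diag (suc r) n = rest-step-diag r n

  -- A sum against 1/(q)ⱼ₋ᵣ is a sum over the shifted index j - r.
  ∑-rest : ∀ N r (g : ℕ → Carrier) →
    ∑ N (λ j → g j * rest (suc j) r) ≈ ∑ (N ∸ r) (λ s → g (r +ₙ s) * inv s)
  ∑-rest N       zero    g = refl
  ∑-rest zero    (suc r) g = trans (∑-0 _) (sym (∑-0 _))
  ∑-rest (suc N) (suc r) g = trans (∑-suc N _) (trans (+-congʳ (zeroʳ _)) (trans (+-identityˡ _) (∑-rest N r (g ∘ suc))))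

  -- The q-Vandermonde sum, with an arbitrary weight w in place of one of the
  -- factors; N is any bound exceeding n.
  vandermondeSum : (ℕ → Carrier) → ℕ → ℕ → ℕ → Carrier
  vandermondeSum w N n M = ∑ N (λ j → q ^ (j *ₙ (j +ₙ M)) * (inv j * inv (j +ₙ M)) * (rest (suc n) j * w j))

  private
    one-zero : ∀ {x} → (1# - 1#) * x ≈ 0#
    one-zero = trans (*-congʳ (-‿inverseʳ 1#)) (zeroˡ _)

  -- Write 1 - qⁿ⁺¹ = (1 - qⁿ⁺¹⁻ʲ) + qⁿ⁺¹⁻ʲ (1 - qʲ) in the j-th term.  The first
  -- part lowers n; the second lowers the factor 1/(q)ⱼ, and shifting j then
  -- raises M and shifts the weight.
  vandermonde-step : ∀ w N n M → (1# - q ^ suc n) * vandermondeSum w (suc N) (suc n) M ≈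
    vandermondeSum w (suc N) n M + q ^ (M +ₙ suc n) * vandermondeSum (w ∘ suc) N n (suc M)
  vandermonde-step w N n M = begin
    (1# - q ^ suc n) * vandermondeSum w (suc N) (suc n) M
      ≈⟨ ∑-*ˡ (suc N) _ _ ⟩
    ∑ (suc N) (λ j → (1# - q ^ suc n) * (X j * (rest (suc (suc n)) j * w j)))
      ≈⟨ ∑-cong (suc N) split ⟩
    ∑ (suc N) (λ j → X j * (rest (suc n) j * w j) + (1# - q ^ j) * Y j)
      ≈⟨ ∑-+ (suc N) (λ j → X j * (rest (suc n) j * w j)) (λ j → (1# - q ^ j) * Y j) ⟩
    vandermondeSum w (suc N) n M + ∑ (suc N) (λ j → (1# - q ^ j) * Y j)
      ≈⟨ +-congˡ (trans (∑-suc N _) (trans (+-congʳ one-zero) (+-identityˡ _))) ⟩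
    vandermondeSum w (suc N) n M + ∑ N (λ j → (1# - q ^ suc j) * Y (suc j))
      ≈⟨ +-congˡ (∑-cong N shift) ⟩
    vandermondeSum w (suc N) n M + ∑ N (λ j → q ^ (M +ₙ suc n) * (q ^ (j *ₙ (j +ₙ suc M)) * (inv j * inv (j +ₙ suc M)) * (rest (suc n) j * w (suc j))))
      ≈⟨ +-congˡ (∑-*ˡ N _ _) ⟨
    vandermondeSum w (suc N) n M + q ^ (M +ₙ suc n) * vandermondeSum (w ∘ suc) N n (suc M) ∎
    where
    X Y : ℕ → Carrier
    X j = q ^ (j *ₙ (j +ₙ M)) * (inv j * inv (j +ₙ M))
    Y j = X j * ((rest (suc (suc n)) j - rest (suc n) j) * w j)

    split : ∀ j → (1# - q ^ suc n) * (X j * (rest (suc (suc n)) j * w j)) ≈ X j * (rest (suc n) j * w j) + (1# - q ^ j) * Y j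
    split j = begin
      (1# - q ^ suc n) * (X j * (r₁ * w j))
        ≈⟨ solve 4 (λ Q x r w → (con (pos 1) :- Q) :* (x :* (r :* w)) := x :* (r :* w) :- x :* w :* (Q :* r)) refl (q ^ suc n) (X j) r₁ (w j) ⟩
      X j * (r₁ * w j) - X j * w j * (q ^ suc n * r₁)
        ≈⟨ +-congˡ (-‿cong (*-congˡ (rest-step (suc n) j))) ⟩
      X j * (r₁ * w j) - X j * w j * (q ^ j * (r₁ - r₀))
        ≈⟨ solve 5 (λ Q x r s w → x :* (r :* w) :- x :* w :* (Q :* (r :- s)) := x :* (s :* w) :+ (con (pos 1) :- Q) :* (x :* ((r :- s) :* w))) refl (q ^ j) (X j) r₁ r₀ (w j) ⟩
      X j * (r₀ * w j) + (1# - q ^ j) * Y j ∎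
      where
      r₁ = rest (suc (suc n)) j
      r₀ = rest (suc n) j

    exponent : ∀ j → suc j *ₙ suc (j +ₙ M) ≡ j *ₙ (j +ₙ suc M) +ₙ (suc M +ₙ j)
    exponent j = identity j M
      where
      identity : ∀ j M → suc j *ₙ suc (j +ₙ M) ≡ j *ₙ (j +ₙ suc M) +ₙ (suc M +ₙ j)
      identity = solve-∀

    shift : ∀ j → (1# - q ^ suc j) * Y (suc j) ≈
      q ^ (M +ₙ suc n) * (q ^ (j *ₙ (j +ₙ suc M)) * (inv j * inv (j +ₙ suc M)) * (rest (suc n) j * w (suc j)))
    shift j = begin
      (1# - q ^ suc j) * (q ^ (suc j *ₙ suc (j +ₙ M)) * (inv (suc j) * inv (suc (j +ₙ M))) * (Δ * w (suc j)))
        ≈⟨ *-congˡ (*-congʳ (*-cong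
             (trans (^-congʳ q (exponent j)) (trans (^-homo-* q (j *ₙ (j +ₙ suc M)) (suc M +ₙ j)) (*-congˡ (^-homo-* q (suc M) j))))
             (*-congˡ (reflexive (≡.cong inv (≡.sym (ℕ.+-suc j M))))))) ⟩
      (1# - q ^ suc j) * (E * (q ^ suc M * q ^ j) * (inv (suc j) * I) * (Δ * w (suc j)))
        ≈⟨ solve 8 (λ Q e a b i I d w → Q :* (e :* (a :* b) :* (i :* I) :* (d :* w)) := a :* (b :* d) :* e :* ((i :* Q) :* I) :* w) refl
             (1# - q ^ suc j) E (q ^ suc M) (q ^ j) (inv (suc j)) I Δ (w (suc j)) ⟩
      q ^ suc M * (q ^ j * Δ) * E * ((inv (suc j) * (1# - q ^ suc j)) * I) * w (suc j)
        ≈⟨ *-congʳ (*-cong (*-congʳ (*-congˡ (sym (rest-step n j)))) (*-congʳ (sym (inv-suc j)))) ⟩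
      q ^ suc M * (q ^ n * rest (suc n) j) * E * (inv j * I) * w (suc j)
        ≈⟨ solve 7 (λ a b r e i I w → a :* (b :* r) :* e :* (i :* I) :* w := (a :* b) :* (e :* (i :* I) :* (r :* w))) refl
             (q ^ suc M) (q ^ n) (rest (suc n) j) E (inv j) I (w (suc j)) ⟩
      (q ^ suc M * q ^ n) * (E * (inv j * I) * (rest (suc n) j * w (suc j)))
        ≈⟨ *-congʳ (trans (sym (^-homo-* q (suc M) n)) (^-congʳ q (≡.sym (ℕ.+-suc M n)))) ⟩
      q ^ (M +ₙ suc n) * (E * (inv j * I) * (rest (suc n) j * w (suc j))) ∎
      where
      E = q ^ (j *ₙ (j +ₙ suc M))
      I = inv (j +ₙ suc M)
      Δ = rest (suc n) j - rest n j

  vandermonde-zero : ∀ w N M → vandermondeSum w (suc N) 0 M ≈ inv M * w 0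
  vandermonde-zero w N M = begin
    vandermondeSum w (suc N) 0 M
      ≈⟨ ∑-suc N _ ⟩
    1# * (inv 0 * inv M) * (inv 0 * w 0) + ∑ N (λ j → q ^ (suc j *ₙ (suc j +ₙ M)) * (inv (suc j) * inv (suc (j +ₙ M))) * (0# * w (suc j)))
      ≈⟨ +-congˡ (∑-zero N (λ j → trans (*-congˡ (zeroˡ _)) (zeroʳ _))) ⟩
    1# * (inv 0 * inv M) * (inv 0 * w 0) + 0#
      ≈⟨ +-congʳ (*-cong (*-congˡ (*-congʳ inv-zero)) (*-congʳ inv-zero)) ⟩
    1# * (1# * inv M) * (1# * w 0) + 0#
      ≈⟨ solve 2 (λ a w → con (pos 1) :* (con (pos 1) :* a) :* (con (pos 1) :* w) :+ con (pos 0) := a :* w) refl (inv M) (w 0) ⟩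
    inv M * w 0 ∎

  -- ∑ⱼ qʲ⁽ʲ⁺ᴹ⁾ / ((q)ⱼ (q)ⱼ₊ᴹ (q)ₙ₋ⱼ) = 1 / ((q)ₙ (q)ₙ₊ᴹ)
  vandermonde : ∀ n N M → n ℕ.< N → vandermondeSum (λ _ → 1#) N n M ≈ inv n * inv (n +ₙ M)
  vandermonde zero    (suc N) M _ = trans (vandermonde-zero _ N M)
    (trans (*-identityʳ _) (sym (trans (*-congʳ inv-zero) (*-identityˡ _))))
  vandermonde (suc n) (suc N) M (s≤s n<N) = cancel n (begin
    (1# - q ^ suc n) * vandermondeSum (λ _ → 1#) (suc N) (suc n) M
      ≈⟨ vandermonde-step _ N n M ⟩
    vandermondeSum (λ _ → 1#) (suc N) n M + q ^ (M +ₙ suc n) * vandermondeSum (λ _ → 1#) N n (suc M)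
      ≈⟨ +-cong (vandermonde n (suc N) M (ℕ.<-trans n<N (ℕ.n<1+n N))) (*-congˡ (vandermonde n N (suc M) n<N)) ⟩
    inv n * inv (n +ₙ M) + q ^ (M +ₙ suc n) * (inv n * inv (n +ₙ suc M))
      ≈⟨ +-cong (*-cong (inv-suc n) (inv-suc (n +ₙ M))) (*-cong (^-congʳ q (exponent M n)) (*-cong (inv-suc n) (reflexive (≡.cong inv (ℕ.+-suc n M))))) ⟩
    (i * (1# - q ^ suc n)) * (j * (1# - Q)) + Q * ((i * (1# - q ^ suc n)) * j)
      ≈⟨ solve 4 (λ i p j Q → (i :* p) :* (j :* (con (pos 1) :- Q)) :+ Q :* ((i :* p) :* j) := p :* (i :* j)) refl i (1# - q ^ suc n) j Q ⟩
    (1# - q ^ suc n) * (i * j) ∎)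
    where
    i = inv (suc n)
    j = inv (suc n +ₙ M)
    Q = q ^ suc (n +ₙ M)
    exponent : ∀ M n → M +ₙ suc n ≡ suc (n +ₙ M)
    exponent = solve-∀

  -- ∑ⱼ qʲ⁽ʲ⁺ᴹ⁾ / ((q)ⱼ (q)ⱼ₊ᴹ (q)ₗ₋ⱼ (q)ₙ₋ⱼ) = (q)ₗ₊ₙ₊ᴹ / ((q)ₗ (q)ₙ (q)ₗ₊ᴹ (q)ₙ₊ᴹ)
  vandermonde-finite : ∀ l n N M → n ℕ.< N → vandermondeSum (rest (suc l)) N n M ≈
    fact (l +ₙ (n +ₙ M)) * ((inv l * inv n) * (inv (l +ₙ M) * inv (n +ₙ M)))
  vandermonde-finite l zero (suc N) M _ = begin
    vandermondeSum (rest (suc l)) (suc N) 0 M                     ≈⟨ vandermonde-zero _ N M ⟩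
    inv M * inv l                                                 ≈⟨ solve 2 (λ m l → m :* l := con (pos 1) :* ((l :* con (pos 1)) :* m)) refl _ _ ⟩
    1# * ((inv l * 1#) * inv M)                                   ≈⟨ *-cong (fact-inv (l +ₙ M)) (*-congʳ (*-congˡ inv-zero)) ⟨
    (fact (l +ₙ M) * inv (l +ₙ M)) * ((inv l * inv 0) * inv M)    ≈⟨ solve 5 (λ f g l o m → (f :* g) :* ((l :* o) :* m) := f :* ((l :* o) :* (g :* m))) refl _ _ _ _ _ ⟩
    fact (l +ₙ M) * ((inv l * inv 0) * (inv (l +ₙ M) * inv M))    ∎
  vandermonde-finite l (suc n) (suc N) M (s≤s n<N) = cancel n (begin
    (1# - q ^ suc n) * vandermondeSum (rest (suc l)) (suc N) (suc n) M
      ≈⟨ vandermonde-step _ N n M ⟩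
    vandermondeSum (rest (suc l)) (suc N) n M + q ^ (M +ₙ suc n) * vandermondeSum (rest l) N n (suc M)
      ≈⟨ +-cong (vandermonde-finite l n (suc N) M (ℕ.<-trans n<N (ℕ.n<1+n N))) (*-congˡ (second l)) ⟩
    f * ((inv l * inv n) * (inv (l +ₙ M) * inv (n +ₙ M))) + q ^ (M +ₙ suc n) * (f * (1# - q ^ l) * (inv l * inv n * (inv (l +ₙ M) * i)))
      ≈⟨ +-cong (*-congˡ (*-congˡ (*-congˡ (inv-suc (n +ₙ M))))) (*-congʳ (^-congʳ q (exponent M n))) ⟩
    f * ((inv l * inv n) * (inv (l +ₙ M) * (i * (1# - Q)))) + Q * (f * (1# - q ^ l) * (inv l * inv n * (inv (l +ₙ M) * i)))
      ≈⟨ solve 7 (λ f l n m i Q L → f :* ((l :* n) :* (m :* (i :* (con (pos 1) :- Q)))) :+ Q :* (f :* (con (pos 1) :- L) :* (l :* n :* (m :* i)))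
            := f :* (con (pos 1) :- L :* Q) :* ((l :* n) :* (m :* i))) refl f (inv l) (inv n) (inv (l +ₙ M)) i Q (q ^ l) ⟩
    f * (1# - q ^ l * Q) * ((inv l * inv n) * (inv (l +ₙ M) * i))
      ≈⟨ *-cong (trans (*-congˡ (+-congˡ (-‿cong top))) (trans (sym (fact-suc (l +ₙ (n +ₙ M)))) (reflexive (≡.cong fact (≡.sym (ℕ.+-suc l (n +ₙ M)))))))
                (*-congʳ (*-congˡ (inv-suc n))) ⟩
    f' * ((inv l * (inv (suc n) * (1# - q ^ suc n))) * (inv (l +ₙ M) * i))
      ≈⟨ solve 6 (λ f l n p m i → f :* ((l :* (n :* p)) :* (m :* i)) := p :* (f :* ((l :* n) :* (m :* i)))) refl _ _ _ _ _ _ ⟩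
    (1# - q ^ suc n) * (f' * ((inv l * inv (suc n)) * (inv (l +ₙ M) * i))) ∎)
    where
    f = fact (l +ₙ (n +ₙ M))
    f' = fact (l +ₙ (suc n +ₙ M))
    i = inv (suc n +ₙ M)
    Q = q ^ suc (n +ₙ M)
    exponent : ∀ M n → M +ₙ suc n ≡ suc (n +ₙ M)
    exponent = solve-∀
    top : q ^ l * Q ≈ q ^ suc (l +ₙ (n +ₙ M))
    top = trans (sym (^-homo-* q l (suc (n +ₙ M)))) (^-congʳ q (ℕ.+-suc l (n +ₙ M)))
    second : ∀ l → vandermondeSum (rest l) N n (suc M) ≈ fact (l +ₙ (n +ₙ M)) * (1# - q ^ l) * (inv l * inv n * (inv (l +ₙ M) * i))
    second zero = begin
      vandermondeSum (rest 0) N n (suc M) ≈⟨ ∑-zero N (λ j → trans (*-congˡ (zeroʳ _)) (zeroʳ _)) ⟩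
      0#                                  ≈⟨ trans (*-congʳ (trans (*-congˡ (-‿inverseʳ 1#)) (zeroʳ _))) (zeroˡ _) ⟨
      fact (n +ₙ M) * (1# - 1#) * (inv 0 * inv n * (inv M * i)) ∎
    second (suc l) = begin
      vandermondeSum (rest (suc l)) N n (suc M)
        ≈⟨ vandermonde-finite l n N (suc M) n<N ⟩
      fact (l +ₙ (n +ₙ suc M)) * ((inv l * inv n) * (inv (l +ₙ suc M) * inv (n +ₙ suc M)))
        ≈⟨ *-cong (reflexive (≡.cong fact (index l n M))) (*-cong (*-congʳ (inv-suc l))
             (*-cong (reflexive (≡.cong inv (ℕ.+-suc l M))) (reflexive (≡.cong inv (ℕ.+-suc n M))))) ⟩
      fact (suc l +ₙ (n +ₙ M)) * ((inv (suc l) * (1# - q ^ suc l) * inv n) * (inv (suc l +ₙ M) * i))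
        ≈⟨ solve 6 (λ f l p n m i → f :* ((l :* p :* n) :* (m :* i)) := f :* p :* (l :* n :* (m :* i))) refl _ _ _ _ _ _ ⟩
      fact (suc l +ₙ (n +ₙ M)) * (1# - q ^ suc l) * (inv (suc l) * inv n * (inv (suc l +ₙ M) * i)) ∎
      where
      index : ∀ l n M → l +ₙ (n +ₙ suc M) ≡ suc l +ₙ (n +ₙ M)
      index = solve-∀

-- The Bailey chain and the finite triple product

module Bailey {c ℓ} (R : CommutativeRing c ℓ) (q : CommutativeRing.Carrier R) (F : QFactorials R q) where
  open CommutativeRing R hiding (zero)
  open QSeries R q F
  open Exp semiring using (_^_; ^-congʳ; ^-homo-*)
  open IntegerRingSolver R
  open FiniteSums R
  open SetoidReasoning setoid

  -- The Bailey pair βₙ = ∑ᵣ αᵣ / ((q)ₙ₋ᵣ (q)ₙ₊ᵣ₊₁) relative to a = q, up to the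
  -- constant factor 1 - q.
  β : (ℕ → Carrier) → ℕ → Carrier
  β α n = ∑ (suc n) (λ r → α r * (rest (suc n) r * inv (n +ₙ suc r)))

  private
    -- With j = r + s this is the q-Vandermonde sum at M = 2r + 1.
    kernel : ∀ n r → r ℕ.≤ n →
      ∑ (suc n) (λ j → (q ^ (j *ₙ suc j) * rest (suc n) j) * (rest (suc j) r * inv (j +ₙ suc r))) ≈
      q ^ (r *ₙ suc r) * (rest (suc n) r * inv (n +ₙ suc r))
    kernel n r r≤n with ℕ.m≤n⇒∃[o]m+o≡n r≤n
    ... | m , ≡.refl = begin
      ∑ (suc n) (λ j → (q ^ (j *ₙ suc j) * rest (suc n) j) * (rest (suc j) r * inv (j +ₙ suc r)))
        ≈⟨ ∑-cong (suc n) (λ j → solve 4 (λ a b d e → (a :* b) :* (d :* e) := (a :* b :* e) :* d) refl _ _ _ _) ⟩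
      ∑ (suc n) (λ j → (q ^ (j *ₙ suc j) * rest (suc n) j * inv (j +ₙ suc r)) * rest (suc j) r)
        ≈⟨ ∑-rest (suc n) r (λ j → q ^ (j *ₙ suc j) * rest (suc n) j * inv (j +ₙ suc r)) ⟩
      ∑ (suc n ∸ r) (λ s → (q ^ ((r +ₙ s) *ₙ suc (r +ₙ s)) * rest (suc n) (r +ₙ s) * inv (r +ₙ s +ₙ suc r)) * inv s)
        ≈⟨ reflexive (≡.cong (λ N → ∑ N (λ s → (q ^ ((r +ₙ s) *ₙ suc (r +ₙ s)) * rest (suc n) (r +ₙ s) * inv (r +ₙ s +ₙ suc r)) * inv s)) bound) ⟩
      ∑ (suc m) (λ s → (q ^ ((r +ₙ s) *ₙ suc (r +ₙ s)) * rest (suc n) (r +ₙ s) * inv (r +ₙ s +ₙ suc r)) * inv s)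
        ≈⟨ ∑-cong (suc m) term ⟩
      ∑ (suc m) (λ s → q ^ (r *ₙ suc r) * (q ^ (s *ₙ (s +ₙ suc (r +ₙ r))) * (inv s * inv (s +ₙ suc (r +ₙ r))) * (rest (suc m) s * 1#)))
        ≈⟨ ∑-*ˡ (suc m) _ _ ⟨
      q ^ (r *ₙ suc r) * vandermondeSum (λ _ → 1#) (suc m) m (suc (r +ₙ r))
        ≈⟨ *-congˡ (vandermonde m (suc m) (suc (r +ₙ r)) (ℕ.n<1+n m)) ⟩
      q ^ (r *ₙ suc r) * (inv m * inv (m +ₙ suc (r +ₙ r)))
        ≈⟨ *-congˡ (*-cong (rest-diag r m) (reflexive (≡.cong inv (index m r)))) ⟨
      q ^ (r *ₙ suc r) * (rest (suc n) r * inv (n +ₙ suc r)) ∎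
      where
      index : ∀ s r → r +ₙ s +ₙ suc r ≡ s +ₙ suc (r +ₙ r)
      index = solve-∀
      exponent : ∀ s r → (r +ₙ s) *ₙ suc (r +ₙ s) ≡ r *ₙ suc r +ₙ s *ₙ (s +ₙ suc (r +ₙ r))
      exponent = solve-∀
      bound : suc (r +ₙ m) ∸ r ≡ suc m
      bound = ≡.trans (≡.cong (_∸ r) (≡.sym (ℕ.+-suc r m))) (ℕ.m+n∸m≡n r (suc m))
      term : ∀ s → (q ^ ((r +ₙ s) *ₙ suc (r +ₙ s)) * rest (suc n) (r +ₙ s) * inv (r +ₙ s +ₙ suc r)) * inv s ≈
        q ^ (r *ₙ suc r) * (q ^ (s *ₙ (s +ₙ suc (r +ₙ r))) * (inv s * inv (s +ₙ suc (r +ₙ r))) * (rest (suc m) s * 1#))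
      term s = begin
        (q ^ ((r +ₙ s) *ₙ suc (r +ₙ s)) * rest (suc n) (r +ₙ s) * inv (r +ₙ s +ₙ suc r)) * inv s
          ≈⟨ *-congʳ (*-cong (*-cong (trans (^-congʳ q (exponent s r)) (^-homo-* q (r *ₙ suc r) _))
               (trans (rest-+ (suc n) r s) (reflexive (≡.cong (λ N → rest N s) bound)))) (reflexive (≡.cong inv (index s r)))) ⟩
        (q ^ (r *ₙ suc r) * q ^ (s *ₙ (s +ₙ suc (r +ₙ r))) * rest (suc m) s * inv (s +ₙ suc (r +ₙ r))) * inv s
          ≈⟨ solve 5 (λ a b d e f → (a :* b :* d :* e) :* f := a :* (b :* (f :* e) :* (d :* con (pos 1)))) refl _ _ _ _ _ ⟩
        q ^ (r *ₙ suc r) * (q ^ (s *ₙ (s +ₙ suc (r +ₙ r))) * (inv s * inv (s +ₙ suc (r +ₙ r))) * (rest (suc m) s * 1#)) ∎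

  β-cong : ∀ {α α′ : ℕ → Carrier} → (∀ r → α r ≈ α′ r) → ∀ n → β α n ≈ β α′ n
  β-cong α≈α′ n = ∑-cong (suc n) (λ r → *-congʳ (α≈α′ r))

  -- One step of the Bailey chain: multiplying αᵣ by q^(r² + r) turns βₙ into
  -- ∑ⱼ q^(j² + j) βⱼ / (q)ₙ₋ⱼ.
  β-step : ∀ α n → β (λ r → q ^ (r *ₙ suc r) * α r) n ≈ ∑ (suc n) (λ j → (q ^ (j *ₙ suc j) * rest (suc n) j) * β α j)
  β-step α n = sym (begin
    ∑ (suc n) (λ j → k j * β α j)
      ≈⟨ ∑-cong-< (suc n) (λ j j<1+n → *-congˡ (∑-extend _ j<1+n
           (λ r j<r → trans (*-congˡ (trans (*-congʳ (rest-≥ j<r)) (zeroˡ _))) (zeroʳ _)))) ⟩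
    ∑ (suc n) (λ j → k j * ∑ (suc n) (λ r → α r * u j r))
      ≈⟨ ∑-cong (suc n) (λ j → ∑-*ˡ (suc n) (k j) (λ r → α r * u j r)) ⟩
    ∑ (suc n) (λ j → ∑ (suc n) (λ r → k j * (α r * u j r)))
      ≈⟨ ∑-swap (suc n) (suc n) _ ⟩
    ∑ (suc n) (λ r → ∑ (suc n) (λ j → k j * (α r * u j r)))
      ≈⟨ ∑-cong (suc n) (λ r → trans (∑-cong (suc n) (λ j → solve 3 (λ k a u → k :* (a :* u) := a :* (k :* u)) refl (k j) (α r) (u j r)))
            (sym (∑-*ˡ (suc n) (α r) (λ j → k j * u j r)))) ⟩
    ∑ (suc n) (λ r → α r * ∑ (suc n) (λ j → k j * u j r))
      ≈⟨ ∑-cong-< (suc n) (λ r r<1+n → *-congˡ (kernel n r (ℕ.≤-pred r<1+n))) ⟩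
    ∑ (suc n) (λ r → α r * (q ^ (r *ₙ suc r) * u n r))
      ≈⟨ ∑-cong (suc n) (λ r → solve 3 (λ a e u → a :* (e :* u) := (e :* a) :* u) refl (α r) (q ^ (r *ₙ suc r)) (u n r)) ⟩
    β (λ r → q ^ (r *ₙ suc r) * α r) n ∎)
    where
    k : ℕ → Carrier
    k j = q ^ (j *ₙ suc j) * rest (suc n) j
    u : ℕ → ℕ → Carrier
    u j r = rest (suc j) r * inv (j +ₙ suc r)

-- The coefficients of the theta series in two variables z and w with zw = p.
module Theta {c ℓ} (R : CommutativeRing c ℓ) (z w p : CommutativeRing.Carrier R) where
  open CommutativeRing R hiding (zero)
  open Exp semiring using (_^_)

  -- t L K is the term of index s = K - L of the theta series: (-z)ˢ p^(s(s-1)/2)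
  -- for s ≥ 0, and (-w)⁻ˢ p^(s(s+1)/2) for s ≤ 0.
  t : ℕ → ℕ → Carrier
  t zero    zero    = 1#
  t zero    (suc K) = - (z * p ^ K) * t zero K
  t (suc L) zero    = - (w * p ^ L) * t L zero
  t (suc L) (suc K) = t L K

  -- The terms of index -r and r + 1 together.
  θ : ℕ → Carrier
  θ r = t r 0 + t 0 (suc r)

module TripleProduct {c ℓ} (R : CommutativeRing c ℓ) (z w p : CommutativeRing.Carrier R) (F : QFactorials R p) where
  open CommutativeRing R hiding (zero)
  open QSeries R p F
  open Bailey R p F using (β)
  open Theta R z w p
  open Exp semiring using (_^_; ^-homo-*)
  open IntegerRingSolver R
  open FiniteSums R
  open SetoidReasoning setoid

  -- The Gaussian binomial coefficient [n, K] in base p, 0 for K > n.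
  binomial : ℕ → ℕ → Carrier
  binomial n K = fact n * (inv K * rest (suc n) K)

  binomial-> : ∀ {n K} → n ℕ.< K → binomial n K ≈ 0#
  binomial-> n<K = trans (*-congˡ (trans (*-congˡ (rest-≥ n<K)) (zeroʳ _))) (zeroʳ _)

  binomial-0 : ∀ n → binomial n 0 ≈ 1#
  binomial-0 n = begin
    fact n * (inv 0 * inv n)   ≈⟨ *-congˡ (trans (*-congʳ inv-zero) (*-identityˡ _)) ⟩
    fact n * inv n             ≈⟨ fact-inv n ⟩
    1#                         ∎

  private
    expand : ∀ n K → binomial (suc n) (suc K) ≈ fact n * inv (suc K) * ((1# - p ^ suc n) * rest (suc n) K)
    expand n K = begin
      fact (suc n) * (inv (suc K) * rest (suc n) K)             ≈⟨ *-congʳ (fact-suc n) ⟩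
      fact n * (1# - p ^ suc n) * (inv (suc K) * rest (suc n) K) ≈⟨ solve 4 (λ f x i r → f :* x :* (i :* r) := f :* i :* (x :* r)) refl _ _ _ _ ⟩
      fact n * inv (suc K) * ((1# - p ^ suc n) * rest (suc n) K) ∎

  -- The two q-analogues of Pascal's rule.
  pascal : ∀ n K → binomial (suc n) (suc K) ≈ binomial n K + p ^ suc K * binomial n (suc K)
  pascal n K = begin
    binomial (suc n) (suc K)
      ≈⟨ expand n K ⟩
    f * i * ((1# - p ^ suc n) * r₁)
      ≈⟨ *-congˡ (solve 3 (λ p x r → (con (pos 1) :- p :* x) :* r := r :- p :* (x :* r)) refl p (p ^ n) r₁) ⟩
    f * i * (r₁ - p * (p ^ n * r₁))
      ≈⟨ *-congˡ (+-congˡ (-‿cong (*-congˡ (rest-step n K)))) ⟩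
    f * i * (r₁ - p * (p ^ K * (r₁ - r₀)))
      ≈⟨ solve 6 (λ f i r s p x → f :* i :* (r :- p :* (x :* (r :- s))) := f :* ((i :* (con (pos 1) :- p :* x)) :* r) :+ p :* x :* (f :* (i :* s))) refl f i r₁ r₀ p (p ^ K) ⟩
    f * ((i * (1# - p ^ suc K)) * r₁) + p ^ suc K * (f * (i * r₀))
      ≈⟨ +-congʳ (*-congˡ (*-congʳ (inv-suc K))) ⟨
    binomial n K + p ^ suc K * binomial n (suc K) ∎
    where
    f = fact n
    i = inv (suc K)
    r₁ = rest (suc n) K
    r₀ = rest n K

  pascal′ : ∀ K m → binomial (suc (K +ₙ m)) (suc K) ≈ binomial (K +ₙ m) (suc K) + p ^ m * binomial (K +ₙ m) K
  pascal′ K m = begin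
    binomial (suc (K +ₙ m)) (suc K)
      ≈⟨ expand (K +ₙ m) K ⟩
    f * i * ((1# - p ^ suc (K +ₙ m)) * r₁)
      ≈⟨ *-congˡ (*-congʳ (+-congˡ (-‿cong (^-homo-* p (suc K) m)))) ⟩
    f * i * ((1# - p ^ suc K * p ^ m) * r₁)
      ≈⟨ *-congˡ (solve 3 (λ k x r → (con (pos 1) :- k :* x) :* r := r :- k :* (x :* r)) refl (p ^ suc K) (p ^ m) r₁) ⟩
    f * i * (r₁ - p ^ suc K * (p ^ m * r₁))
      ≈⟨ solve 6 (λ f i r s k x → f :* i :* (r :- k :* (x :* r)) := f :* i :* ((r :- x :* r) :+ (con (pos 1) :- k) :* (x :* r))) refl f i r₁ r₀ (p ^ suc K) (p ^ m) ⟩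
    f * i * ((r₁ - p ^ m * r₁) + (1# - p ^ suc K) * (p ^ m * r₁))
      ≈⟨ *-congˡ (+-congʳ (+-congˡ (-‿cong (rest-step-diag K m)))) ⟩
    f * i * ((r₁ - (r₁ - r₀)) + (1# - p ^ suc K) * (p ^ m * r₁))
      ≈⟨ solve 6 (λ f i r s k x → f :* i :* ((r :- (r :- s)) :+ k :* (x :* r)) := f :* (i :* s) :+ x :* (f :* ((i :* k) :* r))) refl f i r₁ r₀ (1# - p ^ suc K) (p ^ m) ⟩
    f * (i * r₀) + p ^ m * (f * ((i * (1# - p ^ suc K)) * r₁))
      ≈⟨ +-congˡ (*-congˡ (*-congˡ (*-congʳ (inv-suc K)))) ⟨
    binomial (K +ₙ m) (suc K) + p ^ m * binomial (K +ₙ m) K ∎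
    where
    f = fact (K +ₙ m)
    i = inv (suc K)
    r₁ = rest (suc (K +ₙ m)) K
    r₀ = rest (K +ₙ m) K

  module _ (p≈zw : p ≈ z * w) where

    private
      -- The ratios of consecutive terms of the theta series, multiplied by powers
      -- of p that remove all negative exponents.
      t-down : ∀ L K → p ^ K * t (suc L) K ≈ - (w * p ^ L) * t L K
      t-down L       zero    = *-identityˡ _
      t-down zero    (suc K) = begin
        p ^ suc K * t 0 K                              ≈⟨ *-congʳ (*-congʳ p≈zw) ⟩
        z * w * p ^ K * t 0 K                          ≈⟨ solve 4 (λ z w x t → z :* w :* x :* t := :- (w :* con (pos 1)) :* (:- (z :* x) :* t)) refl z w (p ^ K) (t 0 K) ⟩
        - (w * 1#) * (- (z * p ^ K) * t 0 K)           ∎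
      t-down (suc L) (suc K) = begin
        p ^ suc K * t (suc L) K                        ≈⟨ *-assoc _ _ _ ⟩
        p * (p ^ K * t (suc L) K)                      ≈⟨ *-congˡ (t-down L K) ⟩
        p * (- (w * p ^ L) * t L K)                    ≈⟨ solve 4 (λ p w x t → p :* (:- (w :* x) :* t) := :- (w :* (p :* x)) :* t) refl p w (p ^ L) (t L K) ⟩
        - (w * p ^ suc L) * t L K                      ∎

      t-up : ∀ L K m M → K +ₙ m ≡ L +ₙ M → p ^ m * t L (suc K) ≈ - (z * p ^ M) * t L K
      t-up zero K m .(K +ₙ m) ≡.refl = begin
        p ^ m * (- (z * p ^ K) * t 0 K)      ≈⟨ solve 4 (λ z x y t → x :* (:- (z :* y) :* t) := :- (z :* (y :* x)) :* t) refl z (p ^ m) (p ^ K) (t 0 K) ⟩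
        - (z * (p ^ K * p ^ m)) * t 0 K      ≈⟨ *-congʳ (-‿cong (*-congˡ (^-homo-* p K m))) ⟨
        - (z * p ^ (K +ₙ m)) * t 0 K         ∎
      t-up (suc L) zero .(suc L +ₙ M) M ≡.refl = begin
        p ^ (suc L +ₙ M) * t L 0                    ≈⟨ *-congʳ (trans (^-homo-* p (suc L) M) (*-congʳ (*-congʳ p≈zw))) ⟩
        z * w * p ^ L * p ^ M * t L 0               ≈⟨ solve 5 (λ z w x y t → z :* w :* x :* y :* t := :- (z :* y) :* (:- (w :* x) :* t)) refl z w (p ^ L) (p ^ M) (t L 0) ⟩
        - (z * p ^ M) * (- (w * p ^ L) * t L 0)     ∎
      t-up (suc L) (suc K) m M eq = t-up L K m M (ℕ.suc-injective eq)

    -- The theta series truncated by Gaussian binomials.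
    partialSum : ℕ → ℕ → Carrier
    partialSum L n = ∑ (suc n) (λ K → t L K * binomial n K)

    -- Passing from [2L, K] to [2L + 1, K] contributes the factor 1 - z pᴸ.
    partialSum-odd : ∀ L → partialSum L (suc (L +ₙ L)) ≈ partialSum L (L +ₙ L) * (1# - z * p ^ L)
    partialSum-odd L = begin
      ∑ (suc (suc n)) (λ K → t L K * binomial (suc n) K)
        ≈⟨ ∑-suc (suc n) _ ⟩
      t L 0 * binomial (suc n) 0 + ∑ (suc n) (λ K → t L (suc K) * binomial (suc n) (suc K))
        ≈⟨ +-cong (*-congˡ (trans (binomial-0 (suc n)) (sym (binomial-0 n)))) (∑-cong-< (suc n) term) ⟩
      t L 0 * binomial n 0 + ∑ (suc n) (λ K → t L (suc K) * binomial n (suc K) + - (z * p ^ L) * (t L K * binomial n K))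
        ≈⟨ +-congˡ (∑-+ (suc n) _ _) ⟩
      t L 0 * binomial n 0 + (∑ (suc n) (λ K → t L (suc K) * binomial n (suc K)) + ∑ (suc n) (λ K → - (z * p ^ L) * (t L K * binomial n K)))
        ≈⟨ +-assoc _ _ _ ⟨
      (t L 0 * binomial n 0 + ∑ (suc n) (λ K → t L (suc K) * binomial n (suc K))) + ∑ (suc n) (λ K → - (z * p ^ L) * (t L K * binomial n K))
        ≈⟨ +-cong (trans (sym (∑-suc (suc n) (λ K → t L K * binomial n K)))
             (sym (∑-extend (λ K → t L K * binomial n K) (ℕ.n≤1+n (suc n)) (λ K n<K → trans (*-congˡ (binomial-> n<K)) (zeroʳ _)))))
             (sym (∑-*ˡ (suc n) _ _)) ⟩
      partialSum L n + - (z * p ^ L) * partialSum L n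
        ≈⟨ solve 2 (λ s x → s :+ :- x :* s := s :* (con (pos 1) :- x)) refl (partialSum L n) (z * p ^ L) ⟩
      partialSum L n * (1# - z * p ^ L) ∎
      where
      n = L +ₙ L
      term : ∀ K → K ℕ.< suc n → t L (suc K) * binomial (suc n) (suc K) ≈
        t L (suc K) * binomial n (suc K) + - (z * p ^ L) * (t L K * binomial n K)
      term K K<1+n with ℕ.m≤n⇒∃[o]m+o≡n (ℕ.≤-pred K<1+n)
      ... | m , eq = begin
        t L (suc K) * binomial (suc n) (suc K)
          ≈⟨ *-congˡ (≡.subst (λ n → binomial (suc n) (suc K) ≈ binomial n (suc K) + p ^ m * binomial n K) eq (pascal′ K m)) ⟩
        t L (suc K) * (binomial n (suc K) + p ^ m * binomial n K)
          ≈⟨ solve 4 (λ t b x d → t :* (b :+ x :* d) := t :* b :+ x :* t :* d) refl (t L (suc K)) (binomial n (suc K)) (p ^ m) (binomial n K) ⟩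
        t L (suc K) * binomial n (suc K) + p ^ m * t L (suc K) * binomial n K
          ≈⟨ +-congˡ (trans (*-congʳ (t-up L K m L eq)) (*-assoc _ _ _)) ⟩
        t L (suc K) * binomial n (suc K) + - (z * p ^ L) * (t L K * binomial n K) ∎

    -- Passing from [2L + 1, K] to [2L + 2, K + 1] contributes the factor 1 - w pᴸ.
    partialSum-even : ∀ L n → partialSum (suc L) (suc n) ≈ partialSum L n * (1# - w * p ^ L)
    partialSum-even L n = begin
      ∑ (suc (suc n)) (λ K → t (suc L) K * binomial (suc n) K)
        ≈⟨ ∑-suc (suc n) _ ⟩
      t (suc L) 0 * binomial (suc n) 0 + ∑ (suc n) (λ K → t L K * binomial (suc n) (suc K))
        ≈⟨ +-cong (*-congˡ (trans (binomial-0 (suc n)) (sym (trans (*-identityˡ _) (binomial-0 n)))))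
             (∑-cong (suc n) (λ K → trans (*-congˡ (pascal n K)) (distribˡ _ _ _))) ⟩
      t (suc L) 0 * (1# * binomial n 0) + ∑ (suc n) (λ K → t L K * binomial n K + t L K * (p ^ suc K * binomial n (suc K)))
        ≈⟨ +-congˡ (∑-+ (suc n) _ _) ⟩
      t (suc L) 0 * (1# * binomial n 0) + (partialSum L n + ∑ (suc n) (λ K → t L K * (p ^ suc K * binomial n (suc K))))
        ≈⟨ solve 3 (λ a b d → a :+ (b :+ d) := b :+ (a :+ d)) refl _ _ _ ⟩
      partialSum L n + (t (suc L) 0 * (1# * binomial n 0) + ∑ (suc n) (λ K → t L K * (p ^ suc K * binomial n (suc K))))
        ≈⟨ +-congˡ (∑-suc (suc n) (λ K → t (suc L) K * (p ^ K * binomial n K))) ⟨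
      partialSum L n + ∑ (suc (suc n)) (λ K → t (suc L) K * (p ^ K * binomial n K))
        ≈⟨ +-congˡ (∑-extend (λ K → t (suc L) K * (p ^ K * binomial n K)) (ℕ.n≤1+n (suc n))
             (λ K n<K → trans (*-congˡ (trans (*-congˡ (binomial-> n<K)) (zeroʳ _))) (zeroʳ _))) ⟨
      partialSum L n + ∑ (suc n) (λ K → t (suc L) K * (p ^ K * binomial n K))
        ≈⟨ +-congˡ (∑-cong (suc n) (λ K → trans (solve 3 (λ t x b → t :* (x :* b) := (x :* t) :* b) refl (t (suc L) K) (p ^ K) (binomial n K))
              (trans (*-congʳ (t-down L K)) (*-assoc _ _ _)))) ⟩
      partialSum L n + ∑ (suc n) (λ K → - (w * p ^ L) * (t L K * binomial n K))
        ≈⟨ +-congˡ (∑-*ˡ (suc n) _ _) ⟨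
      partialSum L n + - (w * p ^ L) * partialSum L n
        ≈⟨ solve 2 (λ s x → s :+ :- x :* s := s :* (con (pos 1) :- x)) refl (partialSum L n) (w * p ^ L) ⟩
      partialSum L n * (1# - w * p ^ L) ∎

    private
      t-left : ∀ K r → t (K +ₙ r) K ≈ t r 0
      t-left zero    r = refl
      t-left (suc K) r = t-left K r

      t-right : ∀ L K → t L (L +ₙ K) ≈ t 0 K
      t-right zero    K = refl
      t-right (suc L) K = t-right L K

    -- A finite form of the Jacobi triple product identity; here Z n = (z; p)ₙ and
    -- W n = (w; p)ₙ.
    tripleProduct : (Z W : ℕ → Carrier) → Z 0 ≈ 1# → (∀ n → Z (suc n) ≈ Z n * (1# - z * p ^ n)) →
      W 0 ≈ 1# → (∀ n → W (suc n) ≈ W n * (1# - w * p ^ n)) →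
      ∀ L → fact (suc (L +ₙ L)) * β θ L ≈ Z (suc L) * W L
    tripleProduct Z W Z-zero Z-suc W-zero W-suc L = trans (sym fold) (odd L)
      where
      even : ∀ L → partialSum L (L +ₙ L) ≈ Z L * W L
      odd  : ∀ L → partialSum L (suc (L +ₙ L)) ≈ Z (suc L) * W L
      odd L = begin
        partialSum L (suc (L +ₙ L))                 ≈⟨ partialSum-odd L ⟩
        partialSum L (L +ₙ L) * (1# - z * p ^ L)    ≈⟨ *-congʳ (even L) ⟩
        Z L * W L * (1# - z * p ^ L)                ≈⟨ solve 3 (λ a b x → a :* b :* x := a :* x :* b) refl _ _ _ ⟩
        Z L * (1# - z * p ^ L) * W L                ≈⟨ *-congʳ (Z-suc L) ⟨
        Z (suc L) * W L                             ∎
      even zero    = begin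
        partialSum 0 0                       ≈⟨ trans (∑-suc 0 _) (trans (+-congˡ (∑-0 _)) (+-identityʳ _)) ⟩
        1# * binomial 0 0                    ≈⟨ *-cong (sym Z-zero) (trans (binomial-0 0) (sym W-zero)) ⟩
        Z 0 * W 0                            ∎
      even (suc L) = begin
        partialSum (suc L) (suc L +ₙ suc L)            ≈⟨ reflexive (≡.cong (λ n → partialSum (suc L) (suc n)) (ℕ.+-suc L L)) ⟩
        partialSum (suc L) (suc (suc (L +ₙ L)))        ≈⟨ partialSum-even L (suc (L +ₙ L)) ⟩
        partialSum L (suc (L +ₙ L)) * (1# - w * p ^ L) ≈⟨ *-congʳ (odd L) ⟩
        Z (suc L) * W L * (1# - w * p ^ L)             ≈⟨ *-assoc _ _ _ ⟩
        Z (suc L) * (W L * (1# - w * p ^ L))           ≈⟨ *-congˡ (W-suc L) ⟨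
        Z (suc L) * W (suc L)                          ∎

      f = fact (suc (L +ₙ L))

      left : ∀ r → r ℕ.< suc L → t L (L ∸ r) * binomial (suc (L +ₙ L)) (L ∸ r) ≈ f * (t r 0 * (rest (suc L) r * inv (L +ₙ suc r)))
      left r r<1+L with ℕ.m≤n⇒∃[o]m+o≡n (ℕ.≤-pred r<1+L)
      ... | m , ≡.refl = begin
        t L (L ∸ r) * (f * (inv (L ∸ r) * rest (suc (suc (L +ₙ L))) (L ∸ r)))
          ≈⟨ reflexive (≡.cong (λ k → t L k * (f * (inv k * rest (suc (suc (L +ₙ L))) k))) (ℕ.m+n∸m≡n r m)) ⟩
        t L m * (f * (inv m * rest (suc (suc (L +ₙ L))) m))
          ≈⟨ *-cong (trans (reflexive (≡.cong (λ k → t k m) (ℕ.+-comm r m))) (t-left m r))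
               (*-congˡ (*-cong (sym (rest-diag r m)) (trans (reflexive (≡.cong (λ k → rest (suc k) m) (index r m))) (rest-diag m (L +ₙ suc r))))) ⟩
        t r 0 * (f * (rest (suc L) r * inv (L +ₙ suc r)))
          ≈⟨ solve 4 (λ t f a b → t :* (f :* (a :* b)) := f :* (t :* (a :* b))) refl _ _ _ _ ⟩
        f * (t r 0 * (rest (suc L) r * inv (L +ₙ suc r))) ∎
        where
        index : ∀ r m → suc ((r +ₙ m) +ₙ (r +ₙ m)) ≡ m +ₙ ((r +ₙ m) +ₙ suc r)
        index = solve-∀

      right : ∀ r → r ℕ.< suc L → t L (suc L +ₙ r) * binomial (suc (L +ₙ L)) (suc L +ₙ r) ≈ f * (t 0 (suc r) * (rest (suc L) r * inv (L +ₙ suc r)))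
      right r _ = begin
        t L (suc L +ₙ r) * (f * (inv (suc L +ₙ r) * rest (suc (suc (L +ₙ L))) (suc L +ₙ r)))
          ≈⟨ *-cong (trans (reflexive (≡.cong (t L) (≡.sym (ℕ.+-suc L r)))) (t-right L (suc r)))
               (*-congˡ (*-cong (reflexive (≡.cong inv (≡.sym (ℕ.+-suc L r))))
                 (trans (rest-+ (suc (suc (L +ₙ L))) (suc L) r) (reflexive (≡.cong (λ k → rest k r) (≡.trans (≡.cong (_∸ L) (≡.sym (ℕ.+-suc L L))) (ℕ.m+n∸m≡n L (suc L)))))))) ⟩
        t 0 (suc r) * (f * (inv (L +ₙ suc r) * rest (suc L) r))
          ≈⟨ solve 4 (λ t f a b → t :* (f :* (a :* b)) := f :* (t :* (b :* a))) refl _ _ _ _ ⟩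
        f * (t 0 (suc r) * (rest (suc L) r * inv (L +ₙ suc r))) ∎

      -- The terms of index -r and r + 1 carry the same binomial coefficient.
      fold : partialSum L (suc (L +ₙ L)) ≈ f * β θ L
      fold = begin
        ∑ (suc (suc (L +ₙ L))) g
          ≈⟨ reflexive (≡.cong (λ k → ∑ (suc k) g) (≡.sym (ℕ.+-suc L L))) ⟩
        ∑ (suc L +ₙ suc L) g
          ≈⟨ ∑-++ (suc L) (suc L) g ⟩
        ∑ (suc L) g + ∑ (suc L) (λ r → g (suc L +ₙ r))
          ≈⟨ +-cong (trans (∑-reverse L g) (∑-cong-< (suc L) left)) (∑-cong-< (suc L) right) ⟩
        ∑ (suc L) (λ r → f * (t r 0 * v r)) + ∑ (suc L) (λ r → f * (t 0 (suc r) * v r))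
          ≈⟨ ∑-+ (suc L) _ _ ⟨
        ∑ (suc L) (λ r → f * (t r 0 * v r) + f * (t 0 (suc r) * v r))
          ≈⟨ ∑-cong (suc L) (λ r → solve 4 (λ f a b v → f :* (a :* v) :+ f :* (b :* v) := f :* ((a :+ b) :* v)) refl f (t r 0) (t 0 (suc r)) (v r)) ⟩
        ∑ (suc L) (λ r → f * (θ r * v r))
          ≈⟨ ∑-*ˡ (suc L) f (λ r → θ r * v r) ⟨
        f * β θ L ∎
        where
        g : ℕ → Carrier
        g K = t L K * binomial (suc (L +ₙ L)) K
        v : ℕ → Carrier
        v r = rest (suc L) r * inv (L +ₙ suc r)

-- The Andrews-Gordon theta series and the transfer operator

module ThetaScaling {c ℓ} (R : CommutativeRing c ℓ) where
  open CommutativeRing R hiding (zero)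
  open Theta R
  open Exp semiring using (_^_; ^-congʳ; ^-congˡ; ^-homo-*)
  open IntegerRingSolver R
  open SetoidReasoning setoid

  *-^ : ∀ x y n → (x * y) ^ n ≈ x ^ n * y ^ n
  *-^ x y zero    = sym (*-identityˡ _)
  *-^ x y (suc n) = trans (*-congˡ (*-^ x y n)) (solve 4 (λ x y a b → x :* y :* (a :* b) := x :* a :* (y :* b)) refl x y _ _)

  -- Multiplying w and p by e² multiplies the r-th pair of terms by e^(r² + r).
  θ-scale : ∀ z {w w′ p p′} e → w′ ≈ w * (e * e) → p′ ≈ p * (e * e) →
    ∀ r → θ z w′ p′ r ≈ e ^ (r *ₙ suc r) * θ z w p r
  θ-scale z {w} {w′} {p} {p′} e w′≈ p′≈ r = trans (+-cong (left r) (right r)) (sym (distribˡ _ _ _))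
    where
    exponent : ∀ r → suc r *ₙ suc (suc r) ≡ r *ₙ suc r +ₙ (suc r +ₙ suc r)
    exponent = solve-∀

    next : ∀ r → e ^ (suc r *ₙ suc (suc r)) ≈ e ^ (r *ₙ suc r) * (e * e) ^ suc r
    next r = begin
      e ^ (suc r *ₙ suc (suc r))                  ≈⟨ ^-congʳ e (exponent r) ⟩
      e ^ (r *ₙ suc r +ₙ (suc r +ₙ suc r))        ≈⟨ ^-homo-* e (r *ₙ suc r) _ ⟩
      e ^ (r *ₙ suc r) * e ^ (suc r +ₙ suc r)     ≈⟨ *-congˡ (trans (^-homo-* e (suc r) (suc r)) (sym (*-^ e e (suc r)))) ⟩
      e ^ (r *ₙ suc r) * (e * e) ^ suc r          ∎

    power : ∀ n → p′ ^ n ≈ p ^ n * (e * e) ^ n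
    power n = trans (^-congˡ n p′≈) (*-^ p (e * e) n)

    left : ∀ r → t z w′ p′ r 0 ≈ e ^ (r *ₙ suc r) * t z w p r 0
    left zero    = sym (*-identityˡ _)
    left (suc r) = begin
      - (w′ * p′ ^ r) * t z w′ p′ r 0
        ≈⟨ *-cong (-‿cong (*-cong w′≈ (power r))) (left r) ⟩
      - (w * (e * e) * (p ^ r * (e * e) ^ r)) * (e ^ (r *ₙ suc r) * t z w p r 0)
        ≈⟨ solve 6 (λ w f x g h t → :- (w :* f :* (x :* g)) :* (h :* t) := h :* (f :* g) :* (:- (w :* x) :* t)) refl w (e * e) (p ^ r) ((e * e) ^ r) _ _ ⟩
      e ^ (r *ₙ suc r) * (e * e) ^ suc r * (- (w * p ^ r) * t z w p r 0)
        ≈⟨ *-congʳ (next r) ⟨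
      e ^ (suc r *ₙ suc (suc r)) * (- (w * p ^ r) * t z w p r 0) ∎

    right : ∀ r → t z w′ p′ 0 (suc r) ≈ e ^ (r *ₙ suc r) * t z w p 0 (suc r)
    right zero    = sym (*-identityˡ _)
    right (suc r) = begin
      - (z * p′ ^ suc r) * t z w′ p′ 0 (suc r)
        ≈⟨ *-cong (-‿cong (*-congˡ (power (suc r)))) (right r) ⟩
      - (z * (p ^ suc r * (e * e) ^ suc r)) * (e ^ (r *ₙ suc r) * t z w p 0 (suc r))
        ≈⟨ solve 5 (λ z x g h t → :- (z :* (x :* g)) :* (h :* t) := h :* g :* (:- (z :* x) :* t)) refl z _ _ _ _ ⟩
      e ^ (r *ₙ suc r) * (e * e) ^ suc r * (- (z * p ^ suc r) * t z w p 0 (suc r))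
        ≈⟨ *-congʳ (next r) ⟨
      e ^ (suc r *ₙ suc (suc r)) * (- (z * p ^ suc r) * t z w p 0 (suc r)) ∎

module AndrewsGordon {c ℓ} (R : CommutativeRing c ℓ) (q : CommutativeRing.Carrier R) (F : QFactorials R q) where
  open CommutativeRing R hiding (zero)
  open QSeries R q F
  open Bailey R q F
  open Theta R
  open ThetaScaling R
  open Exp semiring using (_^_; ^-congʳ)
  open IntegerRingSolver R
  open FiniteSums R
  open SetoidReasoning setoid

  -- The sequences αᵣ of the Bailey chain that starts at the unit Bailey pair;
  -- explicitly, (-1)ʳ q^(r(r-1)/2 + k(r²+r)) (1 - q²ʳ⁺¹).
  α : ℕ → ℕ → Carrier
  α zero    r = θ q 1# q r
  α (suc k) r = q ^ (r *ₙ suc r) * α k r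

  -- In base q²ᵏ⁺¹ the same sequence belongs to the triple product at z = q.
  α≈θ : ∀ k {w p} → w ≈ q ^ (k +ₙ k) → p ≈ q ^ suc (k +ₙ k) → ∀ r → α k r ≈ θ q w p r
  α≈θ zero    {w} {p} w≈ p≈ r = sym (begin
    θ q w p r              ≈⟨ θ-scale q 1# (trans w≈ one) (trans p≈ (*-congˡ (sym (*-identityˡ 1#)))) r ⟩
    1# ^ (r *ₙ suc r) * θ q 1# q r   ≈⟨ *-congʳ (one-^ (r *ₙ suc r)) ⟩
    1# * θ q 1# q r                  ≈⟨ *-identityˡ _ ⟩
    θ q 1# q r                       ∎)
    where
    one : 1# ≈ 1# * (1# * 1#)
    one = solve 0 (con (pos 1) := con (pos 1) :* (con (pos 1) :* con (pos 1))) refl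
    one-^ : ∀ n → 1# ^ n ≈ 1#
    one-^ zero    = refl
    one-^ (suc n) = trans (*-identityˡ _) (one-^ n)
  α≈θ (suc k) {w} {p} w≈ p≈ r = trans (*-congˡ (α≈θ k refl refl r))
    (sym (θ-scale q q (trans w≈ shift) (trans p≈ (trans (*-congˡ shift) (sym (*-assoc _ _ _)))) r))
    where
    shift : q ^ (suc k +ₙ suc k) ≈ q ^ (k +ₙ k) * (q * q)
    shift = begin
      q * q ^ (k +ₙ suc k)      ≈⟨ *-congˡ (^-congʳ q (ℕ.+-suc k k)) ⟩
      q * (q * q ^ (k +ₙ k))    ≈⟨ solve 2 (λ q x → q :* (q :* x) := x :* (q :* q)) refl q _ ⟩
      q ^ (k +ₙ k) * (q * q)    ∎

  private
    -- (1; q)ₙ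
    δ₀ : ℕ → Carrier
    δ₀ zero    = 1#
    δ₀ (suc _) = 0#

    δ₀-suc : ∀ n → δ₀ (suc n) ≈ δ₀ n * (1# - 1# * q ^ n)
    δ₀-suc zero    = solve 0 (con (pos 0) := con (pos 1) :* (con (pos 1) :- con (pos 1) :* con (pos 1))) refl
    δ₀-suc (suc n) = sym (zeroˡ _)

  -- The unit Bailey pair is the finite triple product at z = q, w = 1.
  β-unit : ∀ L → β (α 0) L ≈ δ₀ L
  β-unit L = begin
    β (α 0) L                                  ≈⟨ *-identityˡ _ ⟨
    1# * β (α 0) L                             ≈⟨ *-congʳ (trans (sym (fact-inv _)) (*-comm _ _)) ⟩
    inv m * fact m * β (α 0) L                 ≈⟨ *-assoc _ _ _ ⟩
    inv m * (fact m * β (α 0) L)               ≈⟨ *-congˡ (TripleProduct.tripleProduct R q 1# q F (sym (*-identityʳ q)) fact δ₀ fact-zero fact-suc refl δ₀-suc L) ⟩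
    inv m * (fact (suc L) * δ₀ L)              ≈⟨ collapse L ⟩
    δ₀ L                                       ∎
    where
    m = suc (L +ₙ L)
    collapse : ∀ L → inv (suc (L +ₙ L)) * (fact (suc L) * δ₀ L) ≈ δ₀ L
    collapse zero    = trans (sym (*-assoc _ _ _)) (trans (*-identityʳ _) (trans (*-comm _ _) (fact-inv 1)))
    collapse (suc L) = trans (*-congˡ (zeroʳ _)) (zeroʳ _)

  -- The next pair of the chain has βₙ = 1/(q)ₙ.
  β-one : ∀ n → β (α 1) n ≈ inv n
  β-one n = begin
    β (α 1) n                                                         ≈⟨ β-step (α 0) n ⟩
    ∑ (suc n) (λ j → (q ^ (j *ₙ suc j) * rest (suc n) j) * β (α 0) j)  ≈⟨ ∑-cong (suc n) (λ j → *-congˡ (β-unit j)) ⟩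
    ∑ (suc n) (λ j → (q ^ (j *ₙ suc j) * rest (suc n) j) * δ₀ j)       ≈⟨ ∑-suc n _ ⟩
    (1# * inv n) * 1# + ∑ n (λ j → (q ^ (suc j *ₙ suc (suc j)) * rest n j) * 0#)
      ≈⟨ +-cong (trans (*-identityʳ _) (*-identityˡ _)) (∑-zero n (λ j → zeroʳ _)) ⟩
    inv n + 0#                                                        ≈⟨ +-identityʳ _ ⟩
    inv n                                                             ∎

module Transfer {c ℓ} (R : CommutativeRing c ℓ) (q : CommutativeRing.Carrier R) (F : QFactorials R q) where
  open CommutativeRing R hiding (zero)
  open QSeries R q F
  open Exp semiring using (_^_; ^-congʳ; ^-homo-*)
  open IntegerRingSolver R
  open FiniteSums R
  open SetoidReasoning setoid

  -- The truncated transfer operator: g is sent to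
  -- m ↦ ∑ₙ q^(n(m+1)) g(n) / (q)ₙ², the sum being over n < N.
  T : ℕ → (ℕ → Carrier) → ℕ → Carrier
  T N g m = ∑ N (λ n → (q ^ (n *ₙ suc m) * (inv n * inv n)) * g n)

  T-cong : ∀ N {g h : ℕ → Carrier} → (∀ n → g n ≈ h n) → ∀ m → T N g m ≈ T N h m
  T-cong N g≈h m = ∑-cong N (λ n → *-congˡ (g≈h n))

  T-*ˡ : ∀ N x (g : ℕ → Carrier) m → T N (λ n → x * g n) m ≈ x * T N g m
  T-*ˡ N x g m = trans (∑-cong N (λ n → solve 3 (λ a x g → a :* (x :* g) := x :* (a :* g)) refl _ x (g n))) (sym (∑-*ˡ N x _))

  T-- : ∀ N (g h : ℕ → Carrier) m → T N (λ n → g n - h n) m ≈ T N g m - T N h m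
  T-- N g h m = trans (∑-cong N (λ n → solve 3 (λ a g h → a :* (g :- h) := a :* g :- a :* h) refl _ (g n) (h n))) (∑-- N _ _)

  T-∑ : ∀ N M (g : ℕ → ℕ → Carrier) m → T N (λ n → ∑ M (λ j → g j n)) m ≈ ∑ M (λ j → T N (g j) m)
  T-∑ N M g m = trans (∑-cong N (λ n → ∑-*ˡ M _ (λ j → g j n))) (∑-swap N M _)

  -- The d-th iterate of T N.
  T^ : ℕ → ℕ → (ℕ → Carrier) → ℕ → Carrier
  T^ N zero    g = g
  T^ N (suc d) g = T N (T^ N d g)

  T^-+ : ∀ N d e (g : ℕ → Carrier) → T^ N (d +ₙ e) g ≡ T^ N d (T^ N e g)
  T^-+ N zero    e g = ≡.refl
  T^-+ N (suc d) e g = ≡.cong (T N) (T^-+ N d e g)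

  T^-*ˡ : ∀ N d x (g : ℕ → Carrier) m → T^ N d (λ n → x * g n) m ≈ x * T^ N d g m
  T^-*ˡ N zero    x g m = refl
  T^-*ˡ N (suc d) x g m = trans (T-cong N (T^-*ˡ N d x g) m) (T-*ˡ N x _ m)

  T^-- : ∀ N d (g h : ℕ → Carrier) m → T^ N d (λ n → g n - h n) m ≈ T^ N d g m - T^ N d h m
  T^-- N zero    g h m = refl
  T^-- N (suc d) g h m = trans (T-cong N (T^-- N d g h) m) (T-- N _ _ m)

  T^-∑ : ∀ N d M (g : ℕ → ℕ → Carrier) m → T^ N d (λ n → ∑ M (λ j → g j n)) m ≈ ∑ M (λ j → T^ N d (g j) m)
  T^-∑ N zero    M g m = refl
  T^-∑ N (suc d) M g m = trans (T-cong N (T^-∑ N d M g) m) (T-∑ N M (λ j → T^ N d (g j)) m)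

  -- The partial sums of Euler's series ∑ zᵐ / (q)ₘ at z = qˢ⁺¹.
  euler : ℕ → ℕ → Carrier
  euler s N = ∑ N (λ m → q ^ (m *ₙ suc s) * inv m)

  private
    euler-last : ∀ s N → euler s (suc N) ≈ euler s N + q ^ (N *ₙ suc s) * inv N
    euler-last s N = ∑-last N _

    euler-0 : ∀ N → euler 0 (suc N) ≈ inv N
    euler-0 zero = begin
      euler 0 1              ≈⟨ euler-last 0 0 ⟩
      euler 0 0 + 1# * inv 0 ≈⟨ +-cong (∑-0 _) (*-identityˡ _) ⟩
      0# + inv 0             ≈⟨ +-identityˡ _ ⟩
      inv 0                  ∎
    euler-0 (suc N) = begin
      euler 0 (suc (suc N))                              ≈⟨ euler-last 0 (suc N) ⟩
      euler 0 (suc N) + q ^ (suc N *ₙ 1) * i             ≈⟨ +-cong (trans (euler-0 N) (inv-suc N)) (*-congʳ (^-congʳ q (ℕ.*-identityʳ (suc N)))) ⟩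
      i * (1# - q ^ suc N) + q ^ suc N * i               ≈⟨ solve 2 (λ i x → i :* (con (pos 1) :- x) :+ x :* i := i) refl i (q ^ suc N) ⟩
      i                                                  ∎
      where i = inv (suc N)

    euler-suc : ∀ s N → euler (suc s) (suc N) ≈ (1# - q ^ suc s) * euler s (suc N) + q ^ (suc N *ₙ suc s) * inv N
    euler-suc s zero = begin
      euler (suc s) 1        ≈⟨ trans (euler-last (suc s) 0) (+-cong (∑-0 _) (*-identityˡ _)) ⟩
      0# + inv 0             ≈⟨ solve 2 (λ i x → con (pos 0) :+ i := (con (pos 1) :- x) :* (con (pos 0) :+ i) :+ x :* i) refl (inv 0) (q ^ suc s) ⟩
      (1# - q ^ suc s) * (0# + inv 0) + q ^ suc s * inv 0
        ≈⟨ +-cong (*-congˡ (sym (trans (euler-last s 0) (+-cong (∑-0 _) (*-identityˡ _))))) (*-congʳ (^-congʳ q (≡.sym (ℕ.*-identityˡ (suc s))))) ⟩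
      (1# - q ^ suc s) * euler s 1 + q ^ (1 *ₙ suc s) * inv 0 ∎
    euler-suc s (suc N) = begin
      euler (suc s) (suc (suc N))
        ≈⟨ euler-last (suc s) (suc N) ⟩
      euler (suc s) (suc N) + q ^ (suc N *ₙ suc (suc s)) * i
        ≈⟨ +-cong (trans (euler-suc s N) (+-congˡ (*-congˡ (inv-suc N))))
             (*-congʳ (trans (^-congʳ q (ℕ.*-suc (suc N) (suc s))) (^-homo-* q (suc N) _))) ⟩
      (1# - Q) * euler s (suc N) + x * (i * (1# - q ^ suc N)) + q ^ suc N * x * i
        ≈⟨ solve 5 (λ Q e x i y → (con (pos 1) :- Q) :* e :+ x :* (i :* (con (pos 1) :- y)) :+ y :* x :* i
              := (con (pos 1) :- Q) :* (e :+ x :* i) :+ Q :* x :* i) refl Q (euler s (suc N)) x i (q ^ suc N) ⟩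
      (1# - Q) * (euler s (suc N) + x * i) + Q * x * i
        ≈⟨ +-cong (*-congˡ (euler-last s (suc N))) (*-congʳ (^-homo-* q (suc s) _)) ⟨
      (1# - Q) * euler s (suc (suc N)) + q ^ (suc (suc N) *ₙ suc s) * i ∎
      where
      i = inv (suc N)
      Q = q ^ suc s
      x = q ^ (suc N *ₙ suc s)

  -- A finite form of Euler's ∑ₘ q^(m(s+1)) / (q)ₘ = (q)ₛ / (q)_∞, which exchanges
  -- the roles of s and N.
  euler-finite : ∀ s N → euler s (suc N) ≈ fact s * (inv N * ∑ (suc s) (λ t → q ^ (suc N *ₙ t) * inv t))
  euler-finite zero N = begin
    euler 0 (suc N)                 ≈⟨ euler-0 N ⟩
    inv N                           ≈⟨ solve 1 (λ i → i := con (pos 1) :* (i :* (con (pos 1) :* con (pos 1) :+ con (pos 0)))) refl (inv N) ⟩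
    1# * (inv N * (1# * 1# + 0#))
      ≈⟨ *-cong (sym fact-zero) (*-congˡ (sym (trans (∑-suc 0 _) (+-cong (*-cong (^-congʳ q (ℕ.*-zeroʳ N)) inv-zero) (∑-0 _))))) ⟩
    fact 0 * (inv N * ∑ 1 (λ t → q ^ (suc N *ₙ t) * inv t)) ∎
  euler-finite (suc s) N = begin
    euler (suc s) (suc N)
      ≈⟨ euler-suc s N ⟩
    (1# - Q) * euler s (suc N) + x * inv N
      ≈⟨ +-cong (*-congˡ (euler-finite s N)) (trans (sym (*-identityˡ _)) (*-congʳ (sym (fact-inv (suc s))))) ⟩
    (1# - Q) * (fact s * (inv N * S)) + fact (suc s) * inv (suc s) * (x * inv N)
      ≈⟨ solve 7 (λ Q f n S g i x → Q :* (f :* (n :* S)) :+ g :* i :* (x :* n) := f :* Q :* (n :* S) :+ g :* (n :* (x :* i))) refl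
           (1# - Q) (fact s) (inv N) S (fact (suc s)) (inv (suc s)) x ⟩
    fact s * (1# - Q) * (inv N * S) + fact (suc s) * (inv N * (x * inv (suc s)))
      ≈⟨ +-congʳ (*-congʳ (fact-suc s)) ⟨
    fact (suc s) * (inv N * S) + fact (suc s) * (inv N * (x * inv (suc s)))
      ≈⟨ solve 4 (λ g n S y → g :* (n :* S) :+ g :* (n :* y) := g :* (n :* (S :+ y))) refl _ _ _ _ ⟩
    fact (suc s) * (inv N * (S + x * inv (suc s)))
      ≈⟨ *-congˡ (*-congˡ (∑-last (suc s) (λ t → q ^ (suc N *ₙ t) * inv t))) ⟨
    fact (suc s) * (inv N * ∑ (suc (suc s)) (λ t → q ^ (suc N *ₙ t) * inv t)) ∎
    where
    Q = q ^ suc s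
    x = q ^ (suc N *ₙ suc s)
    S = ∑ (suc s) (λ t → q ^ (suc N *ₙ t) * inv t)

  -- T maps the span of the functions φ n to that of the functions ψ j and back,
  -- up to the factor 1/(q)_∞ and an error from the truncation.
  φ ψ : ℕ → ℕ → Carrier
  φ n l = fact (l +ₙ n) * (inv n * inv n)
  ψ j m = fact m * (q ^ (j *ₙ m) * (inv j * inv j))

  -- The weights q^(j²+j) / (q)ₙ₋ⱼ of the Bailey chain.
  weight : ℕ → ℕ → Carrier
  weight n j = q ^ (j *ₙ suc j) * rest (suc n) j

  -- Expanding (q)ₗ₊ₙ by the q-Vandermonde sum and summing over l.
  T-φ : ∀ N n m → T N (φ n) m ≈ ∑ (suc n) (λ j → weight n j * (q ^ (j *ₙ m) * (inv j * inv j) * euler m (N ∸ j)))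
  T-φ N n m = begin
    ∑ N (λ l → (q ^ (l *ₙ suc m) * (inv l * inv l)) * φ n l)
      ≈⟨ ∑-cong N expand ⟩
    ∑ N (λ l → ∑ (suc n) (λ j → v j * (q ^ (l *ₙ suc m) * rest (suc l) j)))
      ≈⟨ ∑-swap N (suc n) _ ⟩
    ∑ (suc n) (λ j → ∑ N (λ l → v j * (q ^ (l *ₙ suc m) * rest (suc l) j)))
      ≈⟨ ∑-cong (suc n) (λ j → trans (sym (∑-*ˡ N (v j) _)) (*-congˡ (∑-rest N j (λ l → q ^ (l *ₙ suc m))))) ⟩
    ∑ (suc n) (λ j → v j * ∑ (N ∸ j) (λ s → q ^ ((j +ₙ s) *ₙ suc m) * inv s))
      ≈⟨ ∑-cong (suc n) collect ⟩
    ∑ (suc n) (λ j → weight n j * (q ^ (j *ₙ m) * (inv j * inv j) * euler m (N ∸ j))) ∎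
    where
    v : ℕ → Carrier
    v j = q ^ (j *ₙ (j +ₙ 0)) * (inv j * inv (j +ₙ 0)) * rest (suc n) j

    expand : ∀ l → (q ^ (l *ₙ suc m) * (inv l * inv l)) * φ n l ≈ ∑ (suc n) (λ j → v j * (q ^ (l *ₙ suc m) * rest (suc l) j))
    expand l = begin
      (x * (inv l * inv l)) * (fact (l +ₙ n) * (inv n * inv n))
        ≈⟨ solve 4 (λ x l f n → (x :* (l :* l)) :* (f :* (n :* n)) := x :* (f :* ((l :* n) :* (l :* n)))) refl x (inv l) (fact (l +ₙ n)) (inv n) ⟩
      x * (fact (l +ₙ n) * ((inv l * inv n) * (inv l * inv n)))
        ≈⟨ *-congˡ (*-cong (reflexive (≡.cong (λ k → fact (l +ₙ k)) (ℕ.+-identityʳ n)))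
             (*-congˡ (*-cong (reflexive (≡.cong inv (ℕ.+-identityʳ l))) (reflexive (≡.cong inv (ℕ.+-identityʳ n)))))) ⟨
      x * (fact (l +ₙ (n +ₙ 0)) * ((inv l * inv n) * (inv (l +ₙ 0) * inv (n +ₙ 0))))
        ≈⟨ *-congˡ (vandermonde-finite l n (suc n) 0 (ℕ.n<1+n n)) ⟨
      x * vandermondeSum (rest (suc l)) (suc n) n 0
        ≈⟨ ∑-*ˡ (suc n) x _ ⟩
      ∑ (suc n) (λ j → x * (q ^ (j *ₙ (j +ₙ 0)) * (inv j * inv (j +ₙ 0)) * (rest (suc n) j * rest (suc l) j)))
        ≈⟨ ∑-cong (suc n) (λ j → solve 4 (λ x a r s → x :* (a :* (r :* s)) := (a :* r) :* (x :* s)) refl x _ _ _) ⟩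
      ∑ (suc n) (λ j → v j * (x * rest (suc l) j)) ∎
      where x = q ^ (l *ₙ suc m)

    exponent : ∀ j m → j *ₙ (j +ₙ 0) +ₙ j *ₙ suc m ≡ j *ₙ suc j +ₙ j *ₙ m
    exponent = solve-∀

    collect : ∀ j → v j * ∑ (N ∸ j) (λ s → q ^ ((j +ₙ s) *ₙ suc m) * inv s) ≈ weight n j * (q ^ (j *ₙ m) * (inv j * inv j) * euler m (N ∸ j))
    collect j = begin
      v j * ∑ (N ∸ j) (λ s → q ^ ((j +ₙ s) *ₙ suc m) * inv s)
        ≈⟨ *-cong (*-congʳ (*-congˡ (*-congˡ (reflexive (≡.cong inv (ℕ.+-identityʳ j)))))) (∑-cong (N ∸ j) (λ s →
             trans (*-congʳ (trans (^-congʳ q (ℕ.*-distribʳ-+ (suc m) j s)) (^-homo-* q (j *ₙ suc m) _))) (*-assoc _ _ _))) ⟩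
      (a * (inv j * inv j) * r) * ∑ (N ∸ j) (λ s → b * (q ^ (s *ₙ suc m) * inv s))
        ≈⟨ *-congˡ (∑-*ˡ (N ∸ j) b _) ⟨
      (a * (inv j * inv j) * r) * (b * euler m (N ∸ j))
        ≈⟨ solve 5 (λ a i r b e → (a :* (i :* i) :* r) :* (b :* e) := (a :* b) :* (r :* (i :* i) :* e)) refl a (inv j) r b _ ⟩
      (a * b) * (r * (inv j * inv j) * euler m (N ∸ j))
        ≈⟨ *-congʳ (trans (sym (^-homo-* q (j *ₙ (j +ₙ 0)) (j *ₙ suc m))) (trans (^-congʳ q (exponent j m)) (^-homo-* q (j *ₙ suc j) (j *ₙ m)))) ⟩
      (q ^ (j *ₙ suc j) * q ^ (j *ₙ m)) * (r * (inv j * inv j) * euler m (N ∸ j))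
        ≈⟨ solve 5 (λ x y r i e → (x :* y) :* (r :* (i :* i) :* e) := x :* r :* (y :* (i :* i) :* e)) refl _ _ _ _ _ ⟩
      weight n j * (q ^ (j *ₙ m) * (inv j * inv j) * euler m (N ∸ j)) ∎
      where
      a = q ^ (j *ₙ (j +ₙ 0))
      b = q ^ (j *ₙ suc m)
      r = rest (suc n) j

  T-ψ : ∀ N j l → T N (ψ j) l ≈ (inv j * inv j) * euler (l +ₙ j) N
  T-ψ N j l = begin
    ∑ N (λ m → (q ^ (m *ₙ suc l) * (inv m * inv m)) * (fact m * (q ^ (j *ₙ m) * (inv j * inv j))))
      ≈⟨ ∑-cong N term ⟩
    ∑ N (λ m → (inv j * inv j) * (q ^ (m *ₙ suc (l +ₙ j)) * inv m))
      ≈⟨ ∑-*ˡ N _ _ ⟨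
    (inv j * inv j) * euler (l +ₙ j) N ∎
    where
    exponent : ∀ m l j → m *ₙ suc l +ₙ j *ₙ m ≡ m *ₙ suc (l +ₙ j)
    exponent = solve-∀
    term : ∀ m → (q ^ (m *ₙ suc l) * (inv m * inv m)) * (fact m * (q ^ (j *ₙ m) * (inv j * inv j))) ≈ (inv j * inv j) * (q ^ (m *ₙ suc (l +ₙ j)) * inv m)
    term m = begin
      (x * (inv m * inv m)) * (fact m * (y * (inv j * inv j)))
        ≈⟨ solve 5 (λ x i f y j → (x :* (i :* i)) :* (f :* (y :* (j :* j))) := (f :* i) :* ((j :* j) :* ((x :* y) :* i))) refl x (inv m) (fact m) y (inv j) ⟩
      (fact m * inv m) * ((inv j * inv j) * ((x * y) * inv m))
        ≈⟨ *-cong (fact-inv m) (*-congˡ (*-congʳ (trans (sym (^-homo-* q (m *ₙ suc l) (j *ₙ m))) (^-congʳ q (exponent m l j))))) ⟩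
      1# * ((inv j * inv j) * (q ^ (m *ₙ suc (l +ₙ j)) * inv m))
        ≈⟨ *-identityˡ _ ⟩
      (inv j * inv j) * (q ^ (m *ₙ suc (l +ₙ j)) * inv m) ∎
      where
      x = q ^ (m *ₙ suc l)
      y = q ^ (j *ₙ m)

-- The ordered field of real numbers

-- Order properties of the real numbers; x ≤ y means that y < x is absurd.
module RealOrder {c ℓ₁ ℓ₂} (ℛ : RealField c ℓ₁ ℓ₂) where
  open RealField ℛ hiding (zero)
  open OrderLemmas ℛ public
  open IntegerRingSolver commutativeRing
  open Exp (CommutativeRing.semiring commutativeRing) using (_^_)

  ≤-from : ∀ {x y} → 0# ≤ y - x → x ≤ y
  ≤-from {x} {y} 0≤y-x y<x = 0≤y-x (<-respˡ-≈ (+-identityˡ _) (<-respʳ-≈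
    (solve 2 (λ x y → (x :- y) :+ (y :- x) := con (pos 0)) refl x y) (+-monoˡ-< (y - x) (x<y⇒0<y-x y<x))))

  ≤-to : ∀ {x y} → x ≤ y → 0# ≤ y - x
  ≤-to {x} {y} x≤y y-x<0 = x≤y (<-respˡ-≈ (solve 2 (λ x y → (y :- x) :+ x := y) refl x y)
    (<-respʳ-≈ (+-identityˡ x) (+-monoˡ-< x y-x<0)))

  <⇒≤ : ∀ {x y} → x < y → x ≤ y
  <⇒≤ = <-asym

  ≤-reflexive : ∀ {x y} → x ≈ y → x ≤ y
  ≤-reflexive x≈y y<x = <-irrefl (sym x≈y) y<x

  ≤-refl : ∀ {x} → x ≤ x
  ≤-refl = ≤-reflexive refl

  ≤-trans : ∀ {x y z} → x ≤ y → y ≤ z → x ≤ z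
  ≤-trans {y = y} x≤y y≤z z<x with <-cotrans z<x y
  ... | inj₁ z<y = y≤z z<y
  ... | inj₂ y<x = x≤y y<x

  ≤-<-trans : ∀ {x y z} → x ≤ y → y < z → x < z
  ≤-<-trans {x} x≤y y<z with <-cotrans y<z x
  ... | inj₁ y<x = ⊥-elim (x≤y y<x)
  ... | inj₂ x<z = x<z

  <-≤-trans : ∀ {x y z} → x < y → y ≤ z → x < z
  <-≤-trans {z = z} x<y y≤z with <-cotrans x<y z
  ... | inj₁ x<z = x<z
  ... | inj₂ z<y = ⊥-elim (y≤z z<y)

  ≤-respˡ-≈ : ∀ {x y z} → x ≈ y → x ≤ z → y ≤ z
  ≤-respˡ-≈ x≈y x≤z z<y = x≤z (<-respʳ-≈ (sym x≈y) z<y)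

  ≤-respʳ-≈ : ∀ {x y z} → x ≈ y → z ≤ x → z ≤ y
  ≤-respʳ-≈ x≈y z≤x y<z = z≤x (<-respˡ-≈ (sym x≈y) y<z)

  -- To prove x ≤ y, exhibit y - x as a nonnegative number.
  ≤-by : ∀ {x y d} → 0# ≤ d → d ≈ y - x → x ≤ y
  ≤-by 0≤d d≈y-x = ≤-from (≤-respʳ-≈ d≈y-x 0≤d)

  <-by : ∀ {x y d} → 0# < d → d ≈ y - x → x < y
  <-by 0<d d≈y-x = 0<y-x⇒x<y (<-respʳ-≈ d≈y-x 0<d)

  0≤1 : 0# ≤ 1#
  0≤1 = <⇒≤ 0<1

  +-nonneg : ∀ {x y} → 0# ≤ x → 0# ≤ y → 0# ≤ x + y
  +-nonneg {x} {y} 0≤x 0≤y s<0 with <-cotrans s<0 y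
  ... | inj₂ y<0 = 0≤y y<0
  ... | inj₁ s<y = 0≤x (<-respˡ-≈ (solve 2 (λ x y → (x :+ y) :- y := x) refl x y)
                     (<-respʳ-≈ (-‿inverseʳ y) (+-monoˡ-< (- y) s<y)))

  *-nonneg : ∀ {x y} → 0# ≤ x → 0# ≤ y → 0# ≤ x * y
  *-nonneg {x} {y} 0≤x 0≤y xy<0 with #⇒<⊎> (xy#0⇒x#0 (<⇒# (<-respˡ-≈ (*-comm x y) xy<0)))
  ... | inj₁ y<0 = 0≤y y<0
  ... | inj₂ 0<y = *-nonneg-pos 0≤x 0<y xy<0

  +-mono-≤ : ∀ {x x′ y y′} → x ≤ x′ → y ≤ y′ → x + y ≤ x′ + y′
  +-mono-≤ {x} {x′} {y} {y′} p q = ≤-by (+-nonneg (≤-to p) (≤-to q))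
    (solve 4 (λ x x′ y y′ → (x′ :- x) :+ (y′ :- y) := (x′ :+ y′) :- (x :+ y)) refl x x′ y y′)

  *-mono-≤ : ∀ {x x′ y y′} → 0# ≤ x → 0# ≤ y′ → x ≤ x′ → y ≤ y′ → x * y ≤ x′ * y′
  *-mono-≤ {x} {x′} {y} {y′} 0≤x 0≤y′ p q = ≤-by (+-nonneg (*-nonneg 0≤x (≤-to q)) (*-nonneg (≤-to p) 0≤y′))
    (solve 4 (λ x x′ y y′ → x :* (y′ :- y) :+ (x′ :- x) :* y′ := x′ :* y′ :- x :* y) refl x x′ y y′)

  *-monoˡ-≤ : ∀ {x y y′} → 0# ≤ x → y ≤ y′ → x * y ≤ x * y′
  *-monoˡ-≤ {x} {y} {y′} 0≤x y≤y′ = ≤-by (*-nonneg 0≤x (≤-to y≤y′))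
    (solve 3 (λ x y y′ → x :* (y′ :- y) := x :* y′ :- x :* y) refl x y y′)

  *-monoʳ-≤ : ∀ {x y y′} → 0# ≤ x → y ≤ y′ → y * x ≤ y′ * x
  *-monoʳ-≤ {x} {y} {y′} 0≤x y≤y′ = ≤-by (*-nonneg 0≤x (≤-to y≤y′))
    (solve 3 (λ x y y′ → x :* (y′ :- y) := y′ :* x :- y :* x) refl x y y′)

  ≤-square : ∀ {x y} → 0# ≤ x → x ≤ y → x * x ≤ y * y
  ≤-square 0≤x x≤y = *-mono-≤ 0≤x (≤-trans 0≤x x≤y) x≤y x≤y

  <-square : ∀ {x y} → 0# ≤ x → x < y → x * x < y * y
  <-square {x} {y} 0≤x x<y = <-by (*-positive (x<y⇒0<y-x x<y) (+-pos-nonneg (≤-<-trans 0≤x x<y) 0≤x))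
    (solve 2 (λ x y → (y :- x) :* (y :+ x) := y :* y :- x :* x) refl x y)

  square-cancel-≤ : ∀ {x y} → 0# ≤ y → x * x ≤ y * y → x ≤ y
  square-cancel-≤ 0≤y x²≤y² y<x = x²≤y² (<-square 0≤y y<x)

  -- |x| ≤ r implies x² ≤ r².
  square-≤ : ∀ {x r} → x ≤ r → - x ≤ r → x * x ≤ r * r
  square-≤ {x} {r} x≤r -x≤r = ≤-by (*-nonneg (≤-to x≤r) (≤-to -x≤r))
    (solve 2 (λ x r → (r :- x) :* (r :- :- x) := r :* r :- x :* x) refl x r)

  *-cancel-pos : ∀ {x y} → 0# ≤ x → 0# < x * y → 0# < y
  *-cancel-pos {x} {y} 0≤x 0<xy with #⇒<⊎> (xy#0⇒x#0 (#-sym (<⇒# (<-respʳ-≈ (*-comm x y) 0<xy))))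
  ... | inj₂ 0<y = 0<y
  ... | inj₁ y<0 = ⊥-elim (≤-respʳ-≈ (zeroʳ x) (*-monoˡ-≤ 0≤x (<⇒≤ y<0)) 0<xy)

  private
    positive-inverse′ : ∀ {x} → 0# < x → ∃[ y ] ((0# < y) × (y * x ≈ 1#))
    positive-inverse′ {x} 0<x = y , *-cancel-pos (<⇒≤ 0<x) (<-respʳ-≈ (sym (trans (*-comm x y) yx≈1)) 0<1) , yx≈1
      where
      inverse = #⇒invertible (#-sym (<⇒# 0<x))
      y = proj₁ inverse
      yx≈1 : y * x ≈ 1#
      yx≈1 = trans (*-congˡ (sym (x-0≈x x))) (proj₁ (proj₂ inverse))

  abstract
    -- The inverse of a positive number.
    positive-inverse : ∀ {x} → 0# < x → ∃[ y ] ((0# < y) × (y * x ≈ 1#))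
    positive-inverse = positive-inverse′

  ^-nonneg : ∀ {x} → 0# ≤ x → ∀ n → 0# ≤ x ^ n
  ^-nonneg 0≤x zero    = 0≤1
  ^-nonneg 0≤x (suc n) = *-nonneg 0≤x (^-nonneg 0≤x n)

  fromℕ-nonneg : ∀ n → 0# ≤ fromℕ n
  fromℕ-nonneg zero    = ≤-refl
  fromℕ-nonneg (suc n) = +-nonneg 0≤1 (fromℕ-nonneg n)

-- Powers of a number ρ with 0 ≤ ρ < 1.
module Geometric {c ℓ₁ ℓ₂} (ℛ : RealField c ℓ₁ ℓ₂) (ρ : RealField.Carrier ℛ)
  (0≤ρ : OrderLemmas._≤_ ℛ (RealField.0# ℛ) ρ) (ρ<1 : RealField._<_ ℛ ρ (RealField.1# ℛ)) where
  open RealField ℛ hiding (zero)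
  open RealOrder ℛ
  open IntegerRingSolver commutativeRing
  open Exp (CommutativeRing.semiring commutativeRing) using (_^_)

  0≤ρ^ : ∀ n → 0# ≤ ρ ^ n
  0≤ρ^ = ^-nonneg 0≤ρ

  ρ≤1 : ρ ≤ 1#
  ρ≤1 = <⇒≤ ρ<1

  0<1-ρ : 0# < 1# - ρ
  0<1-ρ = x<y⇒0<y-x ρ<1

  ρ^-mono : ∀ {m n} → m ℕ.≤ n → ρ ^ n ≤ ρ ^ m
  ρ^-mono {n = zero}  ℕ.z≤n       = ≤-refl
  ρ^-mono {n = suc n} ℕ.z≤n       = ≤-trans (*-mono-≤ 0≤ρ 0≤1 ρ≤1 (ρ^-mono (ℕ.z≤n {n}))) (≤-reflexive (*-identityˡ 1#))
  ρ^-mono             (ℕ.s≤s m≤n) = *-monoˡ-≤ 0≤ρ (ρ^-mono m≤n)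

  ρ^≤1 : ∀ n → ρ ^ n ≤ 1#
  ρ^≤1 n = ρ^-mono (ℕ.z≤n {n})

  ρ^suc<1 : ∀ n → ρ ^ suc n < 1#
  ρ^suc<1 n = ≤-<-trans (≤-trans (*-monoˡ-≤ 0≤ρ (ρ^≤1 n)) (≤-reflexive (*-identityʳ ρ))) ρ<1

  -- γ = 1 / (1 - ρ), the sum of the geometric series.
  γ : Carrier
  γ = proj₁ (positive-inverse 0<1-ρ)

  0<γ : 0# < γ
  0<γ = proj₁ (proj₂ (positive-inverse 0<1-ρ))

  0≤γ : 0# ≤ γ
  0≤γ = <⇒≤ 0<γ

  γ-inverse : γ * (1# - ρ) ≈ 1#
  γ-inverse = proj₂ (proj₂ (positive-inverse 0<1-ρ))

  γ-step : 1# + ρ * γ ≈ γ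
  γ-step = trans (+-congʳ (sym γ-inverse)) (solve 2 (λ g r → g :* (con (pos 1) :- r) :+ r :* g := g) refl γ ρ)

  private
    decay : ∀ n → (fromℕ n * ρ ^ n) * (1# - ρ) ≤ 1# - ρ ^ n
    decay zero    = ≤-reflexive (solve 1 (λ r → (con (pos 0) :* con (pos 1)) :* (con (pos 1) :- r) := con (pos 1) :- con (pos 1)) refl ρ)
    decay (suc n) = ≤-by (+-nonneg (*-nonneg 0≤ρ (≤-to (decay n))) (*-nonneg (<⇒≤ 0<1-ρ) (≤-to (ρ^≤1 (suc n)))))
      (solve 3 (λ r x k → r :* ((con (pos 1) :- x) :- (k :* x) :* (con (pos 1) :- r)) :+ (con (pos 1) :- r) :* (con (pos 1) :- r :* x)
         := (con (pos 1) :- r :* x) :- ((con (pos 1) :+ k) :* (r :* x)) :* (con (pos 1) :- r)) refl ρ (ρ ^ n) (fromℕ n))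

  private
    ρ^-small′ : ∀ {C ε} → 0# ≤ C → 0# < ε → ∃[ N ] (∀ n → N ℕ.≤ n → C * ρ ^ n < ε)
    ρ^-small′ {C} {ε} 0≤C 0<ε = N , λ n N≤n → ≤-<-trans (*-monoˡ-≤ 0≤C (ρ^-mono N≤n)) at-N
      where
      scale = positive-inverse (*-positive 0<1-ρ 0<ε)
      d = (1# - ρ) * ε
      N = proj₁ (archimedean (C * proj₁ scale))
      C<Nd : C < fromℕ N * d
      C<Nd = <-by (*-positive (x<y⇒0<y-x (proj₂ (archimedean (C * proj₁ scale)))) (*-positive 0<1-ρ 0<ε))
        (trans (solve 4 (λ f c i d → (f :- c :* i) :* d := f :* d :- c :* (i :* d)) refl (fromℕ N) C (proj₁ scale) d)
          (+-congˡ (-‿cong (trans (*-congˡ (proj₂ (proj₂ scale))) (*-identityʳ C)))))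
      Cx≤C : C * ((fromℕ N * ρ ^ N) * (1# - ρ)) ≤ C
      Cx≤C = ≤-trans (*-monoˡ-≤ 0≤C (≤-trans (decay N) (≤-by (0≤ρ^ N) (solve 1 (λ x → x := con (pos 1) :- (con (pos 1) :- x)) refl _)))) (≤-reflexive (*-identityʳ C))
      at-N : C * ρ ^ N < ε
      at-N = 0<y-x⇒x<y (*-cancel-pos (*-nonneg (fromℕ-nonneg N) (<⇒≤ 0<1-ρ))
        (<-respʳ-≈ (solve 5 (λ f r e c x → f :* (r :* e) :- c :* ((f :* x) :* r) := (f :* r) :* (e :- c :* x)) refl (fromℕ N) (1# - ρ) ε C (ρ ^ N))
          (x<y⇒0<y-x (≤-<-trans Cx≤C C<Nd))))

  abstract
    -- C ρⁿ tends to 0, since n (1 - ρ) ρⁿ ≤ 1.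
    ρ^-small : ∀ {C ε} → 0# ≤ C → 0# < ε → ∃[ N ] (∀ n → N ℕ.≤ n → C * ρ ^ n < ε)
    ρ^-small = ρ^-small′

  -- The reciprocals of 1 - ρⁿ⁺¹.
  v : ℕ → Carrier
  v n = proj₁ (positive-inverse (x<y⇒0<y-x (ρ^suc<1 n)))

  0≤v : ∀ n → 0# ≤ v n
  0≤v n = <⇒≤ (proj₁ (proj₂ (positive-inverse (x<y⇒0<y-x (ρ^suc<1 n)))))

  v-inverse : ∀ n → v n * (1# - ρ ^ suc n) ≈ 1#
  v-inverse n = proj₂ (proj₂ (positive-inverse (x<y⇒0<y-x (ρ^suc<1 n))))

  1+ρ^≤v : ∀ n → 1# + ρ ^ suc n ≤ v n
  1+ρ^≤v n = ≤-by (*-nonneg (0≤v n) (*-nonneg (0≤ρ^ (suc n)) (0≤ρ^ (suc n))))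
    (trans (solve 2 (λ w x → w :* (x :* x) := w :- (w :* (con (pos 1) :- x)) :* (con (pos 1) :+ x)) refl (v n) (ρ ^ suc n))
      (+-congˡ (-‿cong (trans (*-congʳ (v-inverse n)) (*-identityˡ _)))))

  1≤v : ∀ n → 1# ≤ v n
  1≤v n = ≤-trans (≤-by (0≤ρ^ (suc n)) (solve 1 (λ x → x := (con (pos 1) :+ x) :- con (pos 1)) refl _)) (1+ρ^≤v n)

  -- u n = 1 / (ρ; ρ)ₙ
  u : ℕ → Carrier
  u zero    = 1#
  u (suc n) = u n * v n

  0≤u : ∀ n → 0# ≤ u n
  0≤u zero    = 0≤1
  0≤u (suc n) = *-nonneg (0≤u n) (0≤v n)

  u-mono : ∀ m n → u n ≤ u (m +ₙ n)
  u-mono zero    n = ≤-refl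
  u-mono (suc m) n = ≤-trans (u-mono m n) (≤-trans (≤-reflexive (sym (*-identityʳ _))) (*-monoˡ-≤ (0≤u (m +ₙ n)) (1≤v (m +ₙ n))))

  private
    u-bounded′ : ∃[ U ] ((0# ≤ U) × (∀ n → u n ≤ U))
    u-bounded′ = C , 0≤C , λ n → ≤-trans (u-mono J n) (≤-trans (≤-reflexive (reflexive-u (ℕ.+-comm J n))) (≤-trans (tail n)
        (≤-by (*-nonneg 0≤C (*-nonneg 0≤γ (0≤ρ^ (n +ₙ J)))) (solve 2 (λ c y → c :* y := c :- c :* (con (pos 1) :- y)) refl C _))))
      where
      open import Relation.Binary.PropositionalEquality.Core as ≡ using (_≡_)
      reflexive-u : ∀ {m n} → m ≡ n → u m ≈ u n
      reflexive-u ≡.refl = refl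
      small = ρ^-small 0≤γ 0<1
      J = proj₁ small
      0<g : 0# < 1# - γ * ρ ^ J
      0<g = x<y⇒0<y-x (proj₂ small J ℕ.≤-refl)
      g⁻¹ = positive-inverse 0<g
      C = u J * proj₁ g⁻¹
      0≤C : 0# ≤ C
      0≤C = *-nonneg (0≤u J) (<⇒≤ (proj₁ (proj₂ g⁻¹)))
      tail : ∀ n → u (n +ₙ J) ≤ C * (1# - γ * ρ ^ (n +ₙ J))
      tail zero    = ≤-reflexive (sym (trans (*-assoc _ _ _) (trans (*-congˡ (proj₂ (proj₂ g⁻¹))) (*-identityʳ _))))
      tail (suc n) = ≤-trans (*-monoʳ-≤ (0≤v m) (tail n)) (≤-by
          (*-nonneg (*-nonneg 0≤C (0≤v m)) (+-nonneg (*-nonneg (0≤ρ^ m) (<⇒≤ 0<1-ρ)) (*-nonneg 0≤γ (*-nonneg (0≤ρ^ (suc m)) (0≤ρ^ (suc m))))))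
          (trans (*-congˡ (+-congʳ (*-congˡ (+-congʳ (sym γ-inverse)))))
          (trans (solve 5 (λ c w x g r → (c :* w) :* (x :* (g :* (con (pos 1) :- r) :- r) :+ g :* ((r :* x) :* (r :* x)))
               := c :* (w :* (con (pos 1) :- r :* x)) :* (con (pos 1) :- g :* (r :* x)) :- (c :* (con (pos 1) :- g :* x)) :* w) refl C (v m) (ρ ^ m) γ ρ)
            (+-congʳ (*-congʳ (trans (*-congˡ (v-inverse m)) (*-identityʳ C)))))))
        where m = n +ₙ J

  abstract
    -- Choose J with γ ρᴶ < 1.  For n ≥ J, u n ≤ C (1 - γ ρⁿ) for a constant C, by
    -- induction: 1 - γ ρⁿ ≤ (1 - γ ρⁿ⁺¹) (1 - ρⁿ⁺¹) because γ (1 - ρ) = 1 ≥ ρ.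
    u-bounded : ∃[ U ] ((0# ≤ U) × (∀ n → u n ≤ U))
    u-bounded = u-bounded′

-- Complete norms, and the complex numbers

-- A commutative ring with a complete norm, given through the relation that the
-- norm of x is at most B.  The value of the norm itself is not needed, which
-- avoids square roots.
record NormedRing {c ℓ₁ ℓ₂} (ℛ : RealField c ℓ₁ ℓ₂) a ℓ b : Set (c ⊔ ℓ₁ ⊔ ℓ₂ ⊔ lsuc (a ⊔ ℓ ⊔ b)) where
  private module ℝ = RealField ℛ
  open OrderLemmas ℛ using (_≤_)
  infix 4 ‖_‖≤_
  field
    commutativeRing : CommutativeRing a ℓ
  open CommutativeRing commutativeRing
  field
    ‖_‖≤_      : Carrier → ℝ.Carrier → Set b
    ‖‖-nonneg  : ∀ {x B} → ‖ x ‖≤ B → ℝ.0# ≤ B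
    ‖‖-cong    : ∀ {x y B} → x ≈ y → ‖ x ‖≤ B → ‖ y ‖≤ B
    ‖‖-mono    : ∀ {x B C} → B ≤ C → ‖ x ‖≤ B → ‖ x ‖≤ C
    ‖0‖≤0      : ‖ 0# ‖≤ ℝ.0#
    ‖1‖≤1      : ‖ 1# ‖≤ ℝ.1#
    ‖‖-+       : ∀ {x y B C} → ‖ x ‖≤ B → ‖ y ‖≤ C → ‖ x + y ‖≤ B ℝ.+ C
    ‖‖-neg     : ∀ {x B} → ‖ x ‖≤ B → ‖ - x ‖≤ B
    ‖‖-*       : ∀ {x y B C} → ‖ x ‖≤ B → ‖ y ‖≤ C → ‖ x * y ‖≤ B ℝ.* C
    ‖‖-bounded : ∀ x → ∃[ B ] (‖ x ‖≤ B)
    invertible : ∀ {w b} → ‖ w ‖≤ b → b ℝ.< ℝ.1# → ∃[ v ] (v * (1# - w) ≈ 1#)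
    -- If w has norm at most b < 1, then 1/(1 - w) has norm at most 1/(1 - b).
    ‖‖-inverse : ∀ {w v b u} → ‖ w ‖≤ b → b ℝ.< ℝ.1# → v * (1# - w) ≈ 1# → u ℝ.* (ℝ.1# ℝ.- b) ℝ.≈ ℝ.1# →
                 ℝ.0# ≤ u → ‖ v ‖≤ u
    complete   : (s : ℕ → Carrier) (r : ℕ → ℝ.Carrier) →
                 (∀ ε → ℝ.0# ℝ.< ε → ∃[ N ] (∀ n → N ℕ.≤ n → r n ℝ.< ε)) →
                 (∀ m n → n ℕ.≤ m → ‖ s m - s n ‖≤ r n) →
                 ∃[ L ] (∀ n → ‖ s n - L ‖≤ r n ℝ.+ r n)

module ComplexNorm {c ℓ₁ ℓ₂} (ℛ : RealField c ℓ₁ ℓ₂) where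
  open RealField ℛ using () renaming (commutativeRing to ℝ-ring)
  open RealField ℛ hiding (zero; commutativeRing) renaming
    ( Carrier to ℝ; _+_ to _+ᵣ_; _*_ to _*ᵣ_; -_ to -ᵣ_; _-_ to _-ᵣ_
    ; 0# to 0ᵣ; 1# to 1ᵣ; _≈_ to _≈ᵣ_; ∣_∣<_ to ∣_∣ᵣ<_ )
  open RealOrder ℛ
  open IntegerRingSolver ℝ-ring
  open Complex ℛ

  ℂ-ring : CommutativeRing c ℓ₁
  ℂ-ring = record
    { Carrier = ℂ
    ; _≈_ = _≈_
    ; _+_ = _+_
    ; _*_ = _*_
    ; -_  = -_
    ; 0#  = 0#
    ; 1#  = 1#
    ; isCommutativeRing = record
      { isRing = record
        { +-isAbelianGroup = record
          { isGroup = record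
            { isMonoid = record
              { isSemigroup = record
                { isMagma = record
                  { isEquivalence = record
                    { refl  = refl , refl
                    ; sym   = λ (p , q) → sym p , sym q
                    ; trans = λ (p , q) (p′ , q′) → trans p p′ , trans q q′
                    }
                  ; ∙-cong = λ (p , q) (p′ , q′) → +-cong p p′ , +-cong q q′
                  }
                ; assoc = λ x y z → +-assoc _ _ _ , +-assoc _ _ _
                }
              ; identity = (λ x → +-identityˡ _ , +-identityˡ _) , (λ x → +-identityʳ _ , +-identityʳ _)
              }
            ; inverse = (λ x → -‿inverseˡ _ , -‿inverseˡ _) , (λ x → -‿inverseʳ _ , -‿inverseʳ _)
            ; ⁻¹-cong = λ (p , q) → -‿cong p , -‿cong q
            }
          ; comm = λ x y → +-comm _ _ , +-comm _ _
          }
        ; *-cong = λ (p , q) (p′ , q′) →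
            +-cong (*-cong p p′) (-‿cong (*-cong q q′)) , +-cong (*-cong p q′) (*-cong q p′)
        ; *-assoc = λ (a +i b) (d +i e) (f +i g) →
            solve 6 (λ a b d e f g → (a :* d :- b :* e) :* f :- (a :* e :+ b :* d) :* g
              := a :* (d :* f :- e :* g) :- b :* (d :* g :+ e :* f)) refl a b d e f g ,
            solve 6 (λ a b d e f g → (a :* d :- b :* e) :* g :+ (a :* e :+ b :* d) :* f
              := a :* (d :* g :+ e :* f) :+ b :* (d :* f :- e :* g)) refl a b d e f g
        ; *-identity =
            (λ (a +i b) → solve 2 (λ a b → con (pos 1) :* a :- con (pos 0) :* b := a) refl a b ,
                          solve 2 (λ a b → con (pos 1) :* b :+ con (pos 0) :* a := b) refl a b) ,
            (λ (a +i b) → solve 2 (λ a b → a :* con (pos 1) :- b :* con (pos 0) := a) refl a b ,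
                          solve 2 (λ a b → a :* con (pos 0) :+ b :* con (pos 1) := b) refl a b)
        ; distrib =
            (λ (a +i b) (d +i e) (f +i g) →
              solve 6 (λ a b d e f g → a :* (d :+ f) :- b :* (e :+ g) := (a :* d :- b :* e) :+ (a :* f :- b :* g)) refl a b d e f g ,
              solve 6 (λ a b d e f g → a :* (e :+ g) :+ b :* (d :+ f) := (a :* e :+ b :* d) :+ (a :* g :+ b :* f)) refl a b d e f g) ,
            (λ (a +i b) (d +i e) (f +i g) →
              solve 6 (λ a b d e f g → (d :+ f) :* a :- (e :+ g) :* b := (d :* a :- e :* b) :+ (f :* a :- g :* b)) refl a b d e f g ,
              solve 6 (λ a b d e f g → (d :+ f) :* b :+ (e :+ g) :* a := (d :* b :+ e :* a) :+ (f :* b :+ g :* a)) refl a b d e f g)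
        }
      ; *-comm = λ (a +i b) (d +i e) →
          solve 4 (λ a b d e → a :* d :- b :* e := d :* a :- e :* b) refl a b d e ,
          solve 4 (λ a b d e → a :* e :+ b :* d := d :* b :+ e :* a) refl a b d e
      }
    }

  /-* : ∀ z w (w≠0 : Nonzero w) → (_/_ z w {{w≠0}}) * w ≈ z
  /-* (a +i b) (d +i e) w≠0 =
    trans (solve 5 (λ a b d e r → (a :* (r :* d) :- b :* (r :* (:- e))) :* d :- (a :* (r :* (:- e)) :+ b :* (r :* d)) :* e
      := a :* (r :* (d :* d :+ e :* e))) refl a b d e r) (trans (*-congˡ r-inverse) (*-identityʳ a)) ,
    trans (solve 5 (λ a b d e r → (a :* (r :* d) :- b :* (r :* (:- e))) :* e :+ (a :* (r :* (:- e)) :+ b :* (r :* d)) :* d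
      := b :* (r :* (d :* d :+ e :* e))) refl a b d e r) (trans (*-congˡ r-inverse) (*-identityʳ b))
    where
    inverse = #⇒invertible (#-sym (<⇒# w≠0))
    r = proj₁ inverse
    r-inverse : r *ᵣ (d *ᵣ d +ᵣ e *ᵣ e) ≈ᵣ 1ᵣ
    r-inverse = trans (*-congˡ (sym (x-0≈x _))) (proj₁ (proj₂ inverse))

  -- |z| ≤ B
  Bounded : ℂ → ℝ → Set ℓ₂
  Bounded z B = (0ᵣ ≤ B) × (∣ z ∣² ≤ B *ᵣ B)

  ∣∣²-cong : ∀ {z w} → z ≈ w → ∣ z ∣² ≈ᵣ ∣ w ∣²
  ∣∣²-cong (p , q) = +-cong (*-cong p p) (*-cong q q)

  -- The real part of z times the conjugate of w.
  inner : ℂ → ℂ → ℝ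
  inner z w = re z *ᵣ re w +ᵣ im z *ᵣ im w

  ∣∣²-+ : ∀ z w → ∣ z + w ∣² ≈ᵣ (∣ z ∣² +ᵣ ∣ w ∣²) +ᵣ (inner z w +ᵣ inner z w)
  ∣∣²-+ (a +i b) (d +i e) = solve 4 (λ a b d e → (a :+ d) :* (a :+ d) :+ (b :+ e) :* (b :+ e)
    := ((a :* a :+ b :* b) :+ (d :* d :+ e :* e)) :+ ((a :* d :+ b :* e) :+ (a :* d :+ b :* e))) refl a b d e

  cauchy-schwarz : ∀ z w {B C} → Bounded z B → Bounded w C → inner z w ≤ B *ᵣ C
  cauchy-schwarz z@(a +i b) w@(d +i e) {B} {C} (0≤B , z≤B) (0≤C , w≤C) = square-cancel-≤ (*-nonneg 0≤B 0≤C)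
    (≤-trans (≤-by (0≤x² (a *ᵣ e -ᵣ b *ᵣ d))
      (solve 4 (λ a b d e → (a :* e :- b :* d) :* (a :* e :- b :* d)
        := (a :* a :+ b :* b) :* (d :* d :+ e :* e) :- (a :* d :+ b :* e) :* (a :* d :+ b :* e)) refl a b d e))
    (≤-trans (*-mono-≤ (0≤x²+y² a b) (*-nonneg 0≤C 0≤C) z≤B w≤C)
      (≤-reflexive (solve 2 (λ b c → (b :* b) :* (c :* c) := (b :* c) :* (b :* c)) refl B C))))

  private
    square-sum : ∀ B C → (B *ᵣ B +ᵣ C *ᵣ C) +ᵣ (B *ᵣ C +ᵣ B *ᵣ C) ≈ᵣ (B +ᵣ C) *ᵣ (B +ᵣ C)
    square-sum = solve 2 (λ b c → (b :* b :+ c :* c) :+ (b :* c :+ b :* c) := (b :+ c) :* (b :+ c)) refl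

  bounded-+ : ∀ {z w B C} → Bounded z B → Bounded w C → Bounded (z + w) (B +ᵣ C)
  bounded-+ {z} {w} {B} {C} p@(0≤B , z≤B) q@(0≤C , w≤C) = +-nonneg 0≤B 0≤C ,
    ≤-respˡ-≈ (sym (∣∣²-+ z w)) (≤-trans (+-mono-≤ (+-mono-≤ z≤B w≤C) (+-mono-≤ z·w z·w)) (≤-reflexive (square-sum B C)))
    where z·w = cauchy-schwarz z w p q

  bounded-* : ∀ {z w B C} → Bounded z B → Bounded w C → Bounded (z * w) (B *ᵣ C)
  bounded-* {z} {w} {B} {C} (0≤B , z≤B) (0≤C , w≤C) = *-nonneg 0≤B 0≤C ,
    ≤-respˡ-≈ (sym (∣∣²-* z w)) (≤-trans (*-mono-≤ (0≤x²+y² _ _) (*-nonneg 0≤C 0≤C) z≤B w≤C)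
      (≤-reflexive (solve 2 (λ b c → (b :* b) :* (c :* c) := (b :* c) :* (b :* c)) refl B C)))

  bounded-0 : Bounded 0# 0ᵣ
  bounded-0 = ≤-refl , ≤-reflexive (solve 0 (con (pos 0) :* con (pos 0) :+ con (pos 0) :* con (pos 0) := con (pos 0) :* con (pos 0)) refl)

  bounded-1 : Bounded 1# 1ᵣ
  bounded-1 = 0≤1 , ≤-reflexive (trans ∣1∣²≈1 (sym (*-identityˡ 1ᵣ)))

  bounded-neg : ∀ {z B} → Bounded z B → Bounded (- z) B
  bounded-neg {z} (0≤B , z≤B) = 0≤B , ≤-respˡ-≈ (+-cong (sym (-x*-x≈x*x (re z))) (sym (-x*-x≈x*x (im z)))) z≤B

  bounded-any : ∀ z → ∃[ B ] Bounded z B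
  bounded-any z = ∣ z ∣² +ᵣ 1ᵣ , +-nonneg (0≤x²+y² _ _) 0≤1 ,
    ≤-by (+-nonneg (+-nonneg (0≤x² ∣ z ∣²) (0≤x²+y² (re z) (im z))) 0≤1)
      (solve 1 (λ n → (n :* n :+ n) :+ con (pos 1) := (n :+ con (pos 1)) :* (n :+ con (pos 1)) :- n) refl ∣ z ∣²)

  -- |1 - w| ≥ 1 - b: otherwise the triangle inequality for 1 = (1 - w) + w would
  -- give 1 < 1.
  bounded-inverse : ∀ {w v b u} → Bounded w b → b < 1ᵣ → v * (1# - w) ≈ 1# → u *ᵣ (1ᵣ -ᵣ b) ≈ᵣ 1ᵣ → 0ᵣ ≤ u → Bounded v u
  bounded-inverse {w} {v} {b} {u} w≤b@(0≤b , w²≤b²) b<1 v-inv u-inv 0≤u = 0≤u , ≤-respˡ-≈ simplify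
      (≤-respʳ-≈ (*-identityʳ _) (*-monoˡ-≤ {u *ᵣ u} (*-nonneg 0≤u 0≤u) below))
    where
    d = 1ᵣ -ᵣ b
    z = 1# - w
    lower : d *ᵣ d ≤ ∣ z ∣²
    lower z²<d² = <-irrefl (trans (sym (∣∣²-cong sum≈1)) ∣1∣²≈1) (<-respʳ-≈ one (≤-<-trans (≤-reflexive (∣∣²-+ z w))
        (<-by (+-pos-nonneg (x<y⇒0<y-x z²<d²) (+-nonneg (≤-to w²≤b²) (+-nonneg (≤-to z·w) (≤-to z·w))))
          (solve 5 (λ d b n m i → (d :* d :- n) :+ ((b :* b :- m) :+ ((d :* b :- i) :+ (d :* b :- i)))
            := ((d :* d :+ b :* b) :+ (d :* b :+ d :* b)) :- ((n :+ m) :+ (i :+ i))) refl d b ∣ z ∣² ∣ w ∣² (inner z w)))))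
      where
      sum≈1 : 1# ≈ z + w
      sum≈1 = solve 1 (λ x → con (pos 1) := (con (pos 1) :- x) :+ x) refl (re w) ,
              solve 1 (λ x → con (pos 0) := (con (pos 0) :- x) :+ x) refl (im w)
      z·w : inner z w ≤ d *ᵣ b
      z·w = cauchy-schwarz z w (<⇒≤ (x<y⇒0<y-x b<1) , <⇒≤ z²<d²) w≤b
      one : (d *ᵣ d +ᵣ b *ᵣ b) +ᵣ (d *ᵣ b +ᵣ d *ᵣ b) ≈ᵣ 1ᵣ
      one = solve 1 (λ b → ((con (pos 1) :- b) :* (con (pos 1) :- b) :+ b :* b) :+ ((con (pos 1) :- b) :* b :+ (con (pos 1) :- b) :* b) := con (pos 1)) refl b
    vz≈1 : ∣ v ∣² *ᵣ ∣ z ∣² ≈ᵣ 1ᵣ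
    vz≈1 = trans (sym (∣∣²-* v z)) (trans (∣∣²-cong v-inv) ∣1∣²≈1)
    below : ∣ v ∣² *ᵣ (d *ᵣ d) ≤ 1ᵣ
    below = ≤-respʳ-≈ vz≈1 (*-monoˡ-≤ (0≤x²+y² (re v) (im v)) lower)
    simplify : (u *ᵣ u) *ᵣ (∣ v ∣² *ᵣ (d *ᵣ d)) ≈ᵣ ∣ v ∣²
    simplify = trans (solve 3 (λ u n d → (u :* u) :* (n :* (d :* d)) := n :* ((u :* d) :* (u :* d))) refl u ∣ v ∣² d)
      (trans (*-congˡ (trans (*-cong u-inv u-inv) (*-identityˡ 1ᵣ))) (*-identityʳ _))

  private
    re-≤ : ∀ {z B} → Bounded z B → re z ≤ B
    re-≤ {z} (0≤B , z≤B) = square-cancel-≤ 0≤B (≤-trans (≤-by (0≤x² (im z)) (solve 2 (λ x y → y := (x :+ y) :- x) refl _ _)) z≤B)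

    im-≤ : ∀ {z B} → Bounded z B → im z ≤ B
    im-≤ {z} (0≤B , z≤B) = square-cancel-≤ 0≤B (≤-trans (≤-by (0≤x² (re z)) (solve 2 (λ x y → x := (x :+ y) :- y) refl _ _)) z≤B)

    -- The limit of a real Cauchy sequence with modulus r lies within r n of its
    -- n-th term.
    real-limit : (x r : ℕ → ℝ) →
      (∀ ε → 0ᵣ < ε → ∃[ N ] (∀ n → N ℕ.≤ n → r n < ε)) →
      (∀ m n → n ℕ.≤ m → (x m -ᵣ x n ≤ r n) × (-ᵣ (x m -ᵣ x n) ≤ r n)) →
      ∃[ L ] (∀ n → (x n -ᵣ L ≤ r n) × (-ᵣ (x n -ᵣ L) ≤ r n))
    real-limit x r r→0 x-cauchy = L , λ n → upper n , lower n
      where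
      limit : ∃[ L ] (∀ ε → 0ᵣ < ε → ∃[ N ] (∀ n → N ℕ.≤ n → ∣ x n -ᵣ L ∣ᵣ< ε))
      limit = RealField.complete ℛ x (λ ε 0<ε → proj₁ (r→0 ε 0<ε) , λ m n N≤m N≤n → close (proj₂ (r→0 ε 0<ε)) m n N≤m N≤n)
        where
        flip : ∀ {y ε} → -ᵣ y < ε → -ᵣ ε < y
        flip {y} {ε} -y<ε = <-by (x<y⇒0<y-x -y<ε) (solve 2 (λ y e → e :- :- y := y :- :- e) refl y ε)
        close : ∀ {ε N} → (∀ n → N ℕ.≤ n → r n < ε) → ∀ m n → N ℕ.≤ m → N ℕ.≤ n → ∣ x m -ᵣ x n ∣ᵣ< ε
        close small m n N≤m N≤n with ℕ.≤-total n m
        ... | inj₁ n≤m = flip (≤-<-trans (proj₂ (x-cauchy m n n≤m)) (small n N≤n)) , ≤-<-trans (proj₁ (x-cauchy m n n≤m)) (small n N≤n)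
        ... | inj₂ m≤n =
          flip (≤-<-trans (≤-respˡ-≈ (solve 2 (λ x y → y :- x := :- (x :- y)) refl (x m) (x n)) (proj₁ (x-cauchy n m m≤n))) (small m N≤m)) ,
          ≤-<-trans (≤-respˡ-≈ (solve 2 (λ x y → :- (y :- x) := x :- y) refl (x m) (x n)) (proj₂ (x-cauchy n m m≤n))) (small m N≤m)
      L = proj₁ limit

      later : ∀ n ε → 0ᵣ < ε → ∃[ m ] ((n ℕ.≤ m) × ∣ x m -ᵣ L ∣ᵣ< ε)
      later n ε 0<ε = n ℕ.⊔ N , ℕ.m≤m⊔n n N , proj₂ (proj₂ limit ε 0<ε) (n ℕ.⊔ N) (ℕ.m≤n⊔m n N)
        where N = proj₁ (proj₂ limit ε 0<ε)

      upper : ∀ n → x n -ᵣ L ≤ r n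
      upper n r<d with later n _ (x<y⇒0<y-x r<d)
      ... | m , n≤m , _ , m<ε = proj₂ (x-cauchy m n n≤m) (<-by (x<y⇒0<y-x m<ε)
        (solve 4 (λ x y l r → ((x :- l) :- r) :- (y :- l) := :- (y :- x) :- r) refl (x n) (x m) L (r n)))

      lower : ∀ n → -ᵣ (x n -ᵣ L) ≤ r n
      lower n r<d with later n _ (x<y⇒0<y-x r<d)
      ... | m , n≤m , -ε<m , _ = proj₁ (x-cauchy m n n≤m) (<-by (x<y⇒0<y-x -ε<m)
        (solve 4 (λ x y l r → (y :- l) :- :- (:- (x :- l) :- r) := (y :- x) :- r) refl (x n) (x m) L (r n)))

  bounded-complete : (s : ℕ → ℂ) (r : ℕ → ℝ) →
    (∀ ε → 0ᵣ < ε → ∃[ N ] (∀ n → N ℕ.≤ n → r n < ε)) →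
    (∀ m n → n ℕ.≤ m → Bounded (s m - s n) (r n)) →
    ∃[ L ] (∀ n → Bounded (s n - L) (r n +ᵣ r n))
  bounded-complete s r r→0 s-cauchy = (proj₁ reals +i proj₁ imags) , λ n → +-nonneg (0≤r n) (0≤r n) ,
      ≤-trans (+-mono-≤ (square-≤ (proj₁ (proj₂ reals n)) (proj₂ (proj₂ reals n))) (square-≤ (proj₁ (proj₂ imags n)) (proj₂ (proj₂ imags n))))
        (≤-by (+-nonneg (0≤x² (r n)) (0≤x² (r n))) (solve 1 (λ r → r :* r :+ r :* r := (r :+ r) :* (r :+ r) :- (r :* r :+ r :* r)) refl (r n)))
    where
    0≤r : ∀ n → 0ᵣ ≤ r n
    0≤r n = proj₁ (s-cauchy n n ℕ.≤-refl)
    reals = real-limit (λ n → re (s n)) r r→0 (λ m n n≤m → re-≤ {s m - s n} (s-cauchy m n n≤m) , re-≤ { - (s m - s n)} (bounded-neg {s m - s n} (s-cauchy m n n≤m)))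
    imags = real-limit (λ n → im (s n)) r r→0 (λ m n n≤m → im-≤ {s m - s n} (s-cauchy m n n≤m) , im-≤ { - (s m - s n)} (bounded-neg {s m - s n} (s-cauchy m n n≤m)))

  bounded-invertible : ∀ {w b} → Bounded w b → b < 1ᵣ → ∃[ v ] (v * (1# - w) ≈ 1#)
  bounded-invertible {w} (0≤b , w≤b) b<1 = _/_ 1# (1# - w) {{1-w≠0}} , /-* 1# (1# - w) 1-w≠0
    where
    1-w≠0 = ∣w∣²<1⇒1-w-nonzero w (≤-<-trans w≤b (<-respʳ-≈ (*-identityˡ 1ᵣ) (<-square 0≤b b<1)))

  ℂ-normed : NormedRing ℛ c ℓ₁ ℓ₂
  ℂ-normed = record
    { commutativeRing = ℂ-ring
    ; ‖_‖≤_      = Bounded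
    ; ‖‖-nonneg  = proj₁
    ; ‖‖-cong    = λ {x} {y} x≈y (0≤B , x≤B) → 0≤B , ≤-respˡ-≈ (∣∣²-cong {x} {y} x≈y) x≤B
    ; ‖‖-mono    = λ B≤C (0≤B , x≤B) → ≤-trans 0≤B B≤C , ≤-trans x≤B (≤-square 0≤B B≤C)
    ; ‖0‖≤0      = bounded-0
    ; ‖1‖≤1      = bounded-1
    ; ‖‖-+       = λ {x} {y} → bounded-+ {x} {y}
    ; ‖‖-neg     = λ {x} → bounded-neg {x}
    ; ‖‖-*       = λ {x} {y} → bounded-* {x} {y}
    ; ‖‖-bounded = bounded-any
    ; invertible = λ {w} → bounded-invertible {w}
    ; ‖‖-inverse = λ {w} {v} → bounded-inverse {w} {v}
    ; complete   = bounded-complete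
    }

-- Orders of magnitude

module Asymptotics {c ℓ₁ ℓ₂ a ℓ b} (ℛ : RealField c ℓ₁ ℓ₂) (𝒦 : NormedRing ℛ a ℓ b) (ρ : RealField.Carrier ℛ)
  (0≤ρ : OrderLemmas._≤_ ℛ (RealField.0# ℛ) ρ) (ρ<1 : RealField._<_ ℛ ρ (RealField.1# ℛ)) where
  open NormedRing 𝒦
  open CommutativeRing commutativeRing hiding (zero)
  open FiniteSums commutativeRing
  open IntegerRingSolver commutativeRing
  open Geometric ℛ ρ 0≤ρ ρ<1
  private
    module ℝ where
      open RealField ℛ public
      open RealOrder ℛ public
      open IntegerRingSolver (RealField.commutativeRing ℛ) public
      open Exp (CommutativeRing.semiring (RealField.commutativeRing ℛ)) public using (_^_; ^-homo-*)
    variable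
      i j : Level
      I J : Set i

  -- f = O(ρᵉ), uniformly over the index set.
  record O {I : Set i} (e : I → ℕ) (f : I → Carrier) : Set (c ⊔ ℓ₂ ⊔ b ⊔ i) where
    constructor bigO
    field
      constant : ℝ.Carrier
      nonneg   : ℝ.0# ℝ.≤ constant
      bound    : ∀ x → ‖ f x ‖≤ constant ℝ.* ρ ℝ.^ e x
  open O public

  O-cong : {e : I → ℕ} {f g : I → Carrier} → (∀ x → f x ≈ g x) → O e f → O e g
  O-cong f≈g (bigO C 0≤C p) = bigO C 0≤C (λ x → ‖‖-cong (f≈g x) (p x))

  O-weaken : {e e′ : I → ℕ} {f : I → Carrier} → (∀ x → e′ x ℕ.≤ e x) → O e f → O e′ f
  O-weaken e′≤e (bigO C 0≤C p) = bigO C 0≤C (λ x → ‖‖-mono (ℝ.*-monoˡ-≤ 0≤C (ρ^-mono (e′≤e x))) (p x))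

  O-∘ : {e : I → ℕ} {f : I → Carrier} (h : J → I) → O e f → O (e ∘ h) (f ∘ h)
  O-∘ h (bigO C 0≤C p) = bigO C 0≤C (p ∘ h)

  O-+ : {e : I → ℕ} {f g : I → Carrier} → O e f → O e g → O e (λ x → f x + g x)
  O-+ (bigO C 0≤C p) (bigO D 0≤D q) = bigO (C ℝ.+ D) (ℝ.+-nonneg 0≤C 0≤D)
    (λ x → ‖‖-mono (ℝ.≤-reflexive (ℝ.sym (ℝ.distribʳ _ C D))) (‖‖-+ (p x) (q x)))

  O-neg : {e : I → ℕ} {f : I → Carrier} → O e f → O e (λ x → - f x)
  O-neg (bigO C 0≤C p) = bigO C 0≤C (λ x → ‖‖-neg (p x))

  O-- : {e : I → ℕ} {f g : I → Carrier} → O e f → O e g → O e (λ x → f x - g x)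
  O-- p q = O-+ p (O-neg q)

  O-* : {e e′ : I → ℕ} {f g : I → Carrier} → O e f → O e′ g → O (λ x → e x +ₙ e′ x) (λ x → f x * g x)
  O-* {e = e} {e′} (bigO C 0≤C p) (bigO D 0≤D q) = bigO (C ℝ.* D) (ℝ.*-nonneg 0≤C 0≤D)
    (λ x → ‖‖-mono (ℝ.≤-reflexive (ℝ.trans (ℝ.solve 4 (λ c x d y → (c ℝ.:* x) ℝ.:* (d ℝ.:* y) ℝ.:= (c ℝ.:* d) ℝ.:* (x ℝ.:* y)) ℝ.refl C _ D _)
      (ℝ.*-congˡ (ℝ.sym (ℝ.^-homo-* ρ (e x) (e′ x)))))) (‖‖-* (p x) (q x)))

  O-0 : {e : I → ℕ} → O e (λ _ → 0#)
  O-0 = bigO ℝ.0# ℝ.≤-refl (λ x → ‖‖-mono (ℝ.≤-reflexive (ℝ.sym (ℝ.zeroˡ _))) ‖0‖≤0)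

  O-const : ∀ y → O {I = I} (λ _ → 0) (λ _ → y)
  O-const y with ‖‖-bounded y
  ... | B , y≤B = bigO B (‖‖-nonneg y≤B) (λ x → ‖‖-mono (ℝ.≤-reflexive (ℝ.sym (ℝ.*-identityʳ B))) y≤B)

  -- A bounded factor does not change the order of magnitude.
  O-*ˡ : {e : I → ℕ} {f g : I → Carrier} → O (λ _ → 0) f → O e g → O e (λ x → f x * g x)
  O-*ˡ = O-*

  O-*ʳ : {e : I → ℕ} {f g : I → Carrier} → O e f → O (λ _ → 0) g → O e (λ x → f x * g x)
  O-*ʳ p q = O-cong (λ x → *-comm _ _) (O-* q p)

  -- A bound over I × ℕ may be proved separately for n = 0 and for n ≥ 1.
  O-cases : {e : I × ℕ → ℕ} {f : I × ℕ → Carrier} → O (λ x → e (x , 0)) (λ x → f (x , 0)) →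
    O {I = I × ℕ} (λ (x , n) → e (x , suc n)) (λ (x , n) → f (x , suc n)) → O e f
  O-cases {e = e} (bigO C 0≤C p) (bigO D 0≤D q) = bigO (C ℝ.+ D) (ℝ.+-nonneg 0≤C 0≤D) λ where
    (x , zero)  → ‖‖-mono (ℝ.*-monoʳ-≤ (0≤ρ^ (e (x , zero))) (ℝ.≤-by 0≤D (ℝ.solve 2 (λ c d → d ℝ.:= (c ℝ.:+ d) ℝ.:- c) ℝ.refl C D))) (p x)
    (x , suc n) → ‖‖-mono (ℝ.*-monoʳ-≤ (0≤ρ^ (e (x , suc n))) (ℝ.≤-by 0≤C (ℝ.solve 2 (λ c d → c ℝ.:= (c ℝ.:+ d) ℝ.:- d) ℝ.refl C D))) (q (x , n))

  private
    ∑-bounded : ∀ N (f : ℕ → Carrier) B → ℝ.0# ℝ.≤ B → (∀ n → n ℕ.< N → ‖ f n ‖≤ B ℝ.* ρ ℝ.^ n) → ‖ ∑ N f ‖≤ B ℝ.* γ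
    ∑-bounded zero    f B 0≤B p = ‖‖-cong (sym (∑-0 f)) (‖‖-mono (ℝ.*-nonneg 0≤B 0≤γ) ‖0‖≤0)
    ∑-bounded (suc N) f B 0≤B p = ‖‖-cong (sym (∑-suc N f)) (‖‖-mono (ℝ.≤-reflexive total) (‖‖-+ (p 0 (ℕ.s≤s ℕ.z≤n))
      (∑-bounded N (f ∘ suc) (B ℝ.* ρ) (ℝ.*-nonneg 0≤B 0≤ρ) (λ n n<N → ‖‖-mono (ℝ.≤-reflexive (ℝ.sym (ℝ.*-assoc _ _ _))) (p (suc n) (ℕ.s≤s n<N))))))
      where
      total : B ℝ.* ℝ.1# ℝ.+ (B ℝ.* ρ) ℝ.* γ ℝ.≈ B ℝ.* γ
      total = ℝ.trans (ℝ.solve 3 (λ b r g → b ℝ.:* ℝ.con (pos 1) ℝ.:+ (b ℝ.:* r) ℝ.:* g ℝ.:= b ℝ.:* (ℝ.con (pos 1) ℝ.:+ r ℝ.:* g)) ℝ.refl B ρ γ) (ℝ.*-congˡ γ-step)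

  -- Geometric series: summing terms O(ρ^(e + n)) over n gives O(ρᵉ), however
  -- many terms there are.
  O-∑ : {e : I → ℕ} (N : I → ℕ) {f : I → ℕ → Carrier} →
    O {I = Σ I (λ x → Σ ℕ (λ n → n ℕ.< N x))} (λ (x , n , _) → e x +ₙ n) (λ (x , n , _) → f x n) →
    O e (λ x → ∑ (N x) (f x))
  O-∑ {e = e} N {f} (bigO C 0≤C p) = bigO (C ℝ.* γ) (ℝ.*-nonneg 0≤C 0≤γ) (λ x →
    ‖‖-mono (ℝ.≤-reflexive (ℝ.solve 3 (λ c y g → (c ℝ.:* y) ℝ.:* g ℝ.:= (c ℝ.:* g) ℝ.:* y) ℝ.refl C _ γ))
      (∑-bounded (N x) (f x) (C ℝ.* ρ ℝ.^ e x) (ℝ.*-nonneg 0≤C (0≤ρ^ (e x))) (λ n n<N →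
        ‖‖-mono (ℝ.≤-reflexive (ℝ.trans (ℝ.*-congˡ (ℝ.^-homo-* ρ (e x) n)) (ℝ.sym (ℝ.*-assoc _ _ _)))) (p (x , n , n<N)))))

  eventually<1 : {w : ℕ → Carrier} → O (λ n → n) w → ∃[ n ] ∃[ B ] ((‖ w n ‖≤ B) × (B ℝ.< ℝ.1#))
  eventually<1 (bigO C 0≤C p) = N , C ℝ.* ρ ℝ.^ N , p N , proj₂ small N ℕ.≤-refl
    where
    small = ρ^-small 0≤C ℝ.0<1
    N = proj₁ small

  -- A sequence with increments O(ρⁿ) converges, with error O(ρⁿ).
  O-limit : (s : ℕ → Carrier) → O (λ n → n) (λ n → s (suc n) - s n) → ∃[ L ] O (λ n → n) (λ n → s n - L)
  O-limit s increments = L , bigO (D ℝ.+ D) (ℝ.+-nonneg 0≤D 0≤D) (λ n → ‖‖-mono (ℝ.≤-reflexive (ℝ.sym (ℝ.distribʳ _ D D))) (close n))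
    where
    tails : O {I = ℕ × ℕ} proj₁ (λ (n , k) → s (k +ₙ n) - s n)
    tails = O-cong (λ (n , k) → telescope n k) (O-∑ proj₂ {λ (n , _) l → s (suc (l +ₙ n)) - s (l +ₙ n)}
      (O-weaken (λ ((n , k) , l , _) → ℕ.≤-reflexive (ℕ.+-comm n l)) (O-∘ (λ ((n , k) , l , _) → l +ₙ n) increments)))
      where
      telescope : ∀ n k → ∑ k (λ l → s (suc (l +ₙ n)) - s (l +ₙ n)) ≈ s (k +ₙ n) - s n
      telescope n zero    = trans (∑-0 _) (sym (-‿inverseʳ _))
      telescope n (suc k) = trans (∑-last k _) (trans (+-congʳ (telescope n k))
        (solve 3 (λ x y z → (y :- x) :+ (z :- y) := z :- x) refl (s n) (s (k +ₙ n)) (s (suc (k +ₙ n)))))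
    D = constant tails
    0≤D = nonneg tails
    limit = complete s (λ n → D ℝ.* ρ ℝ.^ n) (λ ε → ρ^-small 0≤D)
      (λ m n n≤m → ≡.subst (λ m → ‖ s m - s n ‖≤ D ℝ.* ρ ℝ.^ n) (ℕ.m∸n+n≡m n≤m) (bound tails (n , m ∸ n)))
    L = proj₁ limit
    close = proj₂ limit

  O-product-limit : ∀ {f g : I → Carrier} {x y} {e : I → ℕ} → O (λ _ → 0) f → O e (λ i → f i - x) → O e (λ i → g i - y) → O e (λ i → f i * g i - x * y)
  O-product-limit {f = f} {g} {x} {y} f-bounded f→x g→y = O-cong
    (λ i → solve 4 (λ f g x y → f :* (g :- y) :+ (f :- x) :* y := f :* g :- x :* y) refl (f i) (g i) x y)
    (O-+ (O-*ˡ f-bounded g→y) (O-*ʳ f→x (O-const y)))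

  -- Products whose factors are as close to 1 as in (ρ; ρ)ₙ are bounded.
  O-product : (f g : ℕ → Carrier) → f 0 ≈ 1# → (∀ n → f (suc n) ≈ f n * g n) → (∀ n → ‖ g n ‖≤ v n) → O (λ _ → 0) f
  O-product f g f-zero f-suc g≤v = bigO U 0≤U (λ n → ‖‖-mono (ℝ.≤-trans (u≤U n) (ℝ.≤-reflexive (ℝ.sym (ℝ.*-identityʳ U)))) (f≤u n))
    where
    U   = proj₁ u-bounded
    0≤U = proj₁ (proj₂ u-bounded)
    u≤U = proj₂ (proj₂ u-bounded)
    f≤u : ∀ n → ‖ f n ‖≤ u n
    f≤u zero    = ‖‖-cong (sym f-zero) ‖1‖≤1
    f≤u (suc n) = ‖‖-cong (sym (f-suc n)) (‖‖-* (f≤u n) (g≤v n))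

-- Limits of q-products

module QLimits {c ℓ₁ ℓ₂ a ℓ b} (ℛ : RealField c ℓ₁ ℓ₂) (𝒦 : NormedRing ℛ a ℓ b) (ρ : RealField.Carrier ℛ)
  (0≤ρ : OrderLemmas._≤_ ℛ (RealField.0# ℛ) ρ) (ρ<1 : RealField._<_ ℛ ρ (RealField.1# ℛ))
  (q : CommutativeRing.Carrier (NormedRing.commutativeRing 𝒦)) (‖q‖≤ρ : NormedRing.‖_‖≤_ 𝒦 q ρ)
  (F : QFactorials (NormedRing.commutativeRing 𝒦) q) where
  open NormedRing 𝒦
  open CommutativeRing commutativeRing hiding (zero)
  open FiniteSums commutativeRing
  open IntegerRingSolver commutativeRing
  open Exp semiring using (_^_)
  open Geometric ℛ ρ 0≤ρ ρ<1
  open Asymptotics ℛ 𝒦 ρ 0≤ρ ρ<1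
  open QSeries commutativeRing q F
  open Bailey commutativeRing q F
  private
    module ℝ where
      open RealField ℛ public
      open RealOrder ℛ public
      open Exp (CommutativeRing.semiring (RealField.commutativeRing ℛ)) public using (_^_)
    variable
      i : Level
      I : Set i

  ‖q^‖≤ρ^ : ∀ n → ‖ q ^ n ‖≤ ρ ℝ.^ n
  ‖q^‖≤ρ^ zero    = ‖1‖≤1
  ‖q^‖≤ρ^ (suc n) = ‖‖-* ‖q‖≤ρ (‖q^‖≤ρ^ n)

  O-q^ : (e : I → ℕ) → O e (λ x → q ^ e x)
  O-q^ e = bigO ℝ.1# ℝ.0≤1 (λ x → ‖‖-mono (ℝ.≤-reflexive (ℝ.sym (ℝ.*-identityˡ _))) (‖q^‖≤ρ^ (e x)))

  O-q^0 : (e : I → ℕ) → O (λ _ → 0) (λ x → q ^ e x)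
  O-q^0 e = O-weaken (λ _ → ℕ.z≤n) (O-q^ e)

  -- Infinite products ∏ (1 - x n) with |x n| ≤ ρⁿ⁺¹ converge.
  O-pochhammer : (f x : ℕ → Carrier) → f 0 ≈ 1# → (∀ n → f (suc n) ≈ f n * (1# - x n)) → (∀ n → ‖ x n ‖≤ ρ ℝ.^ suc n) →
    O (λ _ → 0) f × ∃[ L ] O (λ n → n) (λ n → f n - L)
  O-pochhammer f x f-zero f-suc x≤ = f-bounded , O-limit f (O-cong step (O-neg (O-*ˡ f-bounded x-small)))
    where
    f-bounded : O (λ _ → 0) f
    f-bounded = O-product f (λ n → 1# - x n) f-zero f-suc (λ n → ‖‖-mono (1+ρ^≤v n) (‖‖-+ ‖1‖≤1 (‖‖-neg (x≤ n))))
    x-small : O (λ n → n) x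
    x-small = O-weaken ℕ.n≤1+n (bigO ℝ.1# ℝ.0≤1 (λ n → ‖‖-mono (ℝ.≤-reflexive (ℝ.sym (ℝ.*-identityˡ _))) (x≤ n)))
    step : ∀ n → - (f n * x n) ≈ f (suc n) - f n
    step n = trans (solve 2 (λ f x → :- (f :* x) := f :* (con (pos 1) :- x) :- f) refl (f n) (x n)) (+-congʳ (sym (f-suc n)))

  private
    fact-asymptotics : O (λ _ → 0) fact × ∃[ L ] O (λ n → n) (λ n → fact n - L)
    fact-asymptotics = O-pochhammer fact (λ n → q ^ suc n) fact-zero fact-suc (λ n → ‖q^‖≤ρ^ (suc n))

  O-fact : O (λ _ → 0) fact
  O-fact = proj₁ fact-asymptotics

  O-inv : O (λ _ → 0) inv
  O-inv = O-product inv (λ n → fact n * inv (suc n)) inv-zero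
    (λ n → trans (trans (sym (*-identityˡ _)) (*-congʳ (sym (fact-inv n)))) (solve 3 (λ f i j → f :* i :* j := i :* (f :* j)) refl (fact n) (inv n) (inv (suc n))))
    (λ n → ‖‖-inverse (‖q^‖≤ρ^ (suc n)) (ρ^suc<1 n)
      (trans (*-assoc _ _ _) (trans (*-congˡ (sym (inv-suc n))) (fact-inv n))) (v-inverse n) (0≤v n))

  abstract
    -- (q)_∞ and its inverse.
    D : Carrier
    D = proj₁ (proj₂ fact-asymptotics)

    fact→D : O (λ n → n) (λ n → fact n - D)
    fact→D = proj₂ (proj₂ fact-asymptotics)

  private
    -- D/(q)ₙ = 1 - ((q)ₙ - D)/(q)ₙ is invertible for large n.
    D-inverse′ : ∃[ d ] (D * d ≈ 1#)
    D-inverse′ = inv n * proj₁ v⁻¹ , trans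
        (trans (sym (*-assoc _ _ _)) (trans (*-congʳ D*inv) (*-comm _ _))) (proj₂ v⁻¹)
      where
      w : ℕ → Carrier
      w n = (fact n - D) * inv n
      w-small : O (λ n → n) w
      w-small = O-*ʳ fact→D O-inv
      small = eventually<1 w-small
      n = proj₁ small
      v⁻¹ : ∃[ v ] (v * (1# - w n) ≈ 1#)
      v⁻¹ = invertible (proj₁ (proj₂ (proj₂ small))) (proj₂ (proj₂ (proj₂ small)))
      D*inv : D * inv n ≈ 1# - w n
      D*inv = trans (solve 3 (λ d f i → d :* i := f :* i :- (f :- d) :* i) refl D (fact n) (inv n)) (+-congʳ (fact-inv n))

  abstract
    D-inverse : ∃[ d ] (D * d ≈ 1#)
    D-inverse = D-inverse′

  δ : Carrier
  δ = proj₁ D-inverse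

  Dδ≈1 : D * δ ≈ 1#
  Dδ≈1 = proj₂ D-inverse

  inv→δ : O (λ n → n) (λ n → inv n - δ)
  inv→δ = O-cong eq (O-*ˡ O-inv (O-*ˡ (O-const δ) (O-neg fact→D)))
    where
    eq : ∀ n → inv n * (δ * - (fact n - D)) ≈ inv n - δ
    eq n = trans (solve 4 (λ i e f d → i :* (e :* :- (f :- d)) := i :* (d :* e) :- (f :* i) :* e) refl (inv n) δ (fact n) D)
      (+-cong (trans (*-congˡ Dδ≈1) (*-identityʳ _)) (-‿cong (trans (*-congʳ (fact-inv n)) (*-identityˡ δ))))

  O-rest : O {I = ℕ × ℕ} (λ _ → 0) (λ (n , j) → rest n j)
  O-rest = bigO (constant O-inv) (nonneg O-inv) (λ (n , j) → go n j)
    where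
    go : ∀ n j → ‖ rest n j ‖≤ constant O-inv ℝ.* ℝ.1#
    go zero    j       = ‖‖-mono (ℝ.*-nonneg (nonneg O-inv) ℝ.0≤1) ‖0‖≤0
    go (suc n) zero    = bound O-inv n
    go (suc n) (suc j) = go n j

  rest-≤ : ∀ {n r} → r ℕ.≤ n → rest (suc n) r ≈ inv (n ∸ r)
  rest-≤ {n} ℕ.z≤n             = refl
  rest-≤     (ℕ.s≤s r≤n) = rest-≤ r≤n

  -- Tannery's theorem for Bailey pairs.  If X n tends to (q)_∞², then X n times
  -- the coefficient of αᵣ in βₙ is 1 + O(ρⁿ⁻ʳ).  As αᵣ = O(ρ²ʳ), this makes X n βₙ
  -- close to the n-th partial sum of α.
  O-β : (α X : ℕ → Carrier) → O (λ r → r +ₙ r) α → O (λ n → n) (λ n → X n - D * D) →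
    O (λ n → n) (λ n → X n * β α n - ∑ (suc n) α)
  O-β α X α-small X→D² = O-cong eq (O-∑ suc (O-weaken exponent (O-* (O-∘ index-r α-small) coefficient)))
    where
    J = Σ ℕ (λ n → Σ ℕ (λ r → r ℕ.< suc n))
    index-r : J → ℕ
    index-r (n , r , _) = r
    gap : J → ℕ
    gap (n , r , _) = n ∸ r
    exponent : ∀ (x : J) → proj₁ x +ₙ index-r x ℕ.≤ (index-r x +ₙ index-r x) +ₙ gap x
    exponent (n , r , _) = ℕ.≤-trans (ℕ.+-monoˡ-≤ r (ℕ.m≤n+m∸n n r)) (ℕ.≤-reflexive (identity r (n ∸ r)))
      where
      identity : ∀ r m → (r +ₙ m) +ₙ r ≡ (r +ₙ r) +ₙ m
      identity = solve-∀
    X-bounded : O (λ _ → 0) X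
    X-bounded = O-cong (λ n → solve 2 (λ x d → (x :- d) :+ d := x) refl (X n) (D * D)) (O-+ (O-weaken (λ _ → ℕ.z≤n) X→D²) (O-const (D * D)))
    coefficient : O gap (λ (n , r , _) → X n * (rest (suc n) r * inv (n +ₙ suc r)) - 1#)
    coefficient = O-cong one (O-product-limit (O-∘ proj₁ X-bounded)
        (O-weaken (λ (n , r , _) → ℕ.m∸n≤m n r) (O-∘ proj₁ X→D²))
        (O-product-limit (O-∘ (λ (n , r , _) → suc n , r) O-rest)
          (O-cong (λ (n , r , r<1+n) → +-congʳ (sym (rest-≤ (ℕ.≤-pred r<1+n)))) (O-∘ gap inv→δ))
          (O-weaken (λ (n , r , _) → ℕ.≤-trans (ℕ.m∸n≤m n r) (ℕ.m≤m+n n (suc r))) (O-∘ (λ (n , r , _) → n +ₙ suc r) inv→δ))))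
      where
      one : ∀ (x : J) → _
      one (n , r , _) = +-congˡ {X n * (rest (suc n) r * inv (n +ₙ suc r))} (-‿cong (trans (solve 2 (λ d e → d :* d :* (e :* e) := (d :* e) :* (d :* e)) refl D δ)
        (trans (*-cong Dδ≈1 Dδ≈1) (*-identityˡ 1#))))
    eq : ∀ n → ∑ (suc n) (λ r → α r * (X n * (rest (suc n) r * inv (n +ₙ suc r)) - 1#)) ≈ X n * β α n - ∑ (suc n) α
    eq n = trans (∑-cong (suc n) (λ r → solve 3 (λ a x u → a :* (x :* u :- con (pos 1)) := x :* (a :* u) :- a) refl (α r) (X n) _))
      (trans (∑-- (suc n) _ α) (+-congʳ (sym (∑-*ˡ (suc n) (X n) _))))

-- The transfer operator in the limit

module TransferLimits {c ℓ₁ ℓ₂ a ℓ b} (ℛ : RealField c ℓ₁ ℓ₂) (𝒦 : NormedRing ℛ a ℓ b) (ρ : RealField.Carrier ℛ)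
  (0≤ρ : OrderLemmas._≤_ ℛ (RealField.0# ℛ) ρ) (ρ<1 : RealField._<_ ℛ ρ (RealField.1# ℛ))
  (q : CommutativeRing.Carrier (NormedRing.commutativeRing 𝒦)) (‖q‖≤ρ : NormedRing.‖_‖≤_ 𝒦 q ρ)
  (F : QFactorials (NormedRing.commutativeRing 𝒦) q) where
  open NormedRing 𝒦
  open CommutativeRing commutativeRing hiding (zero)
  open FiniteSums commutativeRing
  open IntegerRingSolver commutativeRing
  open Exp semiring using (_^_; ^-congʳ)
  open Asymptotics ℛ 𝒦 ρ 0≤ρ ρ<1
  open QSeries commutativeRing q F
  open Bailey commutativeRing q F
  open SetoidReasoning setoid
  open Transfer commutativeRing q F
  open AndrewsGordon commutativeRing q F
  open QLimits ℛ 𝒦 ρ 0≤ρ ρ<1 q ‖q‖≤ρ F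
  private
    variable
      i : Level
      I : Set i

  -- Euler's series at z = qˢ⁺¹, uniformly in s.
  O-euler : O {I = ℕ × ℕ} proj₂ (λ (s , N) → euler s N - fact s * δ)
  O-euler = O-cases
    (O-cong (λ s → +-congʳ (sym (∑-0 _))) (O-- O-0 (O-*ˡ O-fact (O-const δ))))
    (O-cong eq (O-*ˡ (O-∘ proj₁ O-fact) (O-+ gap (O-*ˡ (O-∘ proj₂ O-inv) tail))))
    where
    -- Here N + 1 is the number of terms; 1/(q)ₙ at n = N is rewritten through its
    -- value at N + 1, since inv→δ at N would only give O(ρᴺ).
    gap : O {I = ℕ × ℕ} (λ (s , N) → suc N) (λ (s , N) → (inv (suc N) - δ) - inv (suc N) * q ^ suc N)
    gap = O-- (O-∘ (λ (s , N) → suc N) inv→δ) (O-*ˡ (O-∘ (λ (s , N) → suc N) O-inv) (O-q^ (λ (s , N) → suc N)))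
    tail : O {I = ℕ × ℕ} (λ (s , N) → suc N) (λ (s , N) → ∑ s (λ t → q ^ (suc N *ₙ suc t) * inv (suc t)))
    tail = O-∑ proj₁ (O-*ʳ (O-weaken (λ ((s , N) , t , _) → exponent N t) (O-q^ (λ ((s , N) , t , _) → suc N *ₙ suc t)))
                         (O-∘ (λ (_ , t , _) → suc t) O-inv))
      where
      exponent : ∀ N t → suc N +ₙ t ℕ.≤ suc N *ₙ suc t
      exponent N t = ℕ.≤-trans (ℕ.m≤m+n (suc N +ₙ t) (N *ₙ t)) (ℕ.≤-reflexive (identity N t))
        where
        identity : ∀ N t → suc N +ₙ t +ₙ N *ₙ t ≡ suc N *ₙ suc t
        identity = solve-∀
    eq : ∀ ((s , N) : ℕ × ℕ) → fact s * (((inv (suc N) - δ) - inv (suc N) * q ^ suc N) + inv N * ∑ s (λ t → q ^ (suc N *ₙ suc t) * inv (suc t)))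
       ≈ euler s (suc N) - fact s * δ
    eq (s , N) = begin
      fact s * (((i₁ - δ) - i₁ * q ^ suc N) + inv N * S)
        ≈⟨ solve 6 (λ f i d x j s → f :* (((i :- d) :- i :* x) :+ j :* s) := f :* (i :* (con (pos 1) :- x) :+ j :* s) :- f :* d) refl (fact s) i₁ δ (q ^ suc N) (inv N) S ⟩
      fact s * (i₁ * (1# - q ^ suc N) + inv N * S) - fact s * δ
        ≈⟨ +-congʳ (*-congˡ (+-congʳ (inv-suc N))) ⟨
      fact s * (inv N + inv N * S) - fact s * δ
        ≈⟨ +-congʳ (*-congˡ (solve 2 (λ j s → j :+ j :* s := j :* (con (pos 1) :* con (pos 1) :+ s)) refl (inv N) S)) ⟩
      fact s * (inv N * (1# * 1# + S)) - fact s * δ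
        ≈⟨ +-congʳ (*-congˡ (*-congˡ (trans (∑-suc s _) (+-congʳ (*-cong (^-congʳ q (ℕ.*-zeroʳ N)) inv-zero))))) ⟨
      fact s * (inv N * ∑ (suc s) (λ t → q ^ (suc N *ₙ t) * inv t)) - fact s * δ
        ≈⟨ +-congʳ (euler-finite s N) ⟨
      euler s (suc N) - fact s * δ ∎
      where
      i₁ = inv (suc N)
      S = ∑ s (λ t → q ^ (suc N *ₙ suc t) * inv (suc t))

  -- The operators T N are bounded uniformly in N.
  O-T : {e N : I → ℕ} {g : I → ℕ → Carrier} → O {I = I × ℕ} (λ (x , _) → e x) (λ (x , n) → g x n) →
    O {I = I × ℕ} (λ (x , _) → e x) (λ (x , m) → T (N x) (g x) m)
  O-T {e = e} {N} {g} g-small = O-∑ (λ (x , _) → N x)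
    (O-weaken (λ ((x , m) , n , _) → ℕ.≤-trans (ℕ.≤-reflexive (ℕ.+-comm (e x) n)) (ℕ.+-monoˡ-≤ (e x) (ℕ.m≤m*n n (suc m))))
      (O-* (O-*ʳ (O-q^ (λ ((x , m) , n , _) → n *ₙ suc m)) (O-*ˡ (O-∘ (λ (_ , n , _) → n) O-inv) (O-∘ (λ (_ , n , _) → n) O-inv)))
        (O-∘ (λ ((x , m) , n , _) → x , n) g-small)))

  O-T^ : {e N : I → ℕ} {g : I → ℕ → Carrier} (d : ℕ) → O {I = I × ℕ} (λ (x , _) → e x) (λ (x , n) → g x n) →
    O {I = I × ℕ} (λ (x , _) → e x) (λ (x , m) → T^ (N x) d (g x) m)
  O-T^ zero    g-small = g-small
  O-T^ (suc d) g-small = O-T (O-T^ d g-small)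

  O-weight : O {I = ℕ × ℕ} (λ (n , j) → j *ₙ suc j) (λ (n , j) → weight n j)
  O-weight = O-*ʳ (O-q^ (λ (n , j) → j *ₙ suc j)) (O-∘ (λ (n , j) → suc n , j) O-rest)

  private
    -- Multiplying an error term O(ρᴺ) by the weights and summing.
    O-∑-weight : {n N : I → ℕ} {f : I → ℕ → Carrier} →
      O {I = Σ I (λ x → Σ ℕ (λ j → j ℕ.< suc (n x)))} (λ (x , j , _) → N x ∸ j) (λ (x , j , _) → f x j) →
      O N (λ x → ∑ (suc (n x)) (λ j → weight (n x) j * f x j))
    O-∑-weight {n = n} {N} f-small = O-∑ (λ x → suc (n x)) (O-weaken (λ (x , j , _) → exponent (N x) j)
      (O-* (O-∘ (λ (x , j , _) → n x , j) O-weight) f-small))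
      where
      square : ∀ j → j ℕ.≤ j *ₙ j
      square zero    = ℕ.z≤n
      square (suc j) = ℕ.m≤m*n (suc j) (suc j)
      exponent : ∀ N j → N +ₙ j ℕ.≤ j *ₙ suc j +ₙ (N ∸ j)
      exponent N j = ℕ.≤-trans (ℕ.+-mono-≤ (ℕ.m≤n+m∸n N j) (square j)) (ℕ.≤-reflexive (identity j (N ∸ j)))
        where
        identity : ∀ j m → (j +ₙ m) +ₙ j *ₙ j ≡ j *ₙ suc j +ₙ m
        identity = solve-∀

  O-T-φ : O {I = (ℕ × ℕ) × ℕ} (λ ((n , N) , m) → N) (λ ((n , N) , m) → T N (φ n) m - ∑ (suc n) (λ j → weight n j * (δ * ψ j m)))
  O-T-φ = O-cong eq (O-∑-weight (O-*ˡ (O-*ˡ (O-q^0 (λ (((n , N) , m) , j , _) → j *ₙ m)) (O-*ˡ (O-∘ (λ (_ , j , _) → j) O-inv) (O-∘ (λ (_ , j , _) → j) O-inv)))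
      (O-∘ (λ (((n , N) , m) , j , _) → m , N ∸ j) O-euler)))
    where
    eq : ∀ (((n , N) , m) : (ℕ × ℕ) × ℕ) → ∑ (suc n) (λ j → weight n j * (q ^ (j *ₙ m) * (inv j * inv j) * (euler m (N ∸ j) - fact m * δ)))
       ≈ T N (φ n) m - ∑ (suc n) (λ j → weight n j * (δ * ψ j m))
    eq ((n , N) , m) = begin
      ∑ (suc n) (λ j → weight n j * (x j * (euler m (N ∸ j) - fact m * δ)))
        ≈⟨ ∑-cong (suc n) (λ j → solve 5 (λ k x e f d → k :* (x :* (e :- f :* d)) := k :* (x :* e) :- k :* (d :* (f :* x))) refl (weight n j) (x j) (euler m (N ∸ j)) (fact m) δ) ⟩
      ∑ (suc n) (λ j → weight n j * (x j * euler m (N ∸ j)) - weight n j * (δ * ψ j m))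
        ≈⟨ ∑-- (suc n) (λ j → weight n j * (x j * euler m (N ∸ j))) (λ j → weight n j * (δ * ψ j m)) ⟩
      ∑ (suc n) (λ j → weight n j * (x j * euler m (N ∸ j))) - ∑ (suc n) (λ j → weight n j * (δ * ψ j m))
        ≈⟨ +-congʳ (T-φ N n m) ⟨
      T N (φ n) m - ∑ (suc n) (λ j → weight n j * (δ * ψ j m)) ∎
      where
      x : ℕ → Carrier
      x j = q ^ (j *ₙ m) * (inv j * inv j)

  O-T-ψ : O {I = (ℕ × ℕ) × ℕ} (λ ((j , N) , l) → N) (λ ((j , N) , l) → T N (ψ j) l - δ * φ j l)
  O-T-ψ = O-cong (λ ((j , N) , l) → trans (solve 4 (λ i e f d → i :* (e :- f :* d) := i :* e :- d :* (f :* i)) refl (inv j * inv j) (euler (l +ₙ j) N) (fact (l +ₙ j)) δ)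
      (+-congʳ (sym (T-ψ N j l))))
    (O-*ˡ (O-*ˡ (O-∘ (λ ((j , _) , _) → j) O-inv) (O-∘ (λ ((j , _) , _) → j) O-inv)) (O-∘ (λ ((j , N) , l) → l +ₙ j , N) O-euler))

  -- Up to O(ρᴺ), the square of T acts on the functions φ n by the Bailey chain.
  O-T²-φ : O {I = (ℕ × ℕ) × ℕ} (λ ((n , N) , l) → N) (λ ((n , N) , l) → T N (T N (φ n)) l - (δ * δ) * ∑ (suc n) (λ j → weight n j * φ j l))
  O-T²-φ = O-cong eq (O-+ (O-T O-T-φ) (O-*ˡ (O-const δ) (O-∑-weight
      (O-weaken (λ (((n , N) , l) , j , _) → ℕ.m∸n≤m N j) (O-∘ (λ (((n , N) , l) , j , _) → (j , N) , l) O-T-ψ)))))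
    where
    eq : ∀ (((n , N) , l) : (ℕ × ℕ) × ℕ) →
      T N (λ m → T N (φ n) m - ∑ (suc n) (λ j → weight n j * (δ * ψ j m))) l + δ * ∑ (suc n) (λ j → weight n j * (T N (ψ j) l - δ * φ j l))
      ≈ T N (T N (φ n)) l - (δ * δ) * ∑ (suc n) (λ j → weight n j * φ j l)
    eq ((n , N) , l) = begin
      T N (λ m → T N (φ n) m - ∑ (suc n) (λ j → weight n j * (δ * ψ j m))) l + δ * ∑ (suc n) (λ j → weight n j * (T N (ψ j) l - δ * φ j l))
        ≈⟨ +-cong (trans (T-- N _ _ l) (+-congˡ (-‿cong first))) (*-congˡ second) ⟩
      (T N (T N (φ n)) l - δ * S) + δ * (S - δ * P)
        ≈⟨ solve 4 (λ t d s p → (t :- d :* s) :+ d :* (s :- d :* p) := t :- (d :* d) :* p) refl _ δ S P ⟩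
      T N (T N (φ n)) l - (δ * δ) * P ∎
      where
      S = ∑ (suc n) (λ j → weight n j * T N (ψ j) l)
      P = ∑ (suc n) (λ j → weight n j * φ j l)
      first : T N (λ m → ∑ (suc n) (λ j → weight n j * (δ * ψ j m))) l ≈ δ * S
      first = begin
        T N (λ m → ∑ (suc n) (λ j → weight n j * (δ * ψ j m))) l
          ≈⟨ T-∑ N (suc n) (λ j m → weight n j * (δ * ψ j m)) l ⟩
        ∑ (suc n) (λ j → T N (λ m → weight n j * (δ * ψ j m)) l)
          ≈⟨ ∑-cong (suc n) (λ j → trans (T-*ˡ N (weight n j) _ l) (trans (*-congˡ (T-*ˡ N δ (ψ j) l))
                (solve 3 (λ k d t → k :* (d :* t) := d :* (k :* t)) refl (weight n j) δ _))) ⟩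
        ∑ (suc n) (λ j → δ * (weight n j * T N (ψ j) l))
          ≈⟨ ∑-*ˡ (suc n) δ _ ⟨
        δ * S ∎
      second : ∑ (suc n) (λ j → weight n j * (T N (ψ j) l - δ * φ j l)) ≈ S - δ * P
      second = begin
        ∑ (suc n) (λ j → weight n j * (T N (ψ j) l - δ * φ j l))
          ≈⟨ ∑-cong (suc n) (λ j → solve 4 (λ k t d f → k :* (t :- d :* f) := k :* t :- d :* (k :* f)) refl (weight n j) _ δ (φ j l)) ⟩
        ∑ (suc n) (λ j → weight n j * T N (ψ j) l - δ * (weight n j * φ j l))
          ≈⟨ ∑-- (suc n) _ _ ⟩
        S - ∑ (suc n) (λ j → δ * (weight n j * φ j l))
          ≈⟨ +-congˡ (-‿cong (∑-*ˡ (suc n) δ _)) ⟨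
        S - δ * P ∎

  -- Iterating, T²ᵈ (φ n) at 0 is close to δ²ᵈ times the member of the Bailey chain
  -- reached after d steps from 1/(q)ₙ.
  O-T^-φ : ∀ d → O {I = ℕ × ℕ} proj₂ (λ (n , N) → T^ N (d +ₙ d) (φ n) 0 - δ ^ (d +ₙ d) * β (α (suc d)) n)
  O-T^-φ zero = O-cong eq O-0
    where
    eq : ∀ ((n , N) : ℕ × ℕ) → 0# ≈ φ n 0 - 1# * β (α 1) n
    eq (n , N) = begin
      0#                                            ≈⟨ -‿inverseʳ _ ⟨
      inv n - inv n                                 ≈⟨ +-cong (sym (trans (sym (*-assoc _ _ _)) (trans (*-congʳ (fact-inv n)) (*-identityˡ _)))) (-‿cong (sym (trans (*-identityˡ _) (β-one n)))) ⟩
      fact n * (inv n * inv n) - 1# * β (α 1) n     ∎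
  O-T^-φ (suc d) = O-cong eq (O-+ (O-∘ (λ x → x , 0) (O-T^ (d +ₙ d) O-T²-φ))
      (O-*ˡ (O-const (δ * δ)) (O-∑-weight (O-weaken (λ ((n , N) , j , _) → ℕ.m∸n≤m N j) (O-∘ (λ ((n , N) , j , _) → j , N) (O-T^-φ d))))))
    where
    e = d +ₙ d
    eq : ∀ ((n , N) : ℕ × ℕ) →
      T^ N e (λ l → T N (T N (φ n)) l - (δ * δ) * ∑ (suc n) (λ j → weight n j * φ j l)) 0 +
      (δ * δ) * ∑ (suc n) (λ j → weight n j * (T^ N e (φ j) 0 - δ ^ e * β (α (suc d)) j)) ≈
      T^ N (suc d +ₙ suc d) (φ n) 0 - δ ^ (suc d +ₙ suc d) * β (α (suc (suc d))) n
    eq (n , N) = begin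
      T^ N e (λ l → T N (T N (φ n)) l - (δ * δ) * ∑ (suc n) (λ j → weight n j * φ j l)) 0 +
      (δ * δ) * ∑ (suc n) (λ j → weight n j * (T^ N e (φ j) 0 - δ ^ e * β (α (suc d)) j))
        ≈⟨ +-cong (trans (T^-- N e _ _ 0) (+-congˡ (-‿cong first))) (*-congˡ second) ⟩
      (T^ N e (T N (T N (φ n))) 0 - (δ * δ) * S) + (δ * δ) * (S - δ ^ e * B)
        ≈⟨ solve 5 (λ t d s x b → (t :- (d :* d) :* s) :+ (d :* d) :* (s :- x :* b) := t :- d :* (d :* x) :* b) refl (T^ N e (T N (T N (φ n))) 0) δ S (δ ^ e) B ⟩
      T^ N e (T N (T N (φ n))) 0 - δ * (δ * δ ^ e) * B
        ≈⟨ +-cong (reflexive (≡.trans (≡.cong (λ g → g 0) (≡.sym (T^-+ N e 2 (φ n)))) (≡.cong (λ k → T^ N k (φ n) 0) index)))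
             (-‿cong (*-congʳ (trans (*-congˡ (^-congʳ δ (≡.sym (ℕ.+-suc d d)))) refl))) ⟩
      T^ N (suc d +ₙ suc d) (φ n) 0 - δ ^ (suc d +ₙ suc d) * B ∎
      where
      S = ∑ (suc n) (λ j → weight n j * T^ N e (φ j) 0)
      B = β (α (suc (suc d))) n
      index : e +ₙ 2 ≡ suc d +ₙ suc d
      index = identity d
        where
        identity : ∀ d → d +ₙ d +ₙ 2 ≡ suc d +ₙ suc d
        identity = solve-∀
      first : T^ N e (λ l → (δ * δ) * ∑ (suc n) (λ j → weight n j * φ j l)) 0 ≈ (δ * δ) * S
      first = trans (T^-*ˡ N e (δ * δ) (λ l → ∑ (suc n) (λ j → weight n j * φ j l)) 0) (*-congˡ (trans (T^-∑ N e (suc n) (λ j l → weight n j * φ j l) 0)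
        (∑-cong (suc n) (λ j → T^-*ˡ N e (weight n j) (φ j) 0))))
      second : ∑ (suc n) (λ j → weight n j * (T^ N e (φ j) 0 - δ ^ e * β (α (suc d)) j)) ≈ S - δ ^ e * B
      second = begin
        ∑ (suc n) (λ j → weight n j * (T^ N e (φ j) 0 - δ ^ e * β (α (suc d)) j))
          ≈⟨ ∑-cong (suc n) (λ j → solve 4 (λ k t d f → k :* (t :- d :* f) := k :* t :- d :* (k :* f)) refl (weight n j) _ (δ ^ e) _) ⟩
        ∑ (suc n) (λ j → weight n j * T^ N e (φ j) 0 - δ ^ e * (weight n j * β (α (suc d)) j))
          ≈⟨ ∑-- (suc n) _ _ ⟩
        S - ∑ (suc n) (λ j → δ ^ e * (weight n j * β (α (suc d)) j))
          ≈⟨ +-congˡ (-‿cong (trans (sym (∑-*ˡ (suc n) (δ ^ e) _)) (*-congˡ (sym (β-step (α (suc d)) n))))) ⟩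
        S - δ ^ e * B ∎

-- The limit of the sums over cubes

module CubeLimit {c ℓ₁ ℓ₂ a ℓ b} (ℛ : RealField c ℓ₁ ℓ₂) (𝒦 : NormedRing ℛ a ℓ b) (ρ : RealField.Carrier ℛ)
  (0≤ρ : OrderLemmas._≤_ ℛ (RealField.0# ℛ) ρ) (ρ<1 : RealField._<_ ℛ ρ (RealField.1# ℛ))
  (q : CommutativeRing.Carrier (NormedRing.commutativeRing 𝒦)) (‖q‖≤ρ : NormedRing.‖_‖≤_ 𝒦 q ρ)
  (F : QFactorials (NormedRing.commutativeRing 𝒦) q)
  (p : CommutativeRing.Carrier (NormedRing.commutativeRing 𝒦)) (‖p‖≤ρ : NormedRing.‖_‖≤_ 𝒦 p ρ)
  (G : QFactorials (NormedRing.commutativeRing 𝒦) p) where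
  open NormedRing 𝒦
  open CommutativeRing commutativeRing hiding (zero)
  open FiniteSums commutativeRing
  open IntegerRingSolver commutativeRing
  open Exp semiring using (_^_)
  open Geometric ℛ ρ 0≤ρ ρ<1
  open Asymptotics ℛ 𝒦 ρ 0≤ρ ρ<1
  open QSeries commutativeRing q F
  open Bailey commutativeRing q F
  open Transfer commutativeRing q F
  open AndrewsGordon commutativeRing q F
  open QLimits ℛ 𝒦 ρ 0≤ρ ρ<1 q ‖q‖≤ρ F
  open TransferLimits ℛ 𝒦 ρ 0≤ρ ρ<1 q ‖q‖≤ρ F
  open Theta commutativeRing using (t)
  open SetoidReasoning setoid
  private
    module ℝ where
      open RealField ℛ public
      open RealOrder ℛ public
    -- The same notions in base p.
    module P where
      open QSeries commutativeRing p G public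
      open Bailey commutativeRing p G public
      open QLimits ℛ 𝒦 ρ 0≤ρ ρ<1 p ‖p‖≤ρ G public

  -- αᵣ is bounded for k = 0, and O(ρ²ʳ) for k ≥ 1.
  O-α : ∀ k → O (λ _ → 0) (α k)
  O-α zero    = O-+ (one-bounded (λ r → t q 1# q r 0) left) (one-bounded (λ r → t q 1# q 0 (suc r)) (λ r → right (suc r)))
    where
    one-bounded : (f : ℕ → Carrier) → (∀ r → ‖ f r ‖≤ ℝ.1#) → O (λ _ → 0) f
    one-bounded f f≤1 = bigO ℝ.1# ℝ.0≤1 (λ r → ‖‖-mono (ℝ.≤-reflexive (ℝ.sym (ℝ.*-identityˡ ℝ.1#))) (f≤1 r))
    shrink : ∀ {x y} → ‖ x ‖≤ ℝ.1# → ‖ y ‖≤ ℝ.1# → ‖ x * y ‖≤ ℝ.1#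
    shrink x≤1 y≤1 = ‖‖-mono (ℝ.≤-reflexive (ℝ.*-identityˡ ℝ.1#)) (‖‖-* x≤1 y≤1)
    q^≤1 : ∀ n → ‖ q ^ n ‖≤ ℝ.1#
    q^≤1 n = ‖‖-mono (ρ^≤1 n) (‖q^‖≤ρ^ n)
    left : ∀ r → ‖ t q 1# q r 0 ‖≤ ℝ.1#
    left zero    = ‖1‖≤1
    left (suc r) = shrink (‖‖-neg (shrink ‖1‖≤1 (q^≤1 r))) (left r)
    right : ∀ r → ‖ t q 1# q 0 r ‖≤ ℝ.1#
    right zero    = ‖1‖≤1
    right (suc r) = shrink (‖‖-neg (shrink (‖‖-mono ρ≤1 ‖q‖≤ρ) (q^≤1 r))) (right r)
  O-α (suc k) = O-*ˡ (O-q^0 (λ r → r *ₙ suc r)) (O-α k)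

  O-α-suc : ∀ k → O (λ r → r +ₙ r) (α (suc k))
  O-α-suc k = O-*ʳ (O-weaken exponent (O-q^ (λ r → r *ₙ suc r))) (O-α k)
    where
    exponent : ∀ r → r +ₙ r ℕ.≤ r *ₙ suc r
    exponent zero    = ℕ.z≤n
    exponent (suc r) = ℕ.≤-trans (ℕ.m≤m+n _ (r *ₙ suc r)) (ℕ.≤-reflexive (identity r))
      where
      identity : ∀ r → (suc r +ₙ suc r) +ₙ r *ₙ suc r ≡ suc r *ₙ suc (suc r)
      identity = solve-∀

  -- (q)ₙ², which turns φ n l into (q)ₙ₊ₗ.
  X : ℕ → Carrier
  X n = fact n * fact n

  X→D² : O (λ n → n) (λ n → X n - D * D)
  X→D² = O-product-limit O-fact fact→D fact→D

  -- D times the truncated sum differs by O(ρⁿ) from the truncated sum weighted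
  -- by (q)ₙ₊ₗ, where l is the last summation index.
  O-weighted : ∀ d → O {I = ℕ × ℕ} proj₁ (λ (n , N) → D * T^ N d (λ _ → 1#) 0 - X n * T^ N d (φ n) 0)
  O-weighted d = O-cong eq (O-∘ (λ x → x , 0) (O-T^ {N = proj₂} d
      (O-cong same (O-neg (O-weaken (λ ((n , N) , l) → ℕ.m≤n+m n l) (O-∘ (λ ((n , N) , l) → l +ₙ n) fact→D))))))
    where
    same : ∀ (((n , N) , l) : (ℕ × ℕ) × ℕ) → - (fact (l +ₙ n) - D) ≈ D * 1# - X n * φ n l
    same ((n , N) , l) = begin
      - (fact (l +ₙ n) - D)
        ≈⟨ solve 2 (λ f d → :- (f :- d) := d :* con (pos 1) :- f :* (con (pos 1) :* con (pos 1))) refl (fact (l +ₙ n)) D ⟩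
      D * 1# - fact (l +ₙ n) * (1# * 1#)
        ≈⟨ +-congˡ (-‿cong (*-congˡ (*-cong (fact-inv n) (fact-inv n)))) ⟨
      D * 1# - fact (l +ₙ n) * ((fact n * inv n) * (fact n * inv n))
        ≈⟨ +-congˡ (-‿cong (solve 3 (λ f x i → f :* ((x :* i) :* (x :* i)) := (x :* x) :* (f :* (i :* i))) refl (fact (l +ₙ n)) (fact n) (inv n))) ⟩
      D * 1# - X n * φ n l ∎
    eq : ∀ ((n , N) : ℕ × ℕ) → T^ N d (λ l → D * 1# - X n * φ n l) 0 ≈ D * T^ N d (λ _ → 1#) 0 - X n * T^ N d (φ n) 0
    eq (n , N) = trans (T^-- N d (λ _ → D * 1#) (λ l → X n * φ n l) 0)
      (+-cong (T^-*ˡ N d D (λ _ → 1#) 0) (-‿cong (T^-*ˡ N d (X n) (φ n) 0)))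

  module _ (d : ℕ) (w : Carrier) (w≈ : w ≈ q ^ (suc d +ₙ suc d)) (p≈ : p ≈ q ^ suc (suc d +ₙ suc d))
    (Z W : ℕ → Carrier) (A B : Carrier)
    (Z-zero : Z 0 ≈ 1#) (Z-suc : ∀ n → Z (suc n) ≈ Z n * (1# - q * p ^ n)) (Z-bounded : O (λ _ → 0) Z) (Z→A : O (λ n → n) (λ n → Z n - A))
    (W-zero : W 0 ≈ 1#) (W-suc : ∀ n → W (suc n) ≈ W n * (1# - w * p ^ n)) (W→B : O (λ n → n) (λ n → W n - B)) where

    -- The partial sums of ∑ αᵣ are close to (q)ₙ² βₙ in base q, and to the finite
    -- triple product in base p.
    O-theta : O (λ n → n) (λ n → X n * β (α (suc d)) n - A * B * P.D)
    O-theta = O-cong (λ n → solve 4 (λ x s y z → (x :- s) :- (y :- s) :+ (y :- z) := x :- z) refl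
        (X n * β (α (suc d)) n) (∑ (suc n) (α (suc d))) (Y n * P.β (α (suc d)) n) (A * B * P.D))
      (O-+ (O-- (O-β (α (suc d)) X (O-α-suc d) X→D²) (P.O-β (α (suc d)) Y (O-α-suc d) Y→C²)) product)
      where
      Y : ℕ → Carrier
      Y n = P.D * P.fact (suc (n +ₙ n))
      Y→C² : O (λ n → n) (λ n → Y n - P.D * P.D)
      Y→C² = O-cong (λ n → solve 2 (λ d f → d :* (f :- d) := d :* f :- d :* d) refl P.D (P.fact (suc (n +ₙ n))))
        (O-*ˡ (O-const P.D) (O-weaken (λ n → ℕ.m≤n⇒m≤1+n (ℕ.m≤m+n n n)) (O-∘ (λ n → suc (n +ₙ n)) P.fact→D)))
      p≈qw : p ≈ q * w
      p≈qw = trans p≈ (*-congˡ (sym w≈))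
      triple : ∀ n → Z (suc n) * W n ≈ P.fact (suc (n +ₙ n)) * P.β (α (suc d)) n
      triple n = sym (trans (*-congˡ (P.β-cong (α≈θ (suc d) w≈ p≈) n))
        (TripleProduct.tripleProduct commutativeRing q w p G p≈qw Z W Z-zero Z-suc W-zero W-suc n))
      product : O (λ n → n) (λ n → Y n * P.β (α (suc d)) n - A * B * P.D)
      product = O-cong (λ n → trans (solve 4 (λ c x a b → c :* (x :- a :* b) := c :* x :- a :* b :* c) refl P.D (Z (suc n) * W n) A B)
          (+-congʳ (trans (*-congˡ (triple n)) (sym (*-assoc _ _ _)))))
        (O-*ˡ (O-const P.D) (O-product-limit (O-∘ suc Z-bounded) (O-weaken ℕ.n≤1+n (O-∘ suc Z→A)) W→B))

    -- Take n = N in O-weighted and in O-T^-φ.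
    O-cube : O (λ N → N) (λ N → T^ N (d +ₙ d) (λ _ → 1#) 0 - (A * B * P.D) * δ ^ suc (d +ₙ d))
    O-cube = O-cong eq (O-*ˡ (O-const δ) (O-+ (O-∘ (λ N → N , N) (O-weighted e))
        (O-+ (O-*ˡ (O-*ˡ O-fact O-fact) (O-∘ (λ N → N , N) (O-T^-φ d))) (O-*ˡ (O-const (δ ^ e)) O-theta))))
      where
      e = d +ₙ d
      eq : ∀ N → δ * ((D * T^ N e (λ _ → 1#) 0 - X N * T^ N e (φ N) 0) +
          (X N * (T^ N e (φ N) 0 - δ ^ e * β (α (suc d)) N) + δ ^ e * (X N * β (α (suc d)) N - A * B * P.D)))
        ≈ T^ N e (λ _ → 1#) 0 - (A * B * P.D) * δ ^ suc e
      eq N = begin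
        δ * ((D * S - X N * V) + (X N * (V - δ ^ e * b′) + δ ^ e * (X N * b′ - Θ)))
          ≈⟨ solve 8 (λ i d s x v y b t → i :* ((d :* s :- x :* v) :+ (x :* (v :- y :* b) :+ y :* (x :* b :- t))) := (d :* i) :* s :- t :* (i :* y)) refl
               δ D S (X N) V (δ ^ e) b′ Θ ⟩
        (D * δ) * S - Θ * (δ * δ ^ e)
          ≈⟨ +-congʳ (trans (*-congʳ Dδ≈1) (*-identityˡ S)) ⟩
        S - Θ * δ ^ suc e ∎
        where
        S = T^ N e (λ _ → 1#) 0
        V = T^ N e (φ N) 0
        b′ = β (α (suc d)) N
        Θ = A * B * P.D

-- Unconditional summation over vectors

module Cubes where
  -- The vectors of length m with entries less than N.
  cube : ℕ → (m : ℕ) → List (Vec ℕ m)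
  cube N zero    = [] ∷ []
  cube N (suc m) = List.cartesianProductWith _∷_ (List.upTo N) (cube N m)

  cube-unique : ∀ N m → Unique (cube N m)
  cube-unique N zero    = All.[] ∷ []
  cube-unique N (suc m) = Unique.cartesianProductWith⁺ _∷_ ∷-injective (Unique.upTo⁺ N) (cube-unique N m)

  ∈-cube : ∀ N {m} (ns : Vec ℕ m) → Vec.sum ns ℕ.< N → ns ∈ cube N m
  ∈-cube N []       _ = here ≡.refl
  ∈-cube N (n ∷ ns) p = ∈-cartesianProductWith⁺ _∷_ (∈-upTo⁺ (ℕ.≤-<-trans (ℕ.m≤m+n n _) p))
    (∈-cube N ns (ℕ.≤-<-trans (ℕ.m≤n+m _ n) p))

  -- Every finite set lies in a cube, whose side may be taken to be at least N.
  ⊆-cube : ∀ {m} N (F : List (Vec ℕ m)) → ∃[ M ] ((N ℕ.≤ M) × (F ⊆ cube M m))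
  ⊆-cube N F = N ℕ.+ side F , ℕ.m≤m+n N _ , λ {ns} ns∈F → ∈-cube _ ns (ℕ.<-≤-trans (bound F ns∈F) (ℕ.m≤n+m _ N))
    where
    side : ∀ {m} → List (Vec ℕ m) → ℕ
    side []       = 0
    side (ns ∷ F) = suc (Vec.sum ns) ℕ.+ side F
    bound : ∀ {m} (F : List (Vec ℕ m)) {ns} → ns ∈ F → Vec.sum ns ℕ.< side F
    bound (ns ∷ F) (here ≡.refl) = ℕ.m≤m+n _ (side F)
    bound (ns ∷ F) (there p)     = ℕ.<-≤-trans (bound F p) (ℕ.m≤n+m _ (suc (Vec.sum ns)))

  -- A finite set F contained in G can be split off from G.
  complement : ∀ {i} {I : Set i} (F G : List I) → Unique F → F ⊆ G → ∃[ H ] (G ↭ F ++ H)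
  complement []      G _ _ = G , ↭.refl
  complement (x ∷ F) G (x∉F ∷ F-unique) F⊆G with ∈-∃++ (F⊆G (here ≡.refl))
  ... | as , bs , G≡ = let (H , p) = complement F (as ++ bs) F-unique F⊆rest in H , ↭-trans G↭ (↭.prep x p)
    where
    G↭ : G ↭ x ∷ as ++ bs
    G↭ = ↭-trans (↭-reflexive G≡) (↭-shift x as bs)
    F⊆rest : F ⊆ as ++ bs
    F⊆rest y∈F with ∈-resp-↭ G↭ (F⊆G (there y∈F))
    ... | here y≡x  = ⊥-elim (All.lookup x∉F y∈F (≡.sym y≡x))
    ... | there y∈r = y∈r

module ListSums {c ℓ} (R : CommutativeRing c ℓ) where
  open CommutativeRing R hiding (zero)
  open FiniteSums R
  open IntegerRingSolver R
  open Cubes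
  private
    variable
      i : Level
      I J : Set i

  -- The sum of f over the entries of a list.
  sumOver : (I → Carrier) → List I → Carrier
  sumOver f = List.foldr (λ x s → f x + s) 0#

  sumOver-cong : {f g : I → Carrier} → (∀ x → f x ≈ g x) → ∀ F → sumOver f F ≈ sumOver g F
  sumOver-cong f≈g []      = refl
  sumOver-cong f≈g (x ∷ F) = +-cong (f≈g x) (sumOver-cong f≈g F)

  sumOver-++ : ∀ (f : I → Carrier) F G → sumOver f (F ++ G) ≈ sumOver f F + sumOver f G
  sumOver-++ f []      G = sym (+-identityˡ _)
  sumOver-++ f (x ∷ F) G = trans (+-congˡ (sumOver-++ f F G)) (sym (+-assoc _ _ _))

  sumOver-↭ : ∀ (f : I → Carrier) {F G} → F ↭ G → sumOver f F ≈ sumOver f G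
  sumOver-↭ f ↭.refl         = refl
  sumOver-↭ f (↭.prep x p)   = +-congˡ (sumOver-↭ f p)
  sumOver-↭ f (↭.swap x y p) = trans (solve 3 (λ x y s → x :+ (y :+ s) := y :+ (x :+ s)) refl (f x) (f y) _)
    (+-congˡ (+-congˡ (sumOver-↭ f p)))
  sumOver-↭ f (↭.trans p q)  = trans (sumOver-↭ f p) (sumOver-↭ f q)

  sumOver-*ˡ : ∀ x (f : I → Carrier) F → sumOver (λ y → x * f y) F ≈ x * sumOver f F
  sumOver-*ˡ x f []      = sym (zeroʳ x)
  sumOver-*ˡ x f (y ∷ F) = trans (+-congˡ (sumOver-*ˡ x f F)) (sym (distribˡ x _ _))

  private
    sumOver-map : ∀ (f : J → Carrier) (g : I → J) F → sumOver f (List.map g F) ≈ sumOver (f ∘ g) F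
    sumOver-map f g []      = refl
    sumOver-map f g (x ∷ F) = +-congˡ (sumOver-map f g F)

    sumOver-upTo : ∀ (f : ℕ → Carrier) (g : ℕ → ℕ) N → sumOver f (List.applyUpTo g N) ≈ ∑ N (f ∘ g)
    sumOver-upTo f g zero    = sym (∑-0 _)
    sumOver-upTo f g (suc N) = trans (+-congˡ (sumOver-upTo f (g ∘ suc) N)) (sym (∑-suc N (f ∘ g)))

    sumOver-product : ∀ {m} (f : Vec ℕ (suc m) → Carrier) xs ys →
      sumOver f (List.cartesianProductWith _∷_ xs ys) ≈ sumOver (λ n → sumOver (λ ns → f (n ∷ ns)) ys) xs
    sumOver-product f []       ys = refl
    sumOver-product f (x ∷ xs) ys = trans (sumOver-++ f (List.map (x ∷_) ys) _) (+-cong (sumOver-map f (x ∷_) ys) (sumOver-product f xs ys))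

  sumOver-cube : ∀ N m (f : Vec ℕ (suc m) → Carrier) → sumOver f (cube N (suc m)) ≈ ∑ N (λ n → sumOver (λ ns → f (n ∷ ns)) (cube N m))
  sumOver-cube N m f = trans (sumOver-product f (List.upTo N) (cube N m)) (sumOver-upTo _ id N)

module Summability {c ℓ₁ ℓ₂ a ℓ b} (ℛ : RealField c ℓ₁ ℓ₂) (𝒦 : NormedRing ℛ a ℓ b) (ρ : RealField.Carrier ℛ)
  (0≤ρ : OrderLemmas._≤_ ℛ (RealField.0# ℛ) ρ) (ρ<1 : RealField._<_ ℛ ρ (RealField.1# ℛ))
  (κ : RealField.Carrier ℛ) (0≤κ : OrderLemmas._≤_ ℛ (RealField.0# ℛ) κ) where
  open NormedRing 𝒦
  open CommutativeRing commutativeRing hiding (zero)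
  open IntegerRingSolver commutativeRing
  open ListSums commutativeRing
  open Geometric ℛ ρ 0≤ρ ρ<1
  open Asymptotics ℛ 𝒦 ρ 0≤ρ ρ<1
  open Cubes
  private
    module ℝ where
      open RealField ℛ public
      open RealOrder ℛ public
      open IntegerRingSolver (RealField.commutativeRing ℛ) public
      open ListSums (RealField.commutativeRing ℛ) public
      open FiniteSums (RealField.commutativeRing ℛ) public
      open ThetaScaling (RealField.commutativeRing ℛ) public using (*-^)
      open Exp (CommutativeRing.semiring (RealField.commutativeRing ℛ)) public using (_^_)

  -- The majorant κᵐ ρ^(n₁ + ⋯ + nₘ).
  majorant : ∀ {m} → Vec ℕ m → ℝ.Carrier
  majorant []       = ℝ.1#
  majorant (n ∷ ns) = (κ ℝ.* ρ ℝ.^ n) ℝ.* majorant ns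

  majorant-nonneg : ∀ {m} (ns : Vec ℕ m) → ℝ.0# ℝ.≤ majorant ns
  majorant-nonneg []       = ℝ.0≤1
  majorant-nonneg (n ∷ ns) = ℝ.*-nonneg (ℝ.*-nonneg 0≤κ (0≤ρ^ n)) (majorant-nonneg ns)

  private
    total : ℝ.Carrier
    total = κ ℝ.* γ

    0≤total : ℝ.0# ℝ.≤ total
    0≤total = ℝ.*-nonneg 0≤κ 0≤γ

    geometric : ∀ N → ℝ.∑ N (λ n → κ ℝ.* ρ ℝ.^ n) ℝ.≈ total ℝ.* (ℝ.1# ℝ.- ρ ℝ.^ N)
    geometric zero    = ℝ.trans (ℝ.∑-0 _) (ℝ.sym (ℝ.trans (ℝ.*-congˡ (ℝ.-‿inverseʳ ℝ.1#)) (ℝ.zeroʳ _)))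
    geometric (suc N) = ℝ.trans (ℝ.∑-last N _) (ℝ.trans (ℝ.+-cong (geometric N) (ℝ.trans (ℝ.sym (ℝ.*-identityʳ _)) (ℝ.*-congˡ (ℝ.sym γ-inverse))))
      (ℝ.solve 4 (λ k g x r → (k ℝ.:* g) ℝ.:* (ℝ.con (pos 1) ℝ.:- x) ℝ.:+ (k ℝ.:* x) ℝ.:* (g ℝ.:* (ℝ.con (pos 1) ℝ.:- r)) ℝ.:= (k ℝ.:* g) ℝ.:* (ℝ.con (pos 1) ℝ.:- r ℝ.:* x)) ℝ.refl κ γ (ρ ℝ.^ N) ρ))

    -- The sum of the majorant over a cube factors into geometric sums.
    majorant-cube : ∀ N m → ℝ.sumOver majorant (cube N m) ℝ.≈ (total ℝ.* (ℝ.1# ℝ.- ρ ℝ.^ N)) ℝ.^ m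
    majorant-cube N zero    = ℝ.+-identityʳ _
    majorant-cube N (suc m) = ℝ.trans (ℝ.sumOver-cube N m majorant) (ℝ.trans (ℝ.∑-cong N (λ n → ℝ.sumOver-*ˡ (κ ℝ.* ρ ℝ.^ n) majorant (cube N m)))
      (ℝ.trans (ℝ.sym (ℝ.∑-*ʳ N (ℝ.sumOver majorant (cube N m)) (λ n → κ ℝ.* ρ ℝ.^ n))) (ℝ.*-cong (geometric N) (majorant-cube N m))))

    bernoulli : ∀ {x} → ℝ.0# ℝ.≤ x → ℝ.0# ℝ.≤ ℝ.1# ℝ.- x → ∀ m → ℝ.1# ℝ.- ℝ.fromℕ m ℝ.* x ℝ.≤ (ℝ.1# ℝ.- x) ℝ.^ m
    bernoulli {x} 0≤x x≤1 zero    = ℝ.≤-reflexive (ℝ.solve 1 (λ x → ℝ.con (pos 1) ℝ.:- ℝ.con (pos 0) ℝ.:* x ℝ.:= ℝ.con (pos 1)) ℝ.refl x)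
    bernoulli {x} 0≤x x≤1 (suc m) = ℝ.≤-trans
      (ℝ.≤-by (ℝ.*-nonneg (ℝ.fromℕ-nonneg m) (ℝ.*-nonneg 0≤x 0≤x))
        (ℝ.solve 2 (λ k x → k ℝ.:* (x ℝ.:* x) ℝ.:= (ℝ.con (pos 1) ℝ.:- x) ℝ.:* (ℝ.con (pos 1) ℝ.:- k ℝ.:* x) ℝ.:- (ℝ.con (pos 1) ℝ.:- (ℝ.con (pos 1) ℝ.:+ k) ℝ.:* x)) ℝ.refl (ℝ.fromℕ m) x))
      (ℝ.*-monoˡ-≤ x≤1 (bernoulli 0≤x x≤1 m))

    ^-mono : ∀ {x y} → ℝ.0# ℝ.≤ x → x ℝ.≤ y → ∀ m → x ℝ.^ m ℝ.≤ y ℝ.^ m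
    ^-mono 0≤x x≤y zero    = ℝ.≤-refl
    ^-mono 0≤x x≤y (suc m) = ℝ.*-mono-≤ 0≤x (ℝ.^-nonneg (ℝ.≤-trans 0≤x x≤y) m) x≤y (^-mono 0≤x x≤y m)

    0≤1-ρ^ : ∀ N → ℝ.0# ℝ.≤ ℝ.1# ℝ.- ρ ℝ.^ N
    0≤1-ρ^ N = ℝ.≤-to (ρ^≤1 N)

    sumOver-nonneg : ∀ {m} (H : List (Vec ℕ m)) → ℝ.0# ℝ.≤ ℝ.sumOver majorant H
    sumOver-nonneg []       = ℝ.≤-refl
    sumOver-nonneg (ns ∷ H) = ℝ.+-nonneg (majorant-nonneg ns) (sumOver-nonneg H)

    ‖sumOver‖ : ∀ {m} (f : Vec ℕ m → Carrier) → (∀ ns → ‖ f ns ‖≤ majorant ns) → ∀ H → ‖ sumOver f H ‖≤ ℝ.sumOver majorant H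
    ‖sumOver‖ f f≤ []       = ‖0‖≤0
    ‖sumOver‖ f f≤ (ns ∷ H) = ‖‖-+ (f≤ ns) (‖sumOver‖ f f≤ H)

  -- The constant in majorant-tail; the factor m comes from Bernoulli's inequality.
  tailConstant : ℕ → ℝ.Carrier
  tailConstant m = total ℝ.^ m ℝ.* ℝ.fromℕ m

  tailConstant-nonneg : ∀ m → ℝ.0# ℝ.≤ tailConstant m
  tailConstant-nonneg m = ℝ.*-nonneg (ℝ.^-nonneg 0≤total m) (ℝ.fromℕ-nonneg m)

  -- Outside the cube of side N the majorant sums to at most O(ρᴺ).
  majorant-tail : ∀ {m} N (F H : List (Vec ℕ m)) → Unique F → F ↭ cube N m ++ H →
    ℝ.sumOver majorant H ℝ.≤ tailConstant m ℝ.* ρ ℝ.^ N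
  majorant-tail {m} N F H F-unique F↭ = ℝ.≤-by
      (ℝ.+-nonneg (ℝ.≤-to all) (ℝ.+-nonneg (ℝ.≤-to inside) (sumOver-nonneg G)))
      (ℝ.trans (ℝ.+-congʳ (ℝ.+-congˡ (ℝ.-‿cong split)))
        (ℝ.solve 6 (λ t k x n h g → (t ℝ.:- ((n ℝ.:+ h) ℝ.:+ g)) ℝ.:+ ((n ℝ.:- t ℝ.:* (ℝ.con (pos 1) ℝ.:- k ℝ.:* x)) ℝ.:+ g) ℝ.:= (t ℝ.:* k) ℝ.:* x ℝ.:- h) ℝ.refl
          (total ℝ.^ m) (ℝ.fromℕ m) (ρ ℝ.^ N) (ℝ.sumOver majorant (cube N m)) (ℝ.sumOver majorant H) (ℝ.sumOver majorant G)))
    where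
    outer = ⊆-cube N F
    M = proj₁ outer
    rest = complement F (cube M m) F-unique (proj₂ (proj₂ outer))
    G = proj₁ rest
    split : ℝ.sumOver majorant (cube M m) ℝ.≈ (ℝ.sumOver majorant (cube N m) ℝ.+ ℝ.sumOver majorant H) ℝ.+ ℝ.sumOver majorant G
    split = ℝ.trans (ℝ.sumOver-↭ majorant (proj₂ rest)) (ℝ.trans (ℝ.sumOver-++ majorant F G)
      (ℝ.+-congʳ (ℝ.trans (ℝ.sumOver-↭ majorant F↭) (ℝ.sumOver-++ majorant (cube N m) H))))
    all : ℝ.sumOver majorant (cube M m) ℝ.≤ total ℝ.^ m
    all = ℝ.≤-respˡ-≈ (ℝ.sym (majorant-cube M m)) (^-mono (ℝ.*-nonneg 0≤total (0≤1-ρ^ M))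
      (ℝ.≤-by (ℝ.*-nonneg 0≤total (0≤ρ^ M)) (ℝ.solve 2 (λ t x → t ℝ.:* x ℝ.:= t ℝ.:- t ℝ.:* (ℝ.con (pos 1) ℝ.:- x)) ℝ.refl total (ρ ℝ.^ M))) m)
    inside : total ℝ.^ m ℝ.* (ℝ.1# ℝ.- ℝ.fromℕ m ℝ.* ρ ℝ.^ N) ℝ.≤ ℝ.sumOver majorant (cube N m)
    inside = ℝ.≤-respʳ-≈ (ℝ.sym (ℝ.trans (majorant-cube N m) (ℝ.*-^ total _ m)))
      (ℝ.*-monoˡ-≤ (ℝ.^-nonneg 0≤total m) (bernoulli (0≤ρ^ N) (0≤1-ρ^ N) m))

  -- If f is dominated by the majorant, then convergence of the sums over cubes
  -- gives convergence of the sums over all finite sets.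
  sum-close : ∀ {m} (f : Vec ℕ m → Carrier) → (∀ ns → ‖ f ns ‖≤ majorant ns) → ∀ S →
    (cubes : O (λ N → N) (λ N → sumOver f (cube N m) - S)) →
    ∀ N F → Unique F → cube N m ⊆ F → ‖ sumOver f F - S ‖≤ (constant cubes ℝ.+ tailConstant m) ℝ.* ρ ℝ.^ N
  sum-close {m} f f≤ S cubes N F F-unique cube⊆F = ‖‖-cong (sym difference)
      (‖‖-mono (ℝ.≤-reflexive (ℝ.sym (ℝ.distribʳ _ _ _))) (‖‖-+ (bound cubes N)
        (‖‖-mono (majorant-tail N F H F-unique F↭) (‖sumOver‖ f f≤ H))))
    where
    part = complement (cube N m) F (cube-unique N m) cube⊆F
    H = proj₁ part
    F↭ = proj₂ part
    difference : sumOver f F - S ≈ (sumOver f (cube N m) - S) + sumOver f H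
    difference = trans (+-congʳ (trans (sumOver-↭ f F↭) (sumOver-++ f (cube N m) H)))
      (solve 3 (λ c h s → (c :+ h) :- s := (c :- s) :+ h) refl _ _ S)

-- The multiple series

module Chains {c ℓ₁ ℓ₂ a ℓ b} (ℛ : RealField c ℓ₁ ℓ₂) (𝒦 : NormedRing ℛ a ℓ b) (ρ : RealField.Carrier ℛ)
  (0≤ρ : OrderLemmas._≤_ ℛ (RealField.0# ℛ) ρ) (ρ<1 : RealField._<_ ℛ ρ (RealField.1# ℛ))
  (q : CommutativeRing.Carrier (NormedRing.commutativeRing 𝒦)) (‖q‖≤ρ : NormedRing.‖_‖≤_ 𝒦 q ρ)
  (F : QFactorials (NormedRing.commutativeRing 𝒦) q) where
  open NormedRing 𝒦
  open CommutativeRing commutativeRing hiding (zero)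
  open FiniteSums commutativeRing
  open ListSums commutativeRing
  open IntegerRingSolver commutativeRing
  open Exp semiring using (_^_; ^-congʳ; ^-homo-*)
  open Geometric ℛ ρ 0≤ρ ρ<1
  open Asymptotics ℛ 𝒦 ρ 0≤ρ ρ<1
  open QSeries commutativeRing q F
  open Transfer commutativeRing q F
  open QLimits ℛ 𝒦 ρ 0≤ρ ρ<1 q ‖q‖≤ρ F
  open Cubes
  open SetoidReasoning setoid
  private
    module ℝ where
      open RealField ℛ public
      open RealOrder ℛ public
      open Exp (CommutativeRing.semiring (RealField.commutativeRing ℛ)) public using (_^_)

  -- The summand of the multiple series, with an additional factor q^(l n₁).
  chain : ∀ {m} → ℕ → Vec ℕ m → Carrier
  chain l []       = 1#
  chain l (n ∷ ns) = (q ^ (n *ₙ suc l) * (inv n * inv n)) * chain n ns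

  -- The sums over cubes are iterates of the transfer operator.
  chain-cube : ∀ N m l → sumOver (chain l) (cube N m) ≈ T^ N m (λ _ → 1#) l
  chain-cube N zero    l = +-identityʳ 1#
  chain-cube N (suc m) l = trans (sumOver-cube N m (chain l))
    (∑-cong N (λ n → trans (sumOver-*ˡ _ (chain n) (cube N m)) (*-congˡ (chain-cube N m n))))

  -- ∏ᵢ 1/(q)_nᵢ²
  invDenominator : ∀ {m} → Vec ℕ m → Carrier
  invDenominator []       = 1#
  invDenominator (n ∷ ns) = (inv n * inv n) * invDenominator ns

  private
    -- The additional exponent l n₁.
    lead : ∀ {m} → ℕ → Vec ℕ m → ℕ
    lead l []      = 0
    lead l (n ∷ _) = n *ₙ l

  -- The function adjacent is ∑ nᵢ nᵢ₊₁, given by its recursion.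
  chain-closed : ∀ (adjacent : ∀ {m} → Vec ℕ m → ℕ) → adjacent [] ≡ 0 → (∀ n → adjacent (n ∷ []) ≡ 0) →
    (∀ {m} n n′ (ns : Vec ℕ m) → adjacent (n ∷ n′ ∷ ns) ≡ n *ₙ n′ +ₙ adjacent (n′ ∷ ns)) →
    ∀ {m} (ns : Vec ℕ m) → chain 0 ns ≈ q ^ (adjacent ns +ₙ Vec.sum ns) * invDenominator ns
  chain-closed adjacent adj₀ adj₁ adj₂ ns = trans (go 0 ns) (*-congʳ (^-congʳ q (≡.cong (_+ₙ (adjacent ns +ₙ Vec.sum ns)) (lead-0 ns))))
    where
    lead-0 : ∀ {m} (ns : Vec ℕ m) → lead 0 ns ≡ 0
    lead-0 []      = ≡.refl
    lead-0 (n ∷ _) = ℕ.*-zeroʳ n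
    adj : ∀ {m} n (ns : Vec ℕ m) → adjacent (n ∷ ns) ≡ lead n ns +ₙ adjacent ns
    adj n []        = ≡.trans (adj₁ n) (≡.sym adj₀)
    adj n (n′ ∷ ns) = ≡.trans (adj₂ n n′ ns) (≡.cong (_+ₙ adjacent (n′ ∷ ns)) (ℕ.*-comm n n′))
    go : ∀ {m} l (ns : Vec ℕ m) → chain l ns ≈ q ^ (lead l ns +ₙ (adjacent ns +ₙ Vec.sum ns)) * invDenominator ns
    go l []       = trans (sym (*-identityˡ 1#)) (*-congʳ (^-congʳ q (≡.sym (≡.trans (≡.cong (_+ₙ 0) adj₀) ≡.refl))))
    go l (n ∷ ns) = begin
      (q ^ (n *ₙ suc l) * (inv n * inv n)) * chain n ns
        ≈⟨ *-congˡ (go n ns) ⟩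
      (q ^ (n *ₙ suc l) * (inv n * inv n)) * (q ^ e * invDenominator ns)
        ≈⟨ solve 4 (λ x i y d → (x :* i) :* (y :* d) := (x :* y) :* (i :* d)) refl _ (inv n * inv n) _ _ ⟩
      (q ^ (n *ₙ suc l) * q ^ e) * invDenominator (n ∷ ns)
        ≈⟨ *-congʳ (trans (sym (^-homo-* q (n *ₙ suc l) e)) (^-congʳ q (≡.trans (identity n l (lead n ns) (adjacent ns) (Vec.sum ns))
             (≡.cong (λ k → n *ₙ l +ₙ (k +ₙ (n +ₙ Vec.sum ns))) (≡.sym (adj n ns)))))) ⟩
      q ^ (n *ₙ l +ₙ (adjacent (n ∷ ns) +ₙ (n +ₙ Vec.sum ns))) * invDenominator (n ∷ ns) ∎
      where
      e = lead n ns +ₙ (adjacent ns +ₙ Vec.sum ns)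
      identity : ∀ n l d j s → n *ₙ suc l +ₙ (d +ₙ (j +ₙ s)) ≡ n *ₙ l +ₙ ((d +ₙ j) +ₙ (n +ₙ s))
      identity = solve-∀

  private
    inv-bound : ℝ.Carrier
    inv-bound = constant O-inv ℝ.* ℝ.1#

  -- A bound for 1/(q)ₙ².
  κ : ℝ.Carrier
  κ = inv-bound ℝ.* inv-bound

  0≤κ : ℝ.0# ℝ.≤ κ
  0≤κ = ℝ.0≤x² inv-bound

  open Summability ℛ 𝒦 ρ 0≤ρ ρ<1 κ 0≤κ

  chain-majorant : ∀ {m} l (ns : Vec ℕ m) → ‖ chain l ns ‖≤ majorant ns
  chain-majorant l []       = ‖1‖≤1
  chain-majorant l (n ∷ ns) = ‖‖-* (‖‖-mono (ℝ.≤-reflexive (ℝ.*-comm _ κ))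
    (‖‖-* (‖‖-mono (ρ^-mono (ℕ.m≤m*n n (suc l))) (‖q^‖≤ρ^ (n *ₙ suc l))) (‖‖-* (bound O-inv n) (bound O-inv n)))) (chain-majorant n ns)

  -- If the sums over cubes tend to S, then S is the unconditional sum.
  chain-sum : ∀ m S → O (λ N → N) (λ N → T^ N m (λ _ → 1#) 0 - S) →
    ∃[ C ] ((ℝ.0# ℝ.≤ C) × (∀ N F → Unique F → cube N m ⊆ F → ‖ sumOver (chain 0) F - S ‖≤ C ℝ.* ρ ℝ.^ N))
  chain-sum m S close = constant cubes ℝ.+ tailConstant m , ℝ.+-nonneg (nonneg cubes) (tailConstant-nonneg m) ,
      sum-close (chain 0) (chain-majorant 0) S cubes
    where
    cubes : O (λ N → N) (λ N → sumOver (chain 0) (cube N m) - S)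
    cubes = O-cong (λ N → +-congʳ (sym (chain-cube N m 0))) close

module Evaluation {c ℓ₁ ℓ₂} (ℛ : RealField c ℓ₁ ℓ₂) (q : Complex.ℂ ℛ) (|q|<1 : Complex.∣_∣<_ ℛ q (RealField.1# ℛ)) where
  open RealField ℛ using () renaming (commutativeRing to ℝ-ring)
  open RealField ℛ hiding (zero; commutativeRing) renaming
    ( Carrier to ℝ; _+_ to _+ᵣ_; _*_ to _*ᵣ_; -_ to -ᵣ_; _-_ to _-ᵣ_
    ; 0# to 0ᵣ; 1# to 1ᵣ; _≈_ to _≈ᵣ_; ∣_∣<_ to ∣_∣ᵣ<_ )
  open RealOrder ℛ renaming (_≤_ to _≤ᵣ_)
  open IntegerRingSolver ℝ-ring
  open Complex ℛ
  open ComplexNorm ℛ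
  private
    module 𝕂 where
      open CommutativeRing ℂ-ring public
      open IntegerRingSolver ℂ-ring public
      open Exp semiring public using (^-congʳ)
      open ListSums ℂ-ring public using (sumOver-cong)

  -- A number ρ < 1 with |q| ≤ ρ, namely (1 + |q|²) / 2.
  private
    half = positive-inverse (+-pos-nonneg 0<1 0≤1)
    h = proj₁ half
    t = ∣ q ∣²

  ρ : ℝ
  ρ = h *ᵣ (1ᵣ +ᵣ t)

  0≤ρ : 0ᵣ ≤ᵣ ρ
  0≤ρ = *-nonneg (<⇒≤ (proj₁ (proj₂ half))) (+-nonneg 0≤1 (0≤x²+y² (re q) (im q)))

  ρ<1 : ρ < 1ᵣ
  ρ<1 = <-by (*-positive (proj₁ (proj₂ half)) (x<y⇒0<y-x (<-respʳ-≈ (*-identityˡ 1ᵣ) |q|<1)))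
    (trans (solve 2 (λ h t → h :* (con (pos 1) :- t) := h :* (con (pos 1) :+ con (pos 1)) :- h :* (con (pos 1) :+ t)) refl h t)
      (+-congʳ (proj₂ (proj₂ half))))

  |q|≤ρ : Bounded q ρ
  |q|≤ρ = 0≤ρ , ≤-by (0≤x² (h *ᵣ (1ᵣ -ᵣ t)))
    (trans (solve 2 (λ h t → (h :* (con (pos 1) :- t)) :* (h :* (con (pos 1) :- t))
        := (h :* (con (pos 1) :+ t)) :* (h :* (con (pos 1) :+ t)) :- (h :* (con (pos 1) :+ con (pos 1))) :* (h :* (con (pos 1) :+ con (pos 1))) :* t) refl h t)
      (+-congˡ (-‿cong (trans (*-congʳ (trans (*-cong (proj₂ (proj₂ half)) (proj₂ (proj₂ half))) (*-identityˡ 1ᵣ))) (*-identityˡ t)))))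

  open Geometric ℛ ρ 0≤ρ ρ<1 using (ρ^-mono; ρ^-small)
  open Asymptotics ℛ ℂ-normed ρ 0≤ρ ρ<1 using (O; nonneg; bound)

  bounded⇒< : ∀ {z B ε} → Bounded z B → B < ε → ∣ z ∣< ε
  bounded⇒< (0≤B , z≤B) B<ε = ≤-<-trans z≤B (<-square 0≤B B<ε)

  O⇒⟶ : ∀ {s L} → O (λ n → n) (λ n → s n - L) → s ⟶ L
  O⇒⟶ {s} {L} s→L ε 0<ε = proj₁ small , λ n N≤n → bounded⇒< {s n - L} (bound s→L n) (proj₂ small n N≤n)
    where small = ρ^-small (nonneg s→L) 0<ε

  bounded⇒<1 : ∀ {z} → Bounded z ρ → ∣ z ∣< 1ᵣ
  bounded⇒<1 {z} z≤ρ = bounded⇒< {z} z≤ρ ρ<1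

  -- (x; x)ₙ with its inverse obtained by division.
  factorials : ∀ x → ∣ x ∣< 1ᵣ → QFactorials ℂ-ring x
  factorials x x<1 = record
    { fact      = poch x x
    ; inv       = λ n → _/_ 1# (poch x x n) {{poch-nonzero x x<1 n}}
    ; fact-zero = 𝕂.refl
    ; fact-suc  = λ n → 𝕂.refl
    ; fact-inv  = λ n → 𝕂.trans (𝕂.*-comm (poch x x n) _) (/-* 1# (poch x x n) (poch-nonzero x x<1 n))
    }

  /-by : ∀ z w v (w≠0 : Nonzero w) → w * v ≈ 1# → _/_ z w {{w≠0}} ≈ z * v
  /-by z w v w≠0 wv≈1 = 𝕂.trans (𝕂.sym (𝕂.*-identityʳ z/w)) (𝕂.trans (𝕂.*-congˡ {z/w} (𝕂.sym wv≈1))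
      (𝕂.trans (𝕂.sym (𝕂.*-assoc z/w w v)) (𝕂.*-congʳ {v} (/-* z w w≠0))))
    where z/w = _/_ z w {{w≠0}}

  -- A number with a multiplicative inverse is nonzero.
  nonzero-by : ∀ z w → z * w ≈ 1# → Nonzero z
  nonzero-by z w zw≈1 = *-cancel-pos (0≤x²+y² (re w) (im w))
    (<-respʳ-≈ (sym (trans (*-comm ∣ w ∣² ∣ z ∣²) (trans (sym (∣∣²-* z w)) (trans (∣∣²-cong {z * w} {1#} zw≈1) ∣1∣²≈1)))) 0<1)

  ^-inverse : ∀ z w n → z * w ≈ 1# → z ^ n * w ^ n ≈ 1#
  ^-inverse z w zero    _    = 𝕂.*-identityˡ 1#
  ^-inverse z w (suc n) zw≈1 = 𝕂.trans (𝕂.solve 4 (λ z w a b → (z 𝕂.:* a) 𝕂.:* (w 𝕂.:* b) 𝕂.:= (z 𝕂.:* w) 𝕂.:* (a 𝕂.:* b)) 𝕂.refl z w (z ^ n) (w ^ n))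
    (𝕂.trans (𝕂.*-cong zw≈1 (^-inverse z w n zw≈1)) (𝕂.*-identityˡ 1#))

  private
    F : QFactorials ℂ-ring q
    F = factorials q |q|<1

  open QLimits ℛ ℂ-normed ρ 0≤ρ ρ<1 q |q|≤ρ F using (‖q^‖≤ρ^; O-pochhammer; D; δ; Dδ≈1; fact→D)
  open Chains ℛ ℂ-normed ρ 0≤ρ ρ<1 q |q|≤ρ F using (chain; chain-closed; chain-sum; invDenominator)
  open QFactorials F using (inv; fact-inv)

  summand≈chain : ∀ {m} (ns : Vec ℕ m) → summand q |q|<1 ns ≈ chain 0 ns
  summand≈chain ns = 𝕂.trans
    (/-by (q ^ (adjacentProducts ns +ₙ Vec.sum ns)) (denominator q ns) (invDenominator ns) (denominator-nonzero q |q|<1 ns) (inverse ns))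
    (𝕂.sym (chain-closed adjacentProducts ≡.refl (λ _ → ≡.refl) (λ _ _ _ → ≡.refl) ns))
    where
    inverse : ∀ {m} (ns : Vec ℕ m) → denominator q ns * invDenominator ns ≈ 1#
    inverse []       = 𝕂.*-identityˡ 1#
    inverse (n ∷ ns) = 𝕂.trans
      (𝕂.solve 4 (λ f d i e → (f 𝕂.:* (f 𝕂.:* 𝕂.con (pos 1)) 𝕂.:* d) 𝕂.:* ((i 𝕂.:* i) 𝕂.:* e) 𝕂.:= ((f 𝕂.:* i) 𝕂.:* (f 𝕂.:* i)) 𝕂.:* (d 𝕂.:* e)) 𝕂.refl
        (poch q q n) (denominator q ns) (inv n) (invDenominator ns))
      (𝕂.trans (𝕂.*-cong (𝕂.*-cong (fact-inv n) (fact-inv n)) (inverse ns))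
        (𝕂.solve 0 ((𝕂.con (pos 1) 𝕂.:* 𝕂.con (pos 1)) 𝕂.:* 𝕂.con (pos 1) 𝕂.:= 𝕂.con (pos 1)) 𝕂.refl))

  -- The identity for a series with m summation indices.
  Identity : ℕ → Set (c ⊔ ℓ₂)
  Identity m = ∃[ A ] ∃[ B ] ∃[ C ] ∃[ D ] (poch∞ q (q ^ (m +ₙ 3)) A
    × poch∞ (q ^ (m +ₙ 2)) (q ^ (m +ₙ 3)) B
    × poch∞ (q ^ (m +ₙ 3)) (q ^ (m +ₙ 3)) C
    × poch∞ q q D
    × (Σ[ D≠0 ∈ Nonzero D ] HasSum {I = Vec ℕ m} (summand q |q|<1)
        (_/_ (A * B * C) (D ^ (m +ₙ 1)) {{^-nonzero D (m +ₙ 1) D≠0}})))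

  module _ (d : ℕ) where
    private
      m = d +ₙ d
      p = q ^ (m +ₙ 3)
      w = q ^ (m +ₙ 2)

      |q^suc|≤ρ : ∀ n → 1 ℕ.≤ n → Bounded (q ^ n) ρ
      |q^suc|≤ρ n 1≤n = NormedRing.‖‖-mono ℂ-normed {q ^ n}
        (≤-trans (ρ^-mono 1≤n) (≤-reflexive (*-identityʳ ρ))) (‖q^‖≤ρ^ n)

      |p|≤ρ : Bounded p ρ
      |p|≤ρ = |q^suc|≤ρ (m +ₙ 3) (ℕ.≤-trans (ℕ.s≤s ℕ.z≤n) (ℕ.m≤n+m 3 m))

      |w|≤ρ : Bounded w ρ
      |w|≤ρ = |q^suc|≤ρ (m +ₙ 2) (ℕ.≤-trans (ℕ.s≤s ℕ.z≤n) (ℕ.m≤n+m 2 m))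

      G : QFactorials ℂ-ring p
      G = factorials p (bounded⇒<1 {p} |p|≤ρ)

      module P = QLimits ℛ ℂ-normed ρ 0≤ρ ρ<1 p |p|≤ρ G

      -- (a; p)_∞ for |a| ≤ ρ.
      product : ∀ a → Bounded a ρ → O (λ _ → 0) (poch a p) × ∃[ L ] O (λ n → n) (λ n → poch a p n - L)
      product a a≤ρ = O-pochhammer (poch a p) (λ n → a * p ^ n) 𝕂.refl (λ n → 𝕂.refl)
        (λ n → bounded-* {a} {p ^ n} a≤ρ (P.‖q^‖≤ρ^ n))

    identity-even : Identity m
    identity-even = A , B , P.D , D , O⇒⟶ {poch q p} A-limit , O⇒⟶ {poch w p} B-limit , O⇒⟶ {poch p p} P.fact→D , O⇒⟶ {poch q q} fact→D , D≠0 , sums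
      where
      A = proj₁ (proj₂ (product q |q|≤ρ))
      B = proj₁ (proj₂ (product w |w|≤ρ))
      A-limit = proj₂ (proj₂ (product q |q|≤ρ))
      B-limit = proj₂ (proj₂ (product w |w|≤ρ))
      D≠0 : Nonzero D
      D≠0 = nonzero-by D δ Dδ≈1
      Q = A * B * P.D
      S = Q * δ ^ suc m
      w≈ : w ≈ q ^ (suc d +ₙ suc d)
      w≈ = 𝕂.^-congʳ q (index d)
        where
        index : ∀ d → d +ₙ d +ₙ 2 ≡ suc d +ₙ suc d
        index = solve-∀
      p≈ : p ≈ q ^ suc (suc d +ₙ suc d)
      p≈ = 𝕂.^-congʳ q (index d)
        where
        index : ∀ d → d +ₙ d +ₙ 3 ≡ suc (suc d +ₙ suc d)
        index = solve-∀
      limit : _/_ Q (D ^ (m +ₙ 1)) {{^-nonzero D (m +ₙ 1) D≠0}} ≈ S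
      limit = /-by Q (D ^ (m +ₙ 1)) (δ ^ suc m) (^-nonzero D (m +ₙ 1) D≠0)
        (𝕂.trans (𝕂.*-congʳ {δ ^ suc m} (𝕂.^-congʳ D (ℕ.+-comm m 1))) (^-inverse D δ (suc m) Dδ≈1))
      close = chain-sum m S (CubeLimit.O-cube ℛ ℂ-normed ρ 0≤ρ ρ<1 q |q|≤ρ F p |p|≤ρ G d w w≈ p≈ (poch q p) (poch w p) A B
        𝕂.refl (λ n → 𝕂.refl) (proj₁ (product q |q|≤ρ)) A-limit 𝕂.refl (λ n → 𝕂.refl) B-limit)
      sums : HasSum {I = Vec ℕ m} (summand q |q|<1) (_/_ Q (D ^ (m +ₙ 1)) {{^-nonzero D (m +ₙ 1) D≠0}})
      sums ε 0<ε = Cubes.cube N m , λ H H-unique cube⊆H →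
          bounded⇒< {sumOver (summand q |q|<1) H - R}
            (NormedRing.‖‖-cong ℂ-normed
              (𝕂.+-cong (𝕂.sym (𝕂.sumOver-cong summand≈chain H)) (𝕂.-‿cong (𝕂.sym limit)))
              (proj₂ (proj₂ close) N H H-unique cube⊆H))
            (proj₂ small N ℕ.≤-refl)
        where
        R = _/_ Q (D ^ (m +ₙ 1)) {{^-nonzero D (m +ₙ 1) D≠0}}
        small = ρ^-small (proj₁ (proj₂ close)) 0<ε
        N = proj₁ small

open import Data.Nat.Base using (_≤_)

theorem5p2 : ∀ {c ℓ₁ ℓ₂} (ℛ : RealField c ℓ₁ ℓ₂) → let open Complex ℛ in
    (q : ℂ) (|q|<1 : ∣ q ∣< RealField.1# ℛ) (k : ℕ) → 1 ≤ k →
    ∃[ A ] ∃[ B ] ∃[ C ] ∃[ D ] (poch∞ q (q ^ (2 *ₙ k +ₙ 3)) A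
    × poch∞ (q ^ (2 *ₙ k +ₙ 2)) (q ^ (2 *ₙ k +ₙ 3)) B
    × poch∞ (q ^ (2 *ₙ k +ₙ 3)) (q ^ (2 *ₙ k +ₙ 3)) C
    × poch∞ q q D
    × (Σ[ D≠0 ∈ Nonzero D ]
    HasSum {I = Vec ℕ (2 *ₙ k)} (summand q |q|<1)
    (_/_ (A * B * C) (D ^ (2 *ₙ k +ₙ 1)) {{^-nonzero D (2 *ₙ k +ₙ 1) D≠0}})))
theorem5p2 ℛ q |q|<1 k _ = ≡.subst (Evaluation.Identity ℛ q |q|<1) (double k) (Evaluation.identity-even ℛ q |q|<1 k)
  where
  double : ∀ k → k +ₙ k ≡ 2 *ₙ k
  double = solve-∀
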